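{- Let $r$ be any constant. For any $\epsilon>0$, there is a two-sided adaptive algorithm for $\epsilon$-testing $r$-Decision List, and one for $\epsilon$-testing $r$-DNF, with respect to the uniform distribution, that makes $\tilde O(1/\epsilon)$ queries.
   Context: Boolean functions $f:\{0,1\}^n\to\{0,1\}$ are accessed through a membership-query oracle that returns $f(x)$ for a queried $x$. $f$ is $\epsilon$-far from a class $C$ (with respect to the uniform distribution) if $\Pr_{x}[f(x)\neq g(x)]\ge\epsilon$ for every $g\in C$, with $x$ uniform on $\{0,1\}^n$. A two-sided adaptive algorithm for $\epsilon$-testing $C$ is a randomized algorithm that, given $\epsilon$ and membership-query access to an arbitrary $f$ (and able to draw uniform random strings), chooses queries possibly adaptively, accepts with probability at least $2/3$ if $f\in C$, and rejects with probability at least $2/3$ if $f$ is $\epsilon$-far from every function in $C$. $\tilde O(T)$ means $O(T\cdot\mathrm{poly}(\log T))$. An $r$-term is a conjunction of at most $r$ literals. An $r$-decision list is a sequence $(T_1,\xi_1,a_1),\dots,(T_s,\xi_s,a_s)$ (any $s$) where $T_j$ are $r$-terms and $\xi_j,a_j\in\{0,1\}$, representing the function: if $T_1=\xi_1$ output $a_1$, else if $T_2=\xi_2$ output $a_2$, \dots, else if $T_s=\xi_s$ output $a_s$; $r$-Decision List is the class of all $r$-decision lists. An $r$-DNF is a disjunction (of any number) of $r$-terms; $r$-DNF is the class of all $r$-DNFs. -}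

module Defs where

open import Data.Bool using (Bool; true; false; if_then_else_; _∧_; _∨_)
open import Data.Nat using (ℕ; zero; suc; _+_; _*_; _^_; _≤_; _⊔_)
open import Data.Nat.Logarithm using (⌈log₂_⌉)
open import Data.Fin using (Fin)
open import Data.Vec using (Vec; []; _∷_; lookup)
open import Data.List using (List; []; _∷_; length; map; _++_; filter)
open import Data.Bool.ListAction using (all; any)
open import Data.Product using (Σ; _×_; _,_; ∃)
open import Relation.Binary.PropositionalEquality using (_≡_; _≢_)
open import Relation.Nullary using (¬_)
open import Data.Bool.Properties using () renaming (_≟_ to _≟ᵇ_)
open import Relation.Nullary.Decidable using (¬?)
open import Data.Integer using (ℤ; +_; ∣_∣)
open import Data.Rational using (ℚ; _/_; Positive; 1/_; ceiling)
  renaming (_*_ to _*ℚ_; _≤_ to _≤ℚ_)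
open import Data.Rational.Properties using (pos⇒nonZero)

Input : ℕ → Set
Input n = Vec Bool n

BoolFun : ℕ → Set
BoolFun n = Input n → Bool

allInputs : (n : ℕ) → List (Input n)
allInputs zero = [] ∷ []
allInputs (suc n) = map (true ∷_) (allInputs n) ++ map (false ∷_) (allInputs n)

disagreements : {n : ℕ} → BoolFun n → BoolFun n → ℕ
disagreements {n} f g = length (filter (λ x → ¬? (f x ≟ᵇ g x)) (allInputs n))

-- A literal: variable index and the required value (x_i if true, ¬x_i if false).
Literal : ℕ → Set
Literal n = Fin n × Bool

evalLit : {n : ℕ} → Literal n → Input n → Bool
evalLit (i , b) x = if b then lookup x i else (if lookup x i then false else true)

Term : ℕ → Set
Term n = List (Literal n)

evalTerm : {n : ℕ} → Term n → Input n → Bool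
evalTerm t x = all (λ l → evalLit l x) t

IsRTerm : {n : ℕ} → ℕ → Term n → Set
IsRTerm r t = length t ≤ r

-- A decision list: rules (T_j , ξ_j , a_j).  If T_j(x) = ξ_j output a_j.
-- If no rule fires we output 0; this does not change the class, since
-- appending the rule (empty term , 1 , 0) realises that default explicitly.
DecisionList : ℕ → Set
DecisionList n = List (Term n × Bool × Bool)

evalDL : {n : ℕ} → DecisionList n → Input n → Bool
evalDL [] x = false
evalDL ((T , ξ , a) ∷ rest) x =
  if (if evalTerm T x then ξ else (if ξ then false else true)) then a else evalDL rest x

data AllRTerms {n : ℕ} (r : ℕ) : DecisionList n → Set where
  []  : AllRTerms r []
  _∷_ : ∀ {T ξ a rest} → IsRTerm r T → AllRTerms r rest → AllRTerms r ((T , ξ , a) ∷ rest)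

InRDL : {n : ℕ} → ℕ → BoolFun n → Set
InRDL {n} r f = Σ (DecisionList n) λ L → AllRTerms r L × (∀ x → f x ≡ evalDL L x)

DNF : ℕ → Set
DNF n = List (Term n)

evalDNF : {n : ℕ} → DNF n → Input n → Bool
evalDNF D x = any (λ t → evalTerm t x) D

data AllRTermsDNF {n : ℕ} (r : ℕ) : DNF n → Set where
  []  : AllRTermsDNF r []
  _∷_ : ∀ {t rest} → IsRTerm r t → AllRTermsDNF r rest → AllRTermsDNF r (t ∷ rest)

InRDNF : {n : ℕ} → ℕ → BoolFun n → Set
InRDNF {n} r f = Σ (DNF n) λ D → AllRTermsDNF r D × (∀ x → f x ≡ evalDNF D x)

Class : Set₁
Class = (n : ℕ) → BoolFun n → Set

RDL : ℕ → Class
RDL r n f = InRDL r f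

RDNF : ℕ → Class
RDNF r n f = InRDNF r f

ℕtoℚ : ℕ → ℚ
ℕtoℚ k = (+ k) / 1

-- f is ε-far from C:  Pr_x[f x ≠ g x] ≥ ε for every g ∈ C,
-- i.e.  ε · 2^n ≤ #{x | f x ≠ g x}.
Far : (C : Class) {n : ℕ} → ℚ → BoolFun n → Set
Far C {n} ε f = ∀ g → C n g → (ε *ℚ ℕtoℚ (2 ^ n)) ≤ℚ ℕtoℚ (disagreements f g)

-- A deterministic adaptive query algorithm (decision tree): either halt
-- with an answer (true = accept), or query f at a point and continue
-- depending on the answer.
data QTree (n : ℕ) : Set where
  halt  : Bool → QTree n
  query : Input n → (Bool → QTree n) → QTree n

run : {n : ℕ} → QTree n → BoolFun n → Bool
run (halt b) f = b
run (query x k) f = run (k (f x)) f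

depth : {n : ℕ} → QTree n → ℕ
depth (halt _) = 0
depth (query x k) = suc (depth (k true) ⊔ depth (k false))

-- A randomized adaptive algorithm: it uses m uniformly random bits
-- (which also serve to draw uniform random strings), and for each outcome
-- ω ∈ {0,1}^m runs an adaptive deterministic query algorithm.
record RandAlg (n : ℕ) : Set where
  constructor randAlg
  field
    coins : ℕ
    tree  : Input coins → QTree n

open RandAlg public

queries : {n : ℕ} → RandAlg n → ℕ
queries A = maxList (map (λ ω → depth (tree A ω)) (allInputs (coins A)))
  where
  maxList : List ℕ → ℕ
  maxList [] = 0
  maxList (k ∷ ks) = k ⊔ maxList ks

outcomes : {n : ℕ} → RandAlg n → BoolFun n → Bool → ℕ
outcomes A f b = length (filter (λ ω → run (tree A ω) f ≟ᵇ b) (allInputs (coins A)))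

-- Pr_ω[A^f outputs b] ≥ 2/3, i.e. 3·#{ω | output b} ≥ 2·2^m.
ProbAtLeast2/3 : {n : ℕ} → RandAlg n → BoolFun n → Bool → Set
ProbAtLeast2/3 A f b = 2 * (2 ^ coins A) ≤ 3 * outcomes A f b

IsTester : (C : Class) {n : ℕ} → ℚ → RandAlg n → Set
IsTester C {n} ε A =
  (∀ f → C n f → ProbAtLeast2/3 A f true) ×
  (∀ f → Far C ε f → ProbAtLeast2/3 A f false)

ceilInv : (ε : ℚ) → .{{Positive ε}} → ℕ
ceilInv ε = ∣ ceiling ((1/ ε) {{pos⇒nonZero ε}}) ∣

-- The statement "C can be ε-tested with Õ(1/ε) queries": there are constants
-- c, k (depending only on C) such that for every ε > 0 and every n there is a
-- two-sided adaptive ε-tester for C making at most c · M · (⌈log₂ M⌉ + 1)^k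
-- queries, where M = ⌈1/ε⌉.
TestableWithSoftOInvEps : Class → Set
TestableWithSoftOInvEps C =
  Σ ℕ λ c → Σ ℕ λ k →
    (ε : ℚ) → .{{_ : Positive ε}} → (n : ℕ) →
      Σ (RandAlg n) λ A →
        IsTester C ε A ×
        (queries A ≤ c * ceilInv ε * (⌈log₂ ceilInv ε ⌉ + 1) ^ k)

{-# OPTIONS --safe #-}
module Submission where

-- Write r-decision lists as lists of rules T = 1 (an r-DNF is such a list with all
-- outputs 1).  Greedily choosing terms on disjoint variables, and recursing on the
-- literals of the chosen variables, shows that every list is 2 ^ (- p) · poly(p)-close
-- to a sublist of length poly(p), hence to a function g of the class that depends on
-- poly(p) variables.  Partition the variables into poly(p) random blocks, so that each
-- block contains at most one variable of g.  A block matters if resampling it changes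
-- f; a point w witnessing this makes u ↦ f (w with the block replaced by u) a literal,
-- which is tested by an affinity test together with x ∧ y, and whose variable τ is
-- read at any x as f (w, s + x) + f (w, s) for a random s.  Thus f is sampled together
-- with the bits x_τ of all found blocks, and accepted if some short list over the
-- blocks explains the samples.  Soundness is a union bound over these 2 ^ poly(p)
-- lists, each of which is a member of the class once blocks are renamed to variables.
-- For completeness, all queried points are uniformly distributed, so f and g are not
-- distinguished, and a block that matters for a sample but was not found in N tries
-- has probability at most max q (1 - q) ^ N ≤ 1 / (N + 1).  With p = O (log (1 / ε))
-- the number of queries is poly(p) / ε.

open import Defs
open import Data.Bool using (Bool; true; false; not; _∧_; _∨_; _xor_; if_then_else_)
open import Data.Bool.ListAction using (any; all)
open import Data.Bool.Properties
  using (xor-assoc; xor-comm; xor-same; xor-identityʳ; ∧-identityʳ; ∧-zeroʳ; ∧-comm; ∧-distribˡ-xor)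
  renaming (_≟_ to _≟ᵇ_)
open import Data.Bool.Solver using (module xor-∧-Solver)
open import Data.Empty using (⊥; ⊥-elim)
open import Data.Fin using (Fin; zero; suc; toℕ; fromℕ<; combine)
open import Data.Fin.Properties using (combine-injective; toℕ-fromℕ<; toℕ-injective; toℕ<n)
  renaming (_≟_ to _≟F_)
import Data.Integer as ℤ
import Data.Integer.DivMod as ℤ
import Data.Integer.Properties as ℤ
open import Data.List using (List; []; _∷_; length; map; _++_; filter; allFin; cartesianProduct;
    cartesianProductWith)
open import Data.List.Properties using (filter-++; length-++; ++-assoc; length-map; length-tabulate)
import Data.List.Membership.DecPropositional as DecMembership
open import Data.List.Membership.Propositional using (_∈_; find; lose)
open import Data.List.Membership.Propositional.Properties
  using (∈-++⁺ˡ; ∈-++⁺ʳ; ∈-map⁻; ∈-cartesianProduct⁺; ∈-cartesianProduct⁻; ∈-cartesianProductWith⁺;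
      ∈-cartesianProductWith⁻; ∈-allFin)
open import Data.List.Relation.Unary.All using (All; []; _∷_)
import Data.List.Relation.Unary.All as All
open import Data.List.Relation.Unary.Any using (Any; here; there; any?)
open import Data.Maybe using (Maybe; just; nothing)
import Data.Maybe as Maybe
open import Data.Nat using (ℕ; zero; suc; pred; _+_; _*_; _^_; _∸_; ⌊_/2⌋; ⌈_/2⌉; _≤_; _<_; _≤?_; _<?_; z≤n;
    s≤s; >-nonZero)
open import Data.Nat.Induction using (<-rec)
open import Data.Nat.Logarithm using (⌈log₂_⌉; ⌈log₂⌈n/2⌉⌉≡⌈log₂n⌉∸1; ⌈log₂⌉-mono-≤)
open import Data.Nat.Properties
open import Data.Nat.Tactic.RingSolver using (solve-∀)
open import Data.Product using (Σ; _×_; _,_; ∃; proj₁; proj₂)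
open import Data.Product.Properties using (≡-dec)
open import Data.Rational using (mkℚ; Positive)
import Data.Rational as ℚ
import Data.Rational.Properties as ℚ
import Data.Rational.Unnormalised as ℚᵘ
import Data.Rational.Unnormalised.Properties as ℚᵘ
open import Data.Sum using (_⊎_; inj₁; inj₂; [_,_]′)
import Data.Sum as Sum
open import Data.Unit using (⊤; tt)
open import Data.Vec using (Vec; []; _∷_; lookup; take; drop; _[_]≔_; replicate; zipWith; tabulate)
import Data.Vec as Vec
open import Data.Vec.Properties using
    (take++drop≡id; ++-injectiveˡ; ++-injectiveʳ; ∷-injectiveʳ; lookup-zipWith; lookup-replicate;
    lookup∘update; lookup∘update′; lookup∘tabulate)
import Data.Vec.Relation.Unary.All as VAll
open import Function using (_∘_; id)
open import Relation.Binary.PropositionalEquality using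
    (_≡_; _≢_; refl; sym; trans; cong; cong₂; subst; subst₂; module ≡-Reasoning)
open import Relation.Nullary using (¬_; Dec; does; yes; no)
open import Relation.Nullary.Decidable using (dec-true; dec-false)
open import Relation.Unary using (Decidable)

-- The obstacle is a circularity: f is only close to the short list g, so the queries should avoid
-- the points where they differ, and yet their number grows with the quality 2 ^ (- p) of the
-- approximation. As it grows only polynomially in p, taking p = C (log M + 1) with M = ⌈1/ε⌉ and a
-- large constant C makes 2 ^ p exceed M ^ 2 poly(p). Hypotheses are written over blocks so that
-- their number does not depend on n. Which blocks matter for g is never decided. It suffices that
-- the found blocks explain the drawn samples: the variables of all other blocks are fixed to the
-- values of one random point, and the class is closed under substituting constants. Soundness asks
-- nothing of the search: once partition and tries are fixed, so is the variable or constant that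
-- each block reads, and every hypothesis is one fixed member of the class before any sample is
-- drawn. The linear dependence on 1/ε rests on the bound 1 / (N + 1): a union over M poly(p) pairs
-- of a sample and a block asks only for N of that order.

private variable
  A B V W : Set
  n N γ δ : ℕ

-- Finite probability

⟦_⟧ : Bool → ℕ
⟦ true ⟧ = 1
⟦ false ⟧ = 0

⟦⟧-mono : ∀ {p q} → (p ≡ true → q ≡ true) → ⟦ p ⟧ ≤ ⟦ q ⟧
⟦⟧-mono {false} _ = z≤n
⟦⟧-mono {true} i rewrite i refl = ≤-refl

⟦⟧-not : ∀ p → ⟦ p ⟧ + ⟦ not p ⟧ ≡ 1
⟦⟧-not true = refl
⟦⟧-not false = refl

⟦⟧-∨ : ∀ p q → ⟦ p ∨ q ⟧ ≤ ⟦ p ⟧ + ⟦ q ⟧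
⟦⟧-∨ true q = s≤s z≤n
⟦⟧-∨ false q = ≤-refl

⟦⟧-∧ : ∀ p q → ⟦ p ∧ q ⟧ ≡ ⟦ p ⟧ * ⟦ q ⟧
⟦⟧-∧ true q = sym (+-identityʳ _)
⟦⟧-∧ false q = refl

∑ : ∀ n → (Input n → ℕ) → ℕ
∑ zero φ = φ []
∑ (suc n) φ = ∑ n (φ ∘ (true ∷_)) + ∑ n (φ ∘ (false ∷_))

∑-mono : {φ ψ : Input n → ℕ} → (∀ x → φ x ≤ ψ x) → ∑ n φ ≤ ∑ n ψ
∑-mono {zero} h = h []
∑-mono {suc n} h = +-mono-≤ (∑-mono (h ∘ (true ∷_))) (∑-mono (h ∘ (false ∷_)))

∑-cong : {φ ψ : Input n → ℕ} → (∀ x → φ x ≡ ψ x) → ∑ n φ ≡ ∑ n ψ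
∑-cong h = ≤-antisym (∑-mono (≤-reflexive ∘ h)) (∑-mono (≤-reflexive ∘ sym ∘ h))

∑-+ : (φ ψ : Input n → ℕ) → ∑ n (λ x → φ x + ψ x) ≡ ∑ n φ + ∑ n ψ
∑-+ {zero} φ ψ = refl
∑-+ {suc n} φ ψ
  rewrite ∑-+ (φ ∘ (true ∷_)) (ψ ∘ (true ∷_)) | ∑-+ (φ ∘ (false ∷_)) (ψ ∘ (false ∷_)) =
  interchange (∑ n (φ ∘ (true ∷_))) _ _ _
  where
  interchange : ∀ a b c d → (a + b) + (c + d) ≡ (a + c) + (b + d)
  interchange = solve-∀

∑-* : ∀ c (φ : Input n → ℕ) → ∑ n (λ x → c * φ x) ≡ c * ∑ n φ
∑-* {zero} c φ = refl
∑-* {suc n} c φ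
  rewrite ∑-* c (φ ∘ (true ∷_)) | ∑-* c (φ ∘ (false ∷_)) = sym (*-distribˡ-+ c _ _)

∑-const : ∀ n c → ∑ n (λ _ → c) ≡ 2 ^ n * c
∑-const zero c = sym (+-identityʳ c)
∑-const (suc n) c rewrite ∑-const n c = double (2 ^ n) c
  where
  double : ∀ a c → a * c + a * c ≡ (2 * a) * c
  double = solve-∀

∑-swap : ∀ m n (φ : Input m → Input n → ℕ) →
  ∑ m (λ x → ∑ n (φ x)) ≡ ∑ n (λ y → ∑ m (λ x → φ x y))
∑-swap zero n φ = refl
∑-swap (suc m) n φ
  rewrite ∑-swap m n (φ ∘ (true ∷_)) | ∑-swap m n (φ ∘ (false ∷_)) =
  sym (∑-+ {n} (λ y → ∑ m (λ x → φ (true ∷ x) y)) (λ y → ∑ m (λ x → φ (false ∷ x) y)))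

∑-++ : ∀ m n (φ : Input (m + n) → ℕ) →
  ∑ (m + n) φ ≡ ∑ m (λ x → ∑ n (λ y → φ (x Vec.++ y)))
∑-++ zero n φ = refl
∑-++ (suc m) n φ = cong₂ _+_ (∑-++ m n _) (∑-++ m n _)

length-filter-map : ∀ {P : B → Set} (P? : Decidable P) (g : A → B) xs →
  length (filter P? (map g xs)) ≡ length (filter (P? ∘ g) xs)
length-filter-map P? g [] = refl
length-filter-map P? g (x ∷ xs) with does (P? (g x))
... | true = cong suc (length-filter-map P? g xs)
... | false = length-filter-map P? g xs

length-filter-∑ : ∀ n {P : Input n → Set} (P? : Decidable P) →
  length (filter P? (allInputs n)) ≡ ∑ n (λ x → ⟦ does (P? x) ⟧)
length-filter-∑ zero P? with does (P? [])
... | true = refl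
... | false = refl
length-filter-∑ (suc n) P?
  rewrite filter-++ P? (map (true ∷_) (allInputs n)) (map (false ∷_) (allInputs n))
        | length-++ (filter P? (map (true ∷_) (allInputs n))) {filter P? (map (false ∷_) (allInputs n))}
        | length-filter-map P? (true ∷_) (allInputs n)
        | length-filter-map P? (false ∷_) (allInputs n) =
  cong₂ _+_ (length-filter-∑ n (P? ∘ (true ∷_))) (length-filter-∑ n (P? ∘ (false ∷_)))

search : ∀ n (P : Input n → Bool) → (∃ λ x → P x ≡ true) ⊎ (∀ x → P x ≡ false)
search zero P with P [] in eq
... | true = inj₁ ([] , eq)
... | false = inj₂ λ { [] → eq }
search (suc n) P with search n (P ∘ (true ∷_)) | search n (P ∘ (false ∷_))
... | inj₁ (x , p) | _ = inj₁ (true ∷ x , p)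
... | inj₂ _ | inj₁ (x , p) = inj₁ (false ∷ x , p)
... | inj₂ h | inj₂ k = inj₂ λ { (true ∷ x) → h x ; (false ∷ x) → k x }

-- A probability space whose outcomes are computed from uniformly random bits;
-- E φ is the sum of φ over all outcomes, that is size times the expectation.
record Source (A : Set) : Set where
  no-eta-equality
  field
    bits : ℕ
    draw : Input bits → A
    E : (A → ℕ) → ℕ
    E-draw : ∀ φ → E φ ≡ ∑ bits (φ ∘ draw)


open Source

size : Source A → ℕ
size S = 2 ^ bits S

size>0 : (S : Source A) → 0 < size S
size>0 S = m^n>0 2 (bits S)

infix 9 #
# : Source A → (A → Bool) → ℕ
# S P = E S (⟦_⟧ ∘ P)

module _ (S : Source A) where

  E-mono : {φ ψ : A → ℕ} → (∀ x → φ x ≤ ψ x) → E S φ ≤ E S ψ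
  E-mono {φ} {ψ} h = subst₂ _≤_ (sym (E-draw S φ)) (sym (E-draw S ψ)) (∑-mono (h ∘ draw S))

  E-cong : {φ ψ : A → ℕ} → (∀ x → φ x ≡ ψ x) → E S φ ≡ E S ψ
  E-cong h = ≤-antisym (E-mono (≤-reflexive ∘ h)) (E-mono (≤-reflexive ∘ sym ∘ h))

  E-+ : (φ ψ : A → ℕ) → E S (λ x → φ x + ψ x) ≡ E S φ + E S ψ
  E-+ φ ψ = trans (E-draw S _) (trans (∑-+ (φ ∘ draw S) (ψ ∘ draw S))
    (sym (cong₂ _+_ (E-draw S φ) (E-draw S ψ))))

  E-*ˡ : ∀ c (φ : A → ℕ) → E S (λ x → c * φ x) ≡ c * E S φ
  E-*ˡ c φ = trans (E-draw S _) (trans (∑-* c (φ ∘ draw S)) (cong (c *_) (sym (E-draw S φ))))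

  E-*ʳ : ∀ c (φ : A → ℕ) → E S (λ x → φ x * c) ≡ E S φ * c
  E-*ʳ c φ = trans (E-cong (λ x → *-comm (φ x) c)) (trans (E-*ˡ c φ) (*-comm c _))

  E-const : ∀ c → E S (λ _ → c) ≡ size S * c
  E-const c = trans (E-draw S _) (∑-const (bits S) c)

  E-swap : (T : Source B) (φ : A → B → ℕ) →
    E S (λ x → E T (φ x)) ≡ E T (λ y → E S (λ x → φ x y))
  E-swap T φ = begin
    E S (λ x → E T (φ x))
      ≡⟨ E-cong (λ x → E-draw T (φ x)) ⟩
    E S (λ x → ∑ (bits T) (φ x ∘ draw T))
      ≡⟨ E-draw S _ ⟩
    ∑ (bits S) (λ s → ∑ (bits T) (λ t → φ (draw S s) (draw T t)))
      ≡⟨ ∑-swap (bits S) (bits T) _ ⟩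
    ∑ (bits T) (λ t → ∑ (bits S) (λ s → φ (draw S s) (draw T t)))
      ≡⟨ ∑-cong (λ t → sym (E-draw S (λ x → φ x (draw T t)))) ⟩
    ∑ (bits T) (λ t → E S (λ x → φ x (draw T t)))
      ≡⟨ sym (E-draw T (λ y → E S (λ x → φ x y))) ⟩
    E T (λ y → E S (λ x → φ x y)) ∎
    where open ≡-Reasoning

  #-mono : {P Q : A → Bool} → (∀ x → P x ≡ true → Q x ≡ true) → # S P ≤ # S Q
  #-mono h = E-mono (λ x → ⟦⟧-mono (h x))

  #-not : (P : A → Bool) → # S P + # S (not ∘ P) ≡ size S
  #-not P = trans (sym (E-+ _ _)) (trans (E-cong (λ x → ⟦⟧-not (P x)))
    (trans (E-const 1) (*-identityʳ _)))

  #-witness : (P : A → Bool) → # S P < size S → ∃ λ x → P x ≡ false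
  #-witness P lt with search (bits S) (not ∘ P ∘ draw S)
  ... | inj₁ (s , e) = draw S s , not-true e
    where
    not-true : ∀ {p} → not p ≡ true → p ≡ false
    not-true {false} _ = refl
  ... | inj₂ h = ⊥-elim (<-irrefl full lt)
    where
    not-false : ∀ {p} → not p ≡ false → ⟦ p ⟧ ≡ 1
    not-false {true} _ = refl
    full : # S P ≡ size S
    full = trans (E-draw S _) (trans (∑-cong (λ s → not-false (h s)))
      (trans (∑-const (bits S) 1) (*-identityʳ _)))

cube : ∀ n → Source (Input n)
cube n .bits = n
cube n .draw x = x
cube n .E = ∑ n
cube n .E-draw φ = refl

infixr 2 _⊗_
-- The sum over a product is an iterated sum by definition, so fixing the first component of a
-- random pair is a computation rather than a lemma.
_⊗_ : Source A → Source B → Source (A × B)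
(S ⊗ T) .bits = bits S + bits T
(S ⊗ T) .draw ω = draw S (take (bits S) ω) , draw T (drop (bits S) ω)
(S ⊗ T) .E φ = E S λ x → E T λ y → φ (x , y)
(S ⊗ T) .E-draw φ = begin
  E S (λ x → E T (λ y → φ (x , y)))
    ≡⟨ E-cong S (λ x → E-draw T (λ y → φ (x , y))) ⟩
  E S (λ x → ∑ (bits T) (λ t → φ (x , draw T t)))
    ≡⟨ E-draw S _ ⟩
  ∑ (bits S) (λ s → ∑ (bits T) (λ t → φ (draw S s , draw T t)))
    ≡⟨ ∑-cong (λ s → ∑-cong (λ t → sym (cong₂ (λ s t → φ (draw S s , draw T t))
         (++-injectiveˡ _ s (take++drop≡id (bits S) (s Vec.++ t)))
         (++-injectiveʳ _ s (take++drop≡id (bits S) (s Vec.++ t)))))) ⟩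
  _ ≡⟨ sym (∑-++ (bits S) (bits T) _) ⟩
  _ ∎
  where open ≡-Reasoning

size-⊗ : (S : Source A) (T : Source B) → size (S ⊗ T) ≡ size S * size T
size-⊗ S T = ^-distribˡ-+-* 2 (bits S) (bits T)

mapS : (A → B) → Source A → Source B
mapS h S .bits = bits S
mapS h S .draw = h ∘ draw S
mapS h S .E φ = E S (φ ∘ h)
mapS h S .E-draw φ = E-draw S (φ ∘ h)

vec : ∀ k → Source A → Source (Vec A k)
vec zero S .bits = 0
vec zero S .draw _ = []
vec zero S .E φ = φ []
vec zero S .E-draw φ = refl
vec (suc k) S = mapS (λ (a , v) → a ∷ v) (S ⊗ vec k S)

anyF allF : ∀ {k} → (Fin k → Bool) → Bool
anyF {zero} P = false
anyF {suc k} P = P zero ∨ anyF (P ∘ suc)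
allF {zero} P = true
allF {suc k} P = P zero ∧ allF (P ∘ suc)

∧-true : ∀ {p q} → p ≡ true → q ≡ true → p ∧ q ≡ true
∧-true refl refl = refl

∧-trueˡ : ∀ {p q} → p ∧ q ≡ true → p ≡ true
∧-trueˡ {true} _ = refl

∧-trueʳ : ∀ {p q} → p ∧ q ≡ true → q ≡ true
∧-trueʳ {true} e = e

∨-falseˡ : ∀ {p q} → p ∨ q ≡ false → p ≡ false
∨-falseˡ {false} _ = refl

∨-falseʳ : ∀ {p q} → p ∨ q ≡ false → q ≡ false
∨-falseʳ {false} e = e

∨-trueʳ : ∀ p {q} → q ≡ true → p ∨ q ≡ true
∨-trueʳ true _ = refl
∨-trueʳ false e = e

anyF-false : ∀ {k} {P : Fin k → Bool} → anyF P ≡ false → ∀ i → P i ≡ false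
anyF-false {suc k} e zero = ∨-falseˡ e
anyF-false {suc k} e (suc i) = anyF-false (∨-falseʳ e) i

allF-intro : ∀ {k} {P : Fin k → Bool} → (∀ i → P i ≡ true) → allF P ≡ true
allF-intro {zero} h = refl
allF-intro {suc k} h = ∧-true (h zero) (allF-intro (h ∘ suc))

allF-elim : ∀ {k} {P : Fin k → Bool} → allF P ≡ true → ∀ i → P i ≡ true
allF-elim {suc k} e zero = ∧-trueˡ e
allF-elim {suc k} e (suc i) = allF-elim (∧-trueʳ e) i

-- The event P has probability at most a / b.
record Rare (S : Source A) (P : A → Bool) (a b : ℕ) : Set where
  constructor rare
  field bound : # S P * b ≤ a * size S

open Rare

module _ {S : Source A} where

  rare-mono : ∀ {P Q a b} → (∀ x → P x ≡ true → Q x ≡ true) → Rare S Q a b → Rare S P a b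
  rare-mono {b = b} h r .bound = ≤-trans (*-monoˡ-≤ b (#-mono S h)) (bound r)

  rare-false : ∀ {P} a b → (∀ x → P x ≡ false) → Rare S P a b
  rare-false {P} a b h .bound = subst (λ k → k * b ≤ a * size S)
    (sym (trans (E-cong S (cong ⟦_⟧ ∘ h)) (trans (E-const S 0) (*-zeroʳ (size S))))) z≤n

  rare-∨ : ∀ {P Q a b c} → Rare S P a c → Rare S Q b c → Rare S (λ x → P x ∨ Q x) (a + b) c
  rare-∨ {P} {Q} {a} {b} {c} r s .bound = begin
    # S (λ x → P x ∨ Q x) * c      ≤⟨ *-monoˡ-≤ c (E-mono S (λ x → ⟦⟧-∨ (P x) (Q x))) ⟩
    E S (λ x → ⟦ P x ⟧ + ⟦ Q x ⟧) * c ≡⟨ cong (_* c) (E-+ S _ _) ⟩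
    (# S P + # S Q) * c             ≡⟨ *-distribʳ-+ c (# S P) (# S Q) ⟩
    # S P * c + # S Q * c           ≤⟨ +-mono-≤ (bound r) (bound s) ⟩
    a * size S + b * size S         ≡⟨ *-distribʳ-+ (size S) a b ⟨
    (a + b) * size S                ∎
    where open ≤-Reasoning

  rare-anyF : ∀ {k a c} {P : Fin k → A → Bool} →
    (∀ i → Rare S (P i) a c) → Rare S (λ x → anyF λ i → P i x) (k * a) c
  rare-anyF {zero} {a} {c} r = rare-false 0 c (λ _ → refl)
  rare-anyF {suc k} {a} {c} {P} r =
    rare-∨ {a = a} {b = k * a} {c = c} (r zero) (rare-anyF {k} {a} {c} (r ∘ suc))

  rare-any : ∀ {C : Set} {a c} {P : C → A → Bool} hs →
    (∀ {h} → h ∈ hs → Rare S (P h) a c) → Rare S (λ x → any (λ h → P h x) hs) (length hs * a) c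
  rare-any {c = c} [] r = rare-false 0 c (λ _ → refl)
  rare-any {a = a} {c} {P} (h ∷ hs) r =
    rare-∨ {a = a} {b = length hs * a} {c = c} (r (here refl)) (rare-any hs (r ∘ there))

  rare-scale : ∀ {P a b c d} → 0 < b → a * d ≤ c * b → Rare S P a b → Rare S P c d
  rare-scale {P} {a} {b} {c} {d} b>0 h r .bound = *-cancelʳ-≤ _ _ b {{>-nonZero b>0}} (begin
    # S P * d * b       ≡⟨ exch (# S P) d b ⟩
    # S P * b * d       ≤⟨ *-monoˡ-≤ d (bound r) ⟩
    a * size S * d      ≡⟨ exch a (size S) d ⟩
    a * d * size S      ≤⟨ *-monoˡ-≤ (size S) h ⟩
    c * b * size S      ≡⟨ exch c b (size S) ⟩
    c * size S * b      ∎)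
    where
    open ≤-Reasoning
    exch : ∀ x y z → x * y * z ≡ x * z * y
    exch = solve-∀

module _ {S : Source A} {T : Source B} where

  rare-fixˡ : ∀ {P a b} → (∀ x → Rare T (λ y → P (x , y)) a b) → Rare (S ⊗ T) P a b
  rare-fixˡ {P} {a} {b} r .bound = begin
    # (S ⊗ T) P * b                       ≡⟨ E-*ʳ S b _ ⟨
    E S (λ x → # T (λ y → P (x , y)) * b) ≤⟨ E-mono S (bound ∘ r) ⟩
    E S (λ x → a * size T)                ≡⟨ E-const S _ ⟩
    size S * (a * size T)                 ≡⟨ exch (size S) a (size T) ⟩
    a * (size S * size T)                 ≡⟨ cong (a *_) (size-⊗ S T) ⟨
    a * size (S ⊗ T)                      ∎
    where
    open ≤-Reasoning
    exch : ∀ x y z → x * (y * z) ≡ y * (x * z)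
    exch = solve-∀

  E-⊗-swap : ∀ φ → E (S ⊗ T) φ ≡ E (T ⊗ S) (λ (y , x) → φ (x , y))
  E-⊗-swap φ = E-swap S T (λ x y → φ (x , y))

  rare-∧ : ∀ {P Q a b c d} → Rare S P a b → Rare T Q c d →
    Rare (S ⊗ T) (λ (x , y) → P x ∧ Q y) (a * c) (b * d)
  rare-∧ {P} {Q} {a} {b} {c} {d} r s .bound = begin
    # (S ⊗ T) (λ (x , y) → P x ∧ Q y) * (b * d)
      ≡⟨ cong (_* (b * d)) (E-cong S λ x → trans (E-cong T λ y → ⟦⟧-∧ (P x) (Q y)) (E-*ˡ T ⟦ P x ⟧ _)) ⟩
    E S (λ x → ⟦ P x ⟧ * # T Q) * (b * d)
      ≡⟨ cong (_* (b * d)) (E-*ʳ S (# T Q) _) ⟩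
    # S P * # T Q * (b * d)         ≡⟨ exch (# S P) (# T Q) b d ⟩
    # S P * b * (# T Q * d)         ≤⟨ *-mono-≤ (bound r) (bound s) ⟩
    a * size S * (c * size T)       ≡⟨ exch a (size S) c (size T) ⟩
    a * c * (size S * size T)       ≡⟨ cong (a * c *_) (size-⊗ S T) ⟨
    a * c * size (S ⊗ T) ∎
    where
    open ≤-Reasoning
    exch : ∀ x y z w → x * y * (z * w) ≡ x * z * (y * w)
    exch = solve-∀

rare-fixʳ : ∀ {S : Source A} {T : Source B} {P a b} →
  (∀ y → Rare S (λ x → P (x , y)) a b) → Rare (S ⊗ T) P a b
rare-fixʳ {S = S} {T} {P} {a} {b} r .bound = subst₂ (λ k l → k * b ≤ a * l)
  (sym (E-⊗-swap {S = S} {T} (⟦_⟧ ∘ P)))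
  (trans (size-⊗ T S) (trans (*-comm (size T) (size S)) (sym (size-⊗ S T))))
  (bound (rare-fixˡ {S = T} {T = S} {P = λ (y , x) → P (x , y)} {a} {b} r))

rare-all : ∀ k {S : Source A} {P a b} → Rare S P a b →
  Rare (vec k S) (λ v → allF λ i → P (lookup v i)) (a ^ k) (b ^ k)
rare-all zero r .bound = ≤-refl
rare-all (suc k) {S} {P} {a} {b} r .bound = bound
  (rare-∧ {S = S} {T = vec k S} {P = P} {Q = λ v → allF λ i → P (lookup v i)} {a = a} {b} {a ^ k} {b ^ k} r
      (rare-all k {S} {P} {a} {b} r))

E-resample : ∀ k (S : Source A) (i : Fin k) φ →
  E (vec k S) (λ v → E S λ a → φ (v [ i ]≔ a)) ≡ size S * E (vec k S) φ
E-resample (suc k) S zero φ = trans (E-const S _)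
  (cong (size S *_) (E-swap (vec k S) S (λ v a → φ (a ∷ v))))
E-resample (suc k) S (suc i) φ =
  trans (E-cong S λ a → E-resample k S i (φ ∘ (a ∷_))) (E-*ˡ S (size S) _)

-- Since the coordinates are independent, coordinate i may be drawn afresh after all others have
-- been fixed, and the event may be bounded for each choice of the others separately.
rare-resample : ∀ {k} {S : Source A} {T : Source B} (i : Fin k) {P a b} →
  (∀ v → Rare (S ⊗ T) (λ (x , y) → P (v [ i ]≔ x , y)) a b) → Rare (vec k S ⊗ T) P a b
rare-resample {k = k} {S} {T} i {P} {a} {b} r .bound = *-cancelˡ-≤ (size S) {{>-nonZero (size>0 S)}} (begin
  size S * (# (vec k S ⊗ T) P * b)
    ≡⟨ *-assoc (size S) _ b ⟨
  size S * # (vec k S ⊗ T) P * b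
    ≡⟨ cong (_* b) (E-resample k S i (λ v → # T (λ y → P (v , y)))) ⟨
  E (vec k S) (λ v → # (S ⊗ T) (λ (x , y) → P (v [ i ]≔ x , y))) * b
    ≡⟨ E-*ʳ (vec k S) b _ ⟨
  E (vec k S) (λ v → # (S ⊗ T) (λ (x , y) → P (v [ i ]≔ x , y)) * b)
    ≤⟨ E-mono (vec k S) (bound ∘ r) ⟩
  E (vec k S) (λ _ → a * size (S ⊗ T))
    ≡⟨ E-const (vec k S) _ ⟩
  size (vec k S) * (a * size (S ⊗ T))
    ≡⟨ cong (λ z → size (vec k S) * (a * z)) (size-⊗ S T) ⟩
  size (vec k S) * (a * (size S * size T))
    ≡⟨ exch (size (vec k S)) a (size S) (size T) ⟩
  size S * (a * (size (vec k S) * size T))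
    ≡⟨ cong (λ z → size S * (a * z)) (size-⊗ (vec k S) T) ⟨
  size S * (a * size (vec k S ⊗ T)) ∎)
  where
  open ≤-Reasoning
  exch : ∀ v a s t → v * (a * (s * t)) ≡ s * (a * (v * t))
  exch = solve-∀

-- The image of `O` under `g` has the distribution of `S`, expressed through all test functions φ
-- and multiplied out by both sizes to stay in ℕ.
record Marginal {Ω : Set} (O : Source Ω) (S : Source A) (g : Ω → A) : Set where
  constructor marginal
  field law : ∀ φ → E O (φ ∘ g) * size S ≡ size O * E S φ

open Marginal

rare-marginal : ∀ {Ω : Set} {O : Source Ω} {S : Source A} {g : Ω → A} {P a b} →
  Marginal O S g → Rare S P a b → Rare O (P ∘ g) a b
rare-marginal {O = O} {S} {g} {P} {a} {b} μ r .bound = *-cancelʳ-≤ _ _ (size S) {{>-nonZero (size>0 S)}} (begin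
  # O (P ∘ g) * b * size S   ≡⟨ exch (# O (P ∘ g)) b (size S) ⟩
  # O (P ∘ g) * size S * b   ≡⟨ cong (_* b) (law μ (⟦_⟧ ∘ P)) ⟩
  size O * # S P * b         ≡⟨ *-assoc (size O) _ b ⟩
  size O * (# S P * b)       ≤⟨ *-monoʳ-≤ (size O) (bound r) ⟩
  size O * (a * size S)      ≡⟨ exch′ (size O) a (size S) ⟩
  a * size O * size S        ∎)
  where
  open ≤-Reasoning
  exch : ∀ x y z → x * y * z ≡ x * z * y
  exch = solve-∀
  exch′ : ∀ x y z → x * (y * z) ≡ y * x * z
  exch′ = solve-∀

marginal-id : {S : Source A} → Marginal S S id
marginal-id {S = S} .law φ = *-comm _ (size S)

marginal-∘ : ∀ {Ω : Set} {O : Source Ω} {S : Source A} {T : Source B} {g : Ω → A} {h : A → B} →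
  Marginal S T h → Marginal O S g → Marginal O T (h ∘ g)
marginal-∘ {O = O} {S} {T} {g} {h} ν μ .law φ = *-cancelʳ-≡ _ _ (size S) {{>-nonZero (size>0 S)}} (begin
  E O (φ ∘ h ∘ g) * size T * size S    ≡⟨ exch (E O (φ ∘ h ∘ g)) (size T) (size S) ⟩
  E O (φ ∘ h ∘ g) * size S * size T    ≡⟨ cong (_* size T) (law μ (φ ∘ h)) ⟩
  size O * E S (φ ∘ h) * size T        ≡⟨ *-assoc (size O) _ (size T) ⟩
  size O * (E S (φ ∘ h) * size T)      ≡⟨ cong (size O *_) (law ν φ) ⟩
  size O * (size S * E T φ)            ≡⟨ exch′ (size O) (size S) (E T φ) ⟩
  size O * E T φ * size S              ∎)
  where
  open ≡-Reasoning
  exch : ∀ x y z → x * y * z ≡ x * z * y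
  exch = solve-∀
  exch′ : ∀ x y z → x * (y * z) ≡ x * z * y
  exch′ = solve-∀

marginal-⊗ : ∀ {Ω Ω′ : Set} {O : Source Ω} {O′ : Source Ω′} {S : Source A} {T : Source B} {g h} →
  Marginal O S g → Marginal O′ T h → Marginal (O ⊗ O′) (S ⊗ T) (λ (x , y) → g x , h y)
marginal-⊗ {O = O} {O′} {S} {T} {g} {h} μ ν .law φ = begin
  E O (λ x → E O′ (λ y → φ (g x , h y))) * size (S ⊗ T)
    ≡⟨ cong (E (O ⊗ O′) (λ (x , y) → φ (g x , h y)) *_) (size-⊗ S T) ⟩
  E O (λ x → E O′ (λ y → φ (g x , h y))) * (size S * size T)
    ≡⟨ exch (E O (λ x → E O′ (λ y → φ (g x , h y)))) (size S) (size T) ⟩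
  E O (λ x → E O′ (λ y → φ (g x , h y))) * size T * size S
    ≡⟨ cong (_* size S) (E-*ʳ O (size T) _) ⟨
  E O (λ x → E O′ (λ y → φ (g x , h y)) * size T) * size S
    ≡⟨ cong (_* size S) (E-cong O (λ x → law ν (λ y → φ (g x , y)))) ⟩
  E O (λ x → size O′ * E T (λ y → φ (g x , y))) * size S
    ≡⟨ cong (_* size S) (E-*ˡ O (size O′) _) ⟩
  size O′ * E O (λ x → E T (λ y → φ (g x , y))) * size S
    ≡⟨ *-assoc (size O′) _ (size S) ⟩
  size O′ * (E O (λ x → E T (λ y → φ (g x , y))) * size S)
    ≡⟨ cong (size O′ *_) (law μ (λ x → E T (λ y → φ (x , y)))) ⟩
  size O′ * (size O * E (S ⊗ T) φ)
    ≡⟨ exch′ (size O′) (size O) _ ⟩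
  size O * size O′ * E (S ⊗ T) φ
    ≡⟨ cong (_* E (S ⊗ T) φ) (size-⊗ O O′) ⟨
  size (O ⊗ O′) * E (S ⊗ T) φ ∎
  where
  open ≡-Reasoning
  exch : ∀ x y z → x * (y * z) ≡ x * z * y
  exch = solve-∀
  exch′ : ∀ x y z → x * (y * z) ≡ y * x * z
  exch′ = solve-∀

marginal-proj₁ : {S : Source A} {T : Source B} → Marginal (S ⊗ T) S proj₁
marginal-proj₁ {S = S} {T} .law φ = begin
  E S (λ x → E T (λ _ → φ x)) * size S  ≡⟨ cong (_* size S) (E-cong S (λ x → E-const T (φ x))) ⟩
  E S (λ x → size T * φ x) * size S     ≡⟨ cong (_* size S) (E-*ˡ S (size T) φ) ⟩
  size T * E S φ * size S               ≡⟨ exch (size T) (E S φ) (size S) ⟩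
  size S * size T * E S φ               ≡⟨ cong (_* E S φ) (size-⊗ S T) ⟨
  size (S ⊗ T) * E S φ                  ∎
  where
  open ≡-Reasoning
  exch : ∀ x y z → x * y * z ≡ z * x * y
  exch = solve-∀

marginal-proj₂ : {S : Source A} {T : Source B} → Marginal (S ⊗ T) T proj₂
marginal-proj₂ {S = S} {T} .law φ = begin
  E S (λ _ → E T φ) * size T   ≡⟨ cong (_* size T) (E-const S _) ⟩
  size S * E T φ * size T      ≡⟨ exch (size S) (E T φ) (size T) ⟩
  size S * size T * E T φ      ≡⟨ cong (_* E T φ) (size-⊗ S T) ⟨
  size (S ⊗ T) * E T φ         ∎
  where
  open ≡-Reasoning
  exch : ∀ x y z → x * y * z ≡ x * z * y
  exch = solve-∀

marginal-lookup : ∀ {k} {S : Source A} (i : Fin k) → Marginal (vec k S) S (λ v → lookup v i)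
marginal-lookup {k = suc k} {S} zero .law = law (marginal-proj₁ {S = S} {vec k S})
marginal-lookup {k = suc k} {S} (suc i) .law =
  law (marginal-∘ {O = S ⊗ vec k S} (marginal-lookup {S = S} i) (marginal-proj₂ {S = S}))

-- The cube

infixl 6 _⊕_
infixl 7 _&_

_⊕_ _&_ : Input n → Input n → Input n
_⊕_ = zipWith _xor_
_&_ = zipWith _∧_

⊕-comm : (x y : Input n) → x ⊕ y ≡ y ⊕ x
⊕-comm [] [] = refl
⊕-comm (a ∷ x) (b ∷ y) = cong₂ _∷_ (xor-comm a b) (⊕-comm x y)

⊕-assoc : (x y z : Input n) → (x ⊕ y) ⊕ z ≡ x ⊕ (y ⊕ z)
⊕-assoc [] [] [] = refl
⊕-assoc (a ∷ x) (b ∷ y) (c ∷ z) = cong₂ _∷_ (xor-assoc a b c) (⊕-assoc x y z)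

xor-cancel : ∀ a b → a xor (a xor b) ≡ b
xor-cancel a b = trans (sym (xor-assoc a a b)) (cong (_xor b) (xor-same a))

xor-≡ : ∀ {a b} → a xor b ≡ false → a ≡ b
xor-≡ {false} {false} _ = refl
xor-≡ {true} {true} _ = refl

xor-false : ∀ {a b} → a ≡ b → a xor b ≡ false
xor-false {a} refl = xor-same a

⊕-cancel : (x y : Input n) → x ⊕ (x ⊕ y) ≡ y
⊕-cancel [] [] = refl
⊕-cancel (a ∷ x) (b ∷ y) = cong₂ _∷_ (xor-cancel a b) (⊕-cancel x y)

&-comm : (x y : Input n) → x & y ≡ y & x
&-comm [] [] = refl
&-comm (a ∷ x) (b ∷ y) = cong₂ _∷_ (∧-comm a b) (&-comm x y)

&-distribˡ-⊕ : (x y z : Input n) → x & (y ⊕ z) ≡ (x & y) ⊕ (x & z)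
&-distribˡ-⊕ [] [] [] = refl
&-distribˡ-⊕ (a ∷ x) (b ∷ y) (c ∷ z) = cong₂ _∷_ (∧-distribˡ-xor a b c) (&-distribˡ-⊕ x y z)

∑-shift : (a : Input n) (φ : Input n → ℕ) → ∑ n (λ x → φ (x ⊕ a)) ≡ ∑ n φ
∑-shift [] φ = refl
∑-shift (true ∷ a) φ =
  trans (cong₂ _+_ (∑-shift a (φ ∘ (false ∷_))) (∑-shift a (φ ∘ (true ∷_)))) (+-comm (∑ _ (φ ∘ (false ∷_))) _)
∑-shift (false ∷ a) φ = cong₂ _+_ (∑-shift a (φ ∘ (true ∷_))) (∑-shift a (φ ∘ (false ∷_)))

∑-shiftˡ : (a : Input n) (φ : Input n → ℕ) → ∑ n (λ x → φ (a ⊕ x)) ≡ ∑ n φ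
∑-shiftˡ a φ = trans (∑-cong (λ x → cong φ (⊕-comm a x))) (∑-shift a φ)

rare-shift : ∀ (a : Input n) {P k l} → Rare (cube n) P k l → Rare (cube n) (λ x → P (x ⊕ a)) k l
rare-shift a {P} {k} {l} r .bound = subst (λ z → z * l ≤ k * _) (sym (∑-shift a (⟦_⟧ ∘ P))) (bound r)

mix : (Fin n → Bool) → Input n → Input n → Input n
mix S [] [] = []
mix S (a ∷ x) (b ∷ y) = (if S zero then b else a) ∷ mix (S ∘ suc) x y

lookup-mix : (S : Fin n → Bool) (x y : Input n) (i : Fin n) →
  lookup (mix S x y) i ≡ (if S i then lookup y i else lookup x i)
lookup-mix S (a ∷ x) (b ∷ y) zero = refl
lookup-mix S (a ∷ x) (b ∷ y) (suc i) = lookup-mix (S ∘ suc) x y i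

-- Exchanging the coordinates in S between x and y is a bijection on pairs of points. This is why a
-- uniform point with a resampled block is again uniform.
∑∑-mix : (S : Fin n → Bool) (φ : Input n → Input n → ℕ) →
  ∑ n (λ x → ∑ n (λ y → φ (mix S x y) (mix S y x))) ≡ ∑ n (λ x → ∑ n (φ x))
∑∑-mix {zero} S φ = refl
∑∑-mix {suc n} S φ = trans (split swapped) (trans (by-head (S zero) refl) (sym (split φ)))
  where
  swapped : Input (suc n) → Input (suc n) → ℕ
  swapped x y = φ (mix S x y) (mix S y x)
  quarter : (Input (suc n) → Input (suc n) → ℕ) → Bool → Bool → ℕ
  quarter ψ a b = ∑ n (λ x → ∑ n (λ y → ψ (a ∷ x) (b ∷ y)))
  split : ∀ ψ → ∑ (suc n) (λ x → ∑ (suc n) (ψ x)) ≡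
    (quarter ψ true true + quarter ψ true false) + (quarter ψ false true + quarter ψ false false)
  split ψ = cong₂ _+_ (∑-+ (λ x → ∑ n (λ y → ψ (true ∷ x) (true ∷ y))) _)
                      (∑-+ (λ x → ∑ n (λ y → ψ (false ∷ x) (true ∷ y))) _)
  IH : ∀ a b → ∑ n (λ x → ∑ n (λ y → φ (a ∷ mix (S ∘ suc) x y) (b ∷ mix (S ∘ suc) y x))) ≡ quarter φ a b
  IH a b = ∑∑-mix (S ∘ suc) (λ x y → φ (a ∷ x) (b ∷ y))
  exch : ∀ a b c d → (a + c) + (b + d) ≡ (a + b) + (c + d)
  exch = solve-∀
  by-head : ∀ s → S zero ≡ s →
    (quarter swapped true true + quarter swapped true false) +
        (quarter swapped false true + quarter swapped false false) ≡
    (quarter φ true true + quarter φ true false) + (quarter φ false true + quarter φ false false)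
  by-head true e rewrite e | IH true true | IH true false | IH false true | IH false false = exch
      (quarter φ true true) _ _ _
  by-head false e rewrite e | IH true true | IH true false | IH false true | IH false false = refl

rare-mix-pair : ∀ (S : Fin n → Bool) {P k l} → Rare (cube n ⊗ cube n) P k l →
  Rare (cube n ⊗ cube n) (λ (x , y) → P (mix S x y , mix S y x)) k l
rare-mix-pair {n} S {P} {k} {l} r .bound = subst (λ z → z * l ≤ k * size (cube n ⊗ cube n))
    (sym (∑∑-mix S (λ x y → ⟦ P (x , y) ⟧))) (bound r)

rare-mix : ∀ (S : Fin n → Bool) {P k l} → Rare (cube n) P k l →
  Rare (cube n ⊗ cube n) (λ (x , y) → P (mix S x y)) k l
rare-mix {n} S {P} {k} {l} r = rare-mix-pair S {P ∘ proj₁} {k} {l}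
  (rare-fixʳ {S = cube n} {T = cube n} {P ∘ proj₁} {k} {l} (λ _ → r))

-- Overwriting bit i by b maps the cube two-to-one onto the half where that bit is b; the factor
-- before φ is the indicator of this half.
∑-update : (i : Fin n) (b : Bool) (φ : Input n → ℕ) →
  ∑ n (λ x → φ (x [ i ]≔ b)) ≡ 2 * ∑ n (λ x → ⟦ not (lookup x i xor b) ⟧ * φ x)
∑-update {suc n} zero true φ rewrite ∑-* 0 (φ ∘ (false ∷_)) | ∑-* 1 (φ ∘ (true ∷_)) = eq (∑ n (φ ∘ (true ∷_)))
  where
  eq : ∀ a → a + a ≡ 2 * (1 * a + 0)
  eq = solve-∀
∑-update {suc n} zero false φ rewrite ∑-* 1 (φ ∘ (false ∷_)) | ∑-* 0 (φ ∘ (true ∷_)) = eq (∑ n (φ ∘ (false ∷_)))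
  where
  eq : ∀ a → a + a ≡ 2 * (0 + 1 * a)
  eq = solve-∀
∑-update {suc n} (suc i) b φ rewrite ∑-update i b (φ ∘ (true ∷_)) | ∑-update i b (φ ∘ (false ∷_)) =
  sym (*-distribˡ-+ 2 (∑ n (λ x → ⟦ not (lookup x i xor b) ⟧ * φ (true ∷ x))) _)

∑-injective : ∀ {m} (h : Input m → A) (P : A → Bool) → (∀ {x y} → P (h x) ≡ true → P (h y) ≡ true → x ≡ y) →
  ∑ m (λ x → ⟦ P (h x) ⟧) ≤ 1
∑-injective {m = zero} h P inj with P (h [])
... | true = ≤-refl
... | false = z≤n
∑-injective {m = suc m} h P inj with search m (P ∘ h ∘ (true ∷_))
... | inj₂ none = subst (λ z → z + ∑ m (λ x → ⟦ P (h (false ∷ x)) ⟧) ≤ 1)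
    (sym (trans (∑-cong (cong ⟦_⟧ ∘ none)) (trans (∑-const m 0) (*-zeroʳ (2 ^ m)))))
      (∑-injective (h ∘ (false ∷_)) P (λ p q → ∷-injectiveʳ (inj p q)))
... | inj₁ (x₀ , p₀) = subst (λ z → ∑ m (λ x → ⟦ P (h (true ∷ x)) ⟧) + z ≤ 1)
      (sym (trans (∑-cong (λ y → cong ⟦_⟧ (none y))) (trans (∑-const m 0) (*-zeroʳ (2 ^ m)))))
      (subst (_≤ 1) (sym (+-identityʳ _)) (∑-injective (h ∘ (true ∷_)) P (λ p q → ∷-injectiveʳ (inj p q))))
  where
  none : ∀ y → P (h (false ∷ y)) ≡ false
  none y with P (h (false ∷ y)) in e
  ... | false = refl
  ... | true with () ← inj p₀ e

-- Linear functionals and ring homomorphisms on the cube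

Additive Multiplicative : (Input n → Bool) → Set
Additive g = ∀ x y → g (x ⊕ y) ≡ g x xor g y
Multiplicative g = ∀ x y → g (x & y) ≡ g x ∧ g y

-- Translation by `a` exchanges the zeros and the ones of g.
additive-half : (g : Input n → Bool) → Additive g → ∀ a → g a ≡ true → 2 * # (cube n) g ≡ 2 ^ n
additive-half {n} g add a ga = trans (cong (# (cube n) g +_) (trans (+-identityʳ _) flip)) (#-not (cube n) g)
  where
  flip : # (cube n) g ≡ # (cube n) (not ∘ g)
  flip = trans (sym (∑-shiftˡ a (⟦_⟧ ∘ g)))
    (∑-cong (λ x → cong ⟦_⟧ (trans (add a x) (cong (_xor g x) ga))))

zeros : Input n
zeros {n} = replicate n false

⊕-zeros : (x : Input n) → x ⊕ zeros ≡ x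
⊕-zeros [] = refl
⊕-zeros (a ∷ x) = cong₂ _∷_ (xor-identityʳ a) (⊕-zeros x)

&-zeros : (x : Input n) → x & zeros ≡ zeros
&-zeros [] = refl
&-zeros (a ∷ x) = cong₂ _∷_ (∧-zeroʳ a) (&-zeros x)

additive-zeros : (g : Input n → Bool) → Additive g → g zeros ≡ false
additive-zeros g add = trans (sym (cong g (⊕-zeros zeros))) (trans (add zeros zeros) (xor-same (g zeros)))

-- The zero function is included because it also preserves sums and products; a block that reads as
-- zero is later treated as the constant `false`.
Dictator : (Input n → Bool) → Set
Dictator {n} g = (∀ x → g x ≡ false) ⊎ (Σ (Fin n) λ i → ∀ x → g x ≡ lookup x i)

-- Induction on the dimension, with e the unit vector of the head. If g e = 1, a point x with head 0
-- has x & e = 0, so g x = g x ∧ g e = 0, and additivity makes g the head. If g e = 0, additivity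
-- shows that the head does not matter.
ring-hom⇒dictator : (g : Input n → Bool) → Additive g → Multiplicative g → Dictator g
ring-hom⇒dictator {zero} g add mul = inj₁ λ { [] → additive-zeros g add }
ring-hom⇒dictator {suc n} g add mul with g (true ∷ zeros) in e
... | true = inj₂ (zero , by-head)
  where
  tail-false : ∀ x → g (false ∷ x) ≡ false
  tail-false x = trans (sym (∧-identityʳ _)) (trans (cong (g (false ∷ x) ∧_) (sym e))
    (trans (sym (mul (false ∷ x) (true ∷ zeros)))
      (trans (cong (λ z → g (false ∷ z)) (&-zeros x)) (additive-zeros g add))))
  by-head : ∀ x → g x ≡ lookup x zero
  by-head (false ∷ x) = tail-false x
  by-head (true ∷ x) = trans (cong (λ z → g (true ∷ z)) (sym (trans (⊕-comm zeros x) (⊕-zeros x))))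
    (trans (add (true ∷ zeros) (false ∷ x)) (cong₂ _xor_ e (tail-false x)))
... | false = extend (ring-hom⇒dictator (g ∘ (false ∷_)) (λ x y → add (false ∷ x) (false ∷ y))
    (λ x y → mul (false ∷ x) (false ∷ y)))
  where
  head-irrelevant : ∀ b x → g (b ∷ x) ≡ g (false ∷ x)
  head-irrelevant false x = refl
  head-irrelevant true x = trans (cong (λ z → g (true ∷ z)) (sym (trans (⊕-comm zeros x) (⊕-zeros x))))
    (trans (add (true ∷ zeros) (false ∷ x)) (cong (_xor g (false ∷ x)) e))
  extend : Dictator (g ∘ (false ∷_)) → Dictator g
  extend (inj₁ h) = inj₁ λ { (b ∷ x) → trans (head-irrelevant b x) (h x) }
  extend (inj₂ (i , h)) = inj₂ (suc i , λ { (b ∷ x) → trans (head-irrelevant b x) (h x) })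

-- The test that a block reads a single variable

-- For an affine φ this is its linear part at a, whatever s is. For uniform s both arguments of φ
-- are uniform, which allows local correction of a φ that is only nearly affine.
probe : (Input n → Bool) → Input n → Input n → Bool
probe φ a s = φ (s ⊕ a) xor φ s

BlockTest : ℕ → Set
BlockTest n = (Input n × Input n) × Vec (Input n) 4

blockTests : ∀ n → Source (BlockTest n)
blockTests n = (cube n ⊗ cube n) ⊗ vec 4 (cube n)

-- Direction u occurs twice with separate seeds, which tests affinity; u, v and u & v together test
-- multiplicativity, each with a seed of its own.
direction : Input n × Input n → Fin 4 → Input n
direction (u , v) zero = u
direction (u , v) (suc zero) = u
direction (u , v) (suc (suc zero)) = v
direction (u , v) (suc (suc (suc zero))) = u & v

pattern i0 = zero
pattern i1 = suc zero
pattern i2 = suc (suc zero)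
pattern i3 = suc (suc (suc zero))

consistent : (Fin 4 → Bool) → Bool
consistent e = not (e i0 xor e i1) ∧ not ((e i1 ∧ e i2) xor e i3)

passes : (Input n → Bool) → BlockTest n → Bool
passes φ (uv , ss) = consistent (λ i → probe φ (direction uv i) (lookup ss i))

rare-complement : ∀ {S : Source A} {P} k → size S ≤ suc k * # S P → Rare S (not ∘ P) k (suc k)
rare-complement {S = S} {P} k h .bound = +-cancelˡ-≤ (size S) _ _ (begin
  size S + # S (not ∘ P) * suc k             ≤⟨ +-monoˡ-≤ _ h ⟩
  suc k * # S P + # S (not ∘ P) * suc k      ≡⟨ eq k (# S P) (# S (not ∘ P)) ⟩
  suc k * (# S P + # S (not ∘ P))            ≡⟨ cong (suc k *_) (#-not S P) ⟩
  size S + k * size S                        ∎)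
  where
  open ≤-Reasoning
  eq : ∀ k a b → (1 + k) * a + b * (1 + k) ≡ (1 + k) * (a + b)
  eq = solve-∀

#-unequal-pair : (S : Source A) (P : A → Bool) →
  # (S ⊗ S) (λ (y , z) → P y xor P z) ≡ 2 * (# S P * # S (not ∘ P))
#-unequal-pair S P = begin
  E S (λ y → E S (λ z → ⟦ P y xor P z ⟧))
    ≡⟨ E-cong S (λ y → E-cong S (λ z → split (P y) (P z))) ⟩
  E S (λ y → E S (λ z → ⟦ P y ⟧ * ⟦ not (P z) ⟧ + ⟦ not (P y) ⟧ * ⟦ P z ⟧))
    ≡⟨ E-cong S (λ y → trans (E-+ S _ _) (cong₂ _+_ (E-*ˡ S ⟦ P y ⟧ _) (E-*ˡ S ⟦ not (P y) ⟧ _))) ⟩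
  E S (λ y → ⟦ P y ⟧ * # S (not ∘ P) + ⟦ not (P y) ⟧ * # S P)
    ≡⟨ trans (E-+ S _ _) (cong₂ _+_ (E-*ʳ S _ _) (E-*ʳ S _ _)) ⟩
  # S P * # S (not ∘ P) + # S (not ∘ P) * # S P
    ≡⟨ eq (# S P) (# S (not ∘ P)) ⟩
  2 * (# S P * # S (not ∘ P)) ∎
  where
  open ≡-Reasoning
  split : ∀ p q → ⟦ p xor q ⟧ ≡ ⟦ p ⟧ * ⟦ not q ⟧ + ⟦ not p ⟧ * ⟦ q ⟧
  split true true = refl
  split true false = refl
  split false true = refl
  split false false = refl
  eq : ∀ a b → a * b + b * a ≡ 2 * (a * b)
  eq = solve-∀

-- The majority a is at least N / 2, so c N ≤ 2 a c, while 2 a c / N ^ 2 is the probability that two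
-- independent samples differ.
majority-error : ∀ a c N → a + c ≡ N → c ≤ a → 2 * (a * c) * 6 ≤ N * N → 0 < N → c * 6 ≤ N
majority-error a c N refl c≤a h N>0 = *-cancelʳ-≤ (c * 6) N N {{>-nonZero N>0}} (begin
  c * 6 * (a + c)   ≤⟨ *-monoʳ-≤ (c * 6) (+-monoʳ-≤ a c≤a) ⟩
  c * 6 * (a + a)   ≡⟨ eq a c ⟩
  2 * (a * c) * 6   ≤⟨ h ⟩
  N * N             ∎)
  where
  open ≤-Reasoning
  eq : ∀ a c → c * 6 * (a + a) ≡ 2 * (a * c) * 6
  eq = solve-∀

true≢false : true ≢ false
true≢false ()

isLeft : A ⊎ B → Bool
isLeft (inj₁ _) = true
isLeft (inj₂ _) = false

isLeft-spec : (s : A ⊎ B) → (isLeft s ≡ true × A) ⊎ (isLeft s ≡ false × B)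
isLeft-spec (inj₁ a) = inj₁ (refl , a)
isLeft-spec (inj₂ b) = inj₂ (refl , b)

⊕-cancel₂ : (y x z : Input n) → (y ⊕ x) ⊕ (y ⊕ z) ≡ z ⊕ x
⊕-cancel₂ y x z = trans (cong (_⊕ (y ⊕ z)) (⊕-comm y x)) (trans (⊕-assoc x y (y ⊕ z))
  (trans (cong (x ⊕_) (⊕-cancel y z)) (⊕-comm x z)))

module BlockTesting (φ : Input n → Bool) where

  C : Source (Input n)
  C = cube n

  Corrects : (Input n → Bool) → Set
  Corrects g = ∀ x → Rare C (λ s → probe φ x s xor g x) 1 6

  -- For an affine φ no two seeds clash in any direction.
  clash : Input n × Input n × Input n → Bool
  clash (u , s , s′) = probe φ u s xor probe φ u s′

  clash-rejects : size (C ⊗ C ⊗ C) ≤ 12 * # (C ⊗ C ⊗ C) clash → Rare (blockTests n) (passes φ) 11 12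
  clash-rejects h = rare-mono {S = blockTests n} {passes φ} {not ∘ clash ∘ triple} {11} {12}
    (λ { ((u , v) , s₀ ∷ s₁ ∷ ss) → ∧-trueˡ })
    (rare-marginal {O = blockTests n} {C ⊗ C ⊗ C} {triple} {not ∘ clash} {11} {12} marg
      (rare-complement {S = C ⊗ C ⊗ C} {clash} 11 h))
    where
    triple : BlockTest n → Input n × Input n × Input n
    triple ((u , v) , s₀ ∷ s₁ ∷ ss) = u , s₀ , s₁
    marg : Marginal (blockTests n) (C ⊗ C ⊗ C) triple
    marg .law = law (marginal-⊗ {O = C ⊗ C} {C ⊗ C ⊗ vec 2 C} {C} {C ⊗ C} {proj₁} {λ (s₀ , s₁ , ss) → s₀ , s₁}
      (marginal-proj₁ {S = C} {C})
      (marginal-⊗ {O = C} {C ⊗ vec 2 C} {C} {C} {id} {proj₁} (marginal-id {S = C})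
          (marginal-proj₁ {S = C} {vec 2 C})))

  -- The threshold 1/12 is doubled to 1/6 when two seeds are compared through a third point. An
  -- error of 1/6 per value keeps the sum of three errors, as in additivity and in the product test,
  -- at 1/2.
  module Corrected (few : 12 * # (C ⊗ C ⊗ C) clash ≤ size (C ⊗ C ⊗ C)) where

    -- Both ends of the pair are compared with a random third point w, and each
    -- comparison is a uniformly distributed instance of clash.
    pair-clash : ∀ x y z w →
      probe φ x y xor probe φ x z ≡ clash (y ⊕ z , y , w) xor clash (y ⊕ z , y ⊕ x , w)
    pair-clash x y z w rewrite ⊕-cancel y z | ⊕-cancel₂ y x z =
      solve 6 (λ a b c d e f → (a :+ b) :+ (c :+ d) :=
        ((d :+ b) :+ (e :+ f)) :+ ((c :+ a) :+ (e :+ f))) refl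
        (φ (y ⊕ x)) (φ y) (φ (z ⊕ x)) (φ z) (φ (w ⊕ (y ⊕ z))) (φ w)
      where
      open xor-∧-Solver

    disagreement : ∀ x → Rare (C ⊗ C) (λ (y , z) → probe φ x y xor probe φ x z) 1 6
    disagreement x .bound = *-cancelʳ-≤ _ _ (2 * 2 ^ n)
        {{>-nonZero (*-mono-≤ {1} {2} (s≤s z≤n) (size>0 C))}} (begin
      D * 6 * (2 * 2 ^ n)      ≡⟨ eq₁ D (2 ^ n) ⟩
      12 * (2 ^ n * D)         ≤⟨ *-monoʳ-≤ 12 lifted ⟩
      12 * (K + K)             ≡⟨ eq₂ K ⟩
      2 * (12 * K)             ≤⟨ *-monoʳ-≤ 2 few ⟩
      2 * size (C ⊗ C ⊗ C)     ≡⟨ cong (2 *_) (size-⊗ C (C ⊗ C)) ⟩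
      2 * (2 ^ n * size (C ⊗ C)) ≡⟨ eq₃ (2 ^ n) (size (C ⊗ C)) ⟩
      1 * size (C ⊗ C) * (2 * 2 ^ n) ∎)
      where
      open ≤-Reasoning
      D = # (C ⊗ C) (λ (y , z) → probe φ x y xor probe φ x z)
      K = # (C ⊗ C ⊗ C) clash
      eq₁ : ∀ d N → d * 6 * (2 * N) ≡ 12 * (N * d)
      eq₁ = solve-∀
      eq₂ : ∀ k → 12 * (k + k) ≡ 2 * (12 * k)
      eq₂ = solve-∀
      eq₃ : ∀ a b → 2 * (a * b) ≡ 1 * b * (2 * a)
      eq₃ = solve-∀
      ⟦xor⟧ : ∀ a b → ⟦ a xor b ⟧ ≤ ⟦ a ⟧ + ⟦ b ⟧
      ⟦xor⟧ true true = z≤n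
      ⟦xor⟧ true false = ≤-refl
      ⟦xor⟧ false b = ≤-refl
      T : Input n → Input n → Input n → ℕ
      T u s w = ⟦ clash (u , s , w) ⟧
      -- For fixed y the direction u = y ⊕ z runs through the cube as z does. In `second` the seed y
      -- ⊕ x is moreover a translate of y, so both sums count exactly the clashing triples.
      first : ∑ n (λ y → ∑ n (λ z → ∑ n (λ w → T (y ⊕ z) y w))) ≡ K
      first = trans (∑-cong (λ y → ∑-shiftˡ y (λ u → ∑ n (T u y)))) (∑-swap n n (λ y u → ∑ n (T u y)))
      second : ∑ n (λ y → ∑ n (λ z → ∑ n (λ w → T (y ⊕ z) (y ⊕ x) w))) ≡ K
      second = trans (∑-cong (λ y → ∑-shiftˡ y (λ u → ∑ n (T u (y ⊕ x)))))
        (trans (∑-swap n n (λ y u → ∑ n (T u (y ⊕ x)))) (∑-cong (λ u → ∑-shift x (λ y → ∑ n (T u y)))))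
      lifted : 2 ^ n * D ≤ K + K
      lifted = begin
        2 ^ n * D
          ≡⟨ ∑-* {n} (2 ^ n) _ ⟨
        ∑ n (λ y → 2 ^ n * ∑ n (λ z → ⟦ probe φ x y xor probe φ x z ⟧))
          ≡⟨ ∑-cong {n} (λ y → ∑-* {n} (2 ^ n) _) ⟨
        ∑ n (λ y → ∑ n (λ z → 2 ^ n * ⟦ probe φ x y xor probe φ x z ⟧))
          ≡⟨ ∑-cong {n} (λ y → ∑-cong {n} (λ z → ∑-const n _)) ⟨
        ∑ n (λ y → ∑ n (λ z → ∑ n (λ w → ⟦ probe φ x y xor probe φ x z ⟧)))
          ≤⟨ ∑-mono {n} (λ y → ∑-mono {n} (λ z → ∑-mono {n} (λ w →
               ≤-trans (≤-reflexive (cong ⟦_⟧ (pair-clash x y z w))) (⟦xor⟧ (clash (y ⊕ z , y , w)) _)))) ⟩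
        ∑ n (λ y → ∑ n (λ z → ∑ n (λ w → T (y ⊕ z) y w + T (y ⊕ z) (y ⊕ x) w)))
          ≡⟨ ∑-cong {n} (λ y → trans (∑-cong {n} (λ z → ∑-+ {n} (T (y ⊕ z) y) (T (y ⊕ z) (y ⊕ x))))
               (∑-+ {n} (λ z → ∑ n (T (y ⊕ z) y)) (λ z → ∑ n (T (y ⊕ z) (y ⊕ x))))) ⟩
        ∑ n (λ y → ∑ n (λ z → ∑ n (T (y ⊕ z) y)) + ∑ n (λ z → ∑ n (T (y ⊕ z) (y ⊕ x))))
          ≡⟨ ∑-+ {n} (λ y → ∑ n (λ z → ∑ n (T (y ⊕ z) y))) _ ⟩
        _ ≡⟨ cong₂ _+_ first second ⟩
        K + K ∎

    -- Local decoding: the majority of the probes over all seeds.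
    g : Input n → Bool
    g x = isLeft (≤-total (# C (not ∘ probe φ x)) (# C (probe φ x)))

    g-corrects : Corrects g
    g-corrects x with isLeft-spec (≤-total (# C (not ∘ probe φ x)) (# C (probe φ x)))
    ... | inj₁ (e , p) = rare (≤-trans
      (≤-reflexive (cong (_* 6) (∑-cong {n}
          (λ s → cong ⟦_⟧ (trans (cong (probe φ x s xor_) e) (xor-comm (probe φ x s) true))))))
      (≤-trans (majority-error (# C (probe φ x)) (# C (not ∘ probe φ x)) (2 ^ n) (#-not C (probe φ x)) p bnd
          (size>0 C))
        (≤-reflexive (sym (*-identityˡ _)))))
      where
      bnd : 2 * (# C (probe φ x) * # C (not ∘ probe φ x)) * 6 ≤ 2 ^ n * 2 ^ n
      bnd = subst₂ _≤_ (cong (_* 6) (#-unequal-pair C (probe φ x)))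
        (trans (*-identityˡ _) (size-⊗ C C)) (bound (disagreement x))
    ... | inj₂ (e , p) = rare (≤-trans
      (≤-reflexive (cong (_* 6) (∑-cong {n}
          (λ s → cong ⟦_⟧ (trans (cong (probe φ x s xor_) e) (xor-identityʳ (probe φ x s)))))))
      (≤-trans (majority-error (# C (not ∘ probe φ x)) (# C (probe φ x)) (2 ^ n)
        (trans (+-comm (# C (not ∘ probe φ x)) _) (#-not C (probe φ x))) p bnd (size>0 C))
        (≤-reflexive (sym (*-identityˡ _)))))
      where
      bnd : 2 * (# C (not ∘ probe φ x) * # C (probe φ x)) * 6 ≤ 2 ^ n * 2 ^ n
      bnd = subst₂ _≤_ (trans (cong (_* 6) (#-unequal-pair C (probe φ x)))
          (cong (λ z → 2 * z * 6) (*-comm (# C (probe φ x)) _)))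
        (trans (*-identityˡ _) (size-⊗ C C)) (bound (disagreement x))

    -- The probe of y at s and that of x at s ⊕ y telescope to the probe of x ⊕ y at s. For some s
    -- all three equal the decoded values, because the errors sum to at most 1/2.
    g-additive : Additive g
    g-additive x y = conclude (#-witness C bad few-bad)
      where
      bad : Input n → Bool
      bad s = (probe φ (x ⊕ y) s xor g (x ⊕ y)) ∨ ((probe φ x (s ⊕ y) xor g x) ∨ (probe φ y s xor g y))
      few-bad : # C bad < 2 ^ n
      few-bad = *-cancelʳ-< 6 (# C bad) (2 ^ n) (≤-<-trans
        (bound (rare-∨ {a = 1} {2} (g-corrects (x ⊕ y))
          (rare-∨ {a = 1} {1} (rare-shift y {λ s → probe φ x s xor g x} (g-corrects x)) (g-corrects y))))
        (subst (3 * 2 ^ n <_) (*-comm 6 (2 ^ n))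
            (*-monoˡ-< (2 ^ n) {{>-nonZero (size>0 C)}} {3} {6} (s≤s (s≤s (s≤s (s≤s z≤n)))))))
      conclude : (∃ λ s → bad s ≡ false) → g (x ⊕ y) ≡ g x xor g y
      conclude (s , e) = trans (sym (xor-≡ (∨-falseˡ {probe φ (x ⊕ y) s xor g (x ⊕ y)} e))) (trans telescope
        (cong₂ _xor_ err-x err-y))
        where
        rest = ∨-falseʳ {probe φ (x ⊕ y) s xor g (x ⊕ y)} e
        err-x : probe φ x (s ⊕ y) ≡ g x
        err-x = xor-≡ (∨-falseˡ {probe φ x (s ⊕ y) xor g x} rest)
        err-y : probe φ y s ≡ g y
        err-y = xor-≡ (∨-falseʳ {probe φ x (s ⊕ y) xor g x} rest)
        telescope : probe φ (x ⊕ y) s ≡ probe φ x (s ⊕ y) xor probe φ y s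
        telescope rewrite ⊕-assoc s y x | ⊕-comm y x =
          solve 3 (λ a b c → a :+ c := (a :+ b) :+ (b :+ c)) refl (φ (s ⊕ (x ⊕ y))) (φ (s ⊕ y)) (φ s)
          where open xor-∧-Solver

  module Corrector (g : Input n → Bool) (g-additive : Additive g) (g-corrects : Corrects g) where

    -- Both g (u & v) and g u ∧ g v are bilinear over the two-element field, hence so is their sum;
    -- it vanishes identically exactly when g is multiplicative.
    defect : Input n → Input n → Bool
    defect u v = g (u & v) xor (g u ∧ g v)

    defect-additiveʳ : ∀ u → Additive (defect u)
    defect-additiveʳ u v w rewrite &-distribˡ-⊕ u v w | g-additive (u & v) (u & w) | g-additive v w =
      solve 5 (λ a b c d e → (a :+ b) :+ (c :* (d :+ e)) := (a :+ (c :* d)) :+ (b :+ (c :* e))) refl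
        (g (u & v)) (g (u & w)) (g u) (g v) (g w)
      where open xor-∧-Solver

    defect-sym : ∀ u v → defect u v ≡ defect v u
    defect-sym u v = cong₂ _xor_ (cong g (&-comm u v)) (∧-comm (g u) (g v))

    defect-additiveˡ : ∀ v → Additive (λ u → defect u v)
    defect-additiveˡ v x y = trans (defect-sym (x ⊕ y) v) (trans (defect-additiveʳ v x y)
      (cong₂ _xor_ (defect-sym v x) (defect-sym v y)))

    -- A nonzero bilinear form over the two-element field is nonzero on at least
    -- a quarter of the pairs.
    defect-often : ∀ u v → defect u v ≡ true → 2 ^ n * 2 ^ n ≤ 4 * # (C ⊗ C) (λ (u , v) → defect u v)
    defect-often u₀ v₀ e = begin
      2 ^ n * 2 ^ n
        ≡⟨ cong (2 ^ n *_) (additive-half (defect u₀) (defect-additiveʳ u₀) v₀ e) ⟨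
      2 ^ n * (2 * # C (defect u₀))
        ≡⟨ eq₁ (2 ^ n) (# C (defect u₀)) ⟩
      2 * (# C (defect u₀) * 2 ^ n)
        ≡⟨ cong (2 *_) (E-*ʳ C (2 ^ n) _) ⟨
      2 * ∑ n (λ v → ⟦ defect u₀ v ⟧ * 2 ^ n)
        ≤⟨ *-monoʳ-≤ 2 (∑-mono {n} column) ⟩
      2 * ∑ n (λ v → 2 * # C (λ u → defect u v))
        ≡⟨ cong (2 *_) (∑-* {n} 2 _) ⟩
      2 * (2 * ∑ n (λ v → # C (λ u → defect u v)))
        ≡⟨ cong (λ z → 2 * (2 * z)) (∑-swap n n (λ v u → ⟦ defect u v ⟧)) ⟩
      2 * (2 * # (C ⊗ C) (λ (u , v) → defect u v))
        ≡⟨ *-assoc 2 2 (# (C ⊗ C) (λ (u , v) → defect u v)) ⟨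
      4 * # (C ⊗ C) (λ (u , v) → defect u v) ∎
      where
      open ≤-Reasoning
      eq₁ : ∀ a b → a * (2 * b) ≡ 2 * (b * a)
      eq₁ = solve-∀
      column : ∀ v → ⟦ defect u₀ v ⟧ * 2 ^ n ≤ 2 * # C (λ u → defect u v)
      column v with defect u₀ v in d
      ... | true = ≤-reflexive (trans (*-identityˡ (2 ^ n))
          (sym (additive-half (λ u → defect u v) (defect-additiveˡ v) u₀ d)))
      ... | false = z≤n

    -- When the probes in the directions u, v and u & v all return the decoded values, the product
    -- test sees the defect and fails. Each of them errs with probability at most 1/6.
    defect-detected : ∀ u v → defect u v ≡ true → Rare (vec 4 C) (λ ss → passes φ ((u , v) , ss)) 1 2
    defect-detected u v d = rare-scale {a = 3} {6} {1} {2} (s≤s z≤n) ≤-refl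
      (rare-mono {Q = wrong} detect
        (rare-∨ {a = 1} {2} (at u i1)
          (rare-∨ {a = 1} {1} (at v i2) (at (u & v) i3))))
      where
      err : Input n → Fin 4 → Vec (Input n) 4 → Bool
      err x i ss = probe φ x (lookup ss i) xor g x
      at : ∀ x i → Rare (vec 4 C) (err x i) 1 6
      at x i = rare-marginal {O = vec 4 C} {C} {λ ss → lookup ss i} {λ s → probe φ x s xor g x} {1} {6}
        (marginal-lookup {S = C} i) (g-corrects x)
      wrong : Vec (Input n) 4 → Bool
      wrong ss = err u i1 ss ∨ (err v i2 ss ∨ err (u & v) i3 ss)
      bool : ∀ e₁ e₂ e₃ g₁ g₂ g₃ → g₃ xor (g₁ ∧ g₂) ≡ true → not ((e₁ ∧ e₂) xor e₃) ≡ true →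
        (e₁ xor g₁) ∨ ((e₂ xor g₂) ∨ (e₃ xor g₃)) ≡ true
      bool e₁ e₂ e₃ g₁ g₂ g₃ p q with e₁ xor g₁ in x₁ | e₂ xor g₂ in x₂ | e₃ xor g₃ in x₃
      ... | true | _ | _ = refl
      ... | false | true | _ = refl
      ... | false | false | true = refl
      ... | false | false | false with refl ← xor-≡ {e₁} x₁ | refl ← xor-≡ {e₂} x₂ | refl ← xor-≡ {e₃} x₃ =
        ⊥-elim (contra (e₁ ∧ e₂) e₃ p q)
        where
        contra : ∀ a b → b xor a ≡ true → not (a xor b) ≡ true → ⊥
        contra true true () _
        contra true false _ ()
        contra false true _ ()
        contra false false () _
      detect : ∀ ss → passes φ ((u , v) , ss) ≡ true → wrong ss ≡ true
      detect ss p = bool (probe φ u (lookup ss i1)) (probe φ v (lookup ss i2)) (probe φ (u & v) (lookup ss i3))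
        (g u) (g v) (g (u & v)) d (∧-trueʳ {not (probe φ u (lookup ss i0) xor probe φ u (lookup ss i1))} p)

    -- At least a quarter of the pairs of directions show a defect, and each of these is rejected
    -- with probability at least 1/2. Acceptance is thus bounded by 7/8, weakened to 11/12 to agree
    -- with `clash-rejects`.
    defect-rejects : ∀ u v → defect u v ≡ true → Rare (blockTests n) (passes φ) 11 12
    defect-rejects u v d = rare-scale {S = blockTests n} {passes φ} {a = 7} {8} {11} {12} (s≤s z≤n) (m≤m+n 84 4)
      (rare (+-cancelʳ-≤ (K * K * M) _ _ (begin
        P * 8 + K * K * M            ≤⟨ +-monoʳ-≤ (P * 8) (*-monoˡ-≤ M (defect-often u v d)) ⟩
        P * 8 + 4 * Q * M            ≡⟨ eq₁ P Q M ⟩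
        4 * (2 * P + Q * M)          ≤⟨ *-monoʳ-≤ 4 summed ⟩
        4 * (K * K * (2 * M))        ≡⟨ eq₂ (K * K) M ⟩
        7 * (K * K * M) + K * K * M  ≡⟨ cong (λ z → 7 * z + K * K * M) sizes ⟨
        7 * size (blockTests n) + K * K * M ∎)))
      where
      open ≤-Reasoning
      K = 2 ^ n
      M = size (vec 4 C)
      P = # (blockTests n) (passes φ)
      Q = # (C ⊗ C) (λ (u , v) → defect u v)
      sizes : size (blockTests n) ≡ K * K * M
      sizes = trans (size-⊗ (C ⊗ C) (vec 4 C)) (cong (_* M) (size-⊗ C C))
      eq₁ : ∀ P Q M → P * 8 + 4 * Q * M ≡ 4 * (2 * P + Q * M)
      eq₁ = solve-∀
      eq₂ : ∀ a b → 4 * (a * (2 * b)) ≡ 7 * (a * b) + a * b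
      eq₂ = solve-∀
      row : ∀ uv → 2 * # (vec 4 C) (λ ss → passes φ (uv , ss)) + ⟦ defect (proj₁ uv) (proj₂ uv) ⟧ * M ≤ 2 * M
      row (u , v) with defect u v in d
      ... | true = begin
        2 * # (vec 4 C) (λ ss → passes φ ((u , v) , ss)) + 1 * M ≡⟨ cong (_+ 1 * M)
            (*-comm 2 (# (vec 4 C) (λ ss → passes φ ((u , v) , ss)))) ⟩
        # (vec 4 C) (λ ss → passes φ ((u , v) , ss)) * 2 + 1 * M ≤⟨ +-monoˡ-≤ (1 * M)
            (bound (defect-detected u v d)) ⟩
        1 * M + 1 * M ≡⟨ *-distribʳ-+ M 1 1 ⟨
        2 * M ∎
      ... | false = ≤-trans (≤-reflexive (+-identityʳ _))
          (*-monoʳ-≤ 2 (≤-trans (m≤m+n _ (# (vec 4 C) (λ ss → not (passes φ ((u , v) , ss)))))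
            (≤-reflexive (#-not (vec 4 C) (λ ss → passes φ ((u , v) , ss))))))
      summed : 2 * P + Q * M ≤ K * K * (2 * M)
      summed = begin
        2 * P + Q * M
          ≡⟨ cong₂ _+_ (E-*ˡ (C ⊗ C) 2 _) (E-*ʳ (C ⊗ C) M _) ⟨
        E (C ⊗ C) (λ uv → 2 * # (vec 4 C) (λ ss → passes φ (uv , ss))) + E (C ⊗ C)
            (λ (u , v) → ⟦ defect u v ⟧ * M)
          ≡⟨ E-+ (C ⊗ C) _ _ ⟨
        E (C ⊗ C) (λ uv → 2 * # (vec 4 C) (λ ss → passes φ (uv , ss)) + ⟦ defect (proj₁ uv) (proj₂ uv) ⟧ * M)
          ≤⟨ E-mono (C ⊗ C) row ⟩
        E (C ⊗ C) (λ _ → 2 * M)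
          ≡⟨ E-const (C ⊗ C) (2 * M) ⟩
        size (C ⊗ C) * (2 * M)
          ≡⟨ cong (_* (2 * M)) (size-⊗ C C) ⟩
        K * K * (2 * M) ∎

    dictator-or-rejected : (Dictator g × Corrects g) ⊎ Rare (blockTests n) (passes φ) 11 12
    dictator-or-rejected with search n (λ u → isLeft (search n (defect u)))
    ... | inj₂ none = inj₁ (ring-hom⇒dictator g g-additive multiplicative , g-corrects)
      where
      multiplicative : Multiplicative g
      multiplicative u v with isLeft-spec (search n (defect u))
      ... | inj₁ (e , _) = ⊥-elim (true≢false (trans (sym e) (none u)))
      ... | inj₂ (_ , z) = xor-≡ (z v)
    ... | inj₁ (u , e) with isLeft-spec (search n (defect u))
    ...   | inj₁ (_ , v , d) = inj₂ (defect-rejects u v d)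
    ...   | inj₂ (e′ , _) = ⊥-elim (true≢false (trans (sym e) e′))

  -- The corrector is right in every direction, not just in most. Hence a bit can be extracted at
  -- any given sample point by varying the seed alone.
  dichotomy : (Σ (Input n → Bool) λ g → Dictator g × Corrects g) ⊎ Rare (blockTests n) (passes φ) 11 12
  dichotomy with size (C ⊗ C ⊗ C) ≤? 12 * # (C ⊗ C ⊗ C) clash
  ... | yes h = inj₂ (clash-rejects h)
  ... | no h = add-corrector (Corrector.dictator-or-rejected g g-additive g-corrects)
    where
    open Corrected (<⇒≤ (≰⇒> h))
    add-corrector : (Dictator g × Corrects g) ⊎ Rare (blockTests n) (passes φ) 11 12 →
      (Σ (Input n → Bool) λ g → Dictator g × Corrects g) ⊎ Rare (blockTests n) (passes φ) 11 12
    add-corrector (inj₁ d) = inj₁ (g , d)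
    add-corrector (inj₂ r) = inj₂ r

-- Short decision lists

-- These are the first two terms of the binomial expansion. Besides `decay`, the bound q (1 - q) ^ N
-- ≤ 1 / (N + 1) for an overlooked block is an instance.
bernoulli : ∀ a b k → b ^ suc k + suc k * (a * b ^ k) ≤ (a + b) ^ suc k
bernoulli a b zero = ≤-reflexive (eq a b)
  where
  eq : ∀ a b → b * 1 + 1 * (a * 1) ≡ (a + b) * 1
  eq = solve-∀
bernoulli a b (suc k) = begin
  b ^ suc (suc k) + suc (suc k) * (a * b ^ suc k)
    ≤⟨ m≤m+n _ (suc k * (a * (a * b ^ k))) ⟩
  b ^ suc (suc k) + suc (suc k) * (a * b ^ suc k) + suc k * (a * (a * b ^ k))
    ≡⟨ eq a b (b ^ k) k ⟩
  (a + b) * (b ^ suc k + suc k * (a * b ^ k))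
    ≤⟨ *-monoʳ-≤ (a + b) (bernoulli a b k) ⟩
  (a + b) ^ suc (suc k) ∎
  where
  open ≤-Reasoning
  eq : ∀ a b c k → b * (b * c) + (1 + (1 + k)) * (a * (b * c)) + (1 + k) * (a * (a * c)) ≡ (a + b) *
      (b * c + (1 + k) * (a * c))
  eq = solve-∀

^-distribʳ-* : ∀ a b k → (a * b) ^ k ≡ a ^ k * b ^ k
^-distribʳ-* a b zero = refl
^-distribʳ-* a b (suc k) rewrite ^-distribʳ-* a b k = eq a b (a ^ k) (b ^ k)
  where
  eq : ∀ a b c d → a * b * (c * d) ≡ a * c * (b * d)
  eq = solve-∀

-- With q = a / (a + b) ≥ 1 / (M + 1), Bernoulli's inequality yields (1 - q) ^ (M + 1) ≤ 1/2; the
-- l-th power of this is the claim.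
decay : ∀ M a b l → a + b ≤ suc M * a → b ^ (suc M * l) * 2 ^ l ≤ (a + b) ^ (suc M * l)
decay M a b l h = begin
  b ^ (suc M * l) * 2 ^ l        ≡⟨ cong (_* 2 ^ l) (^-*-assoc b (suc M) l) ⟨
  (b ^ suc M) ^ l * 2 ^ l        ≡⟨ ^-distribʳ-* (b ^ suc M) 2 l ⟨
  (b ^ suc M * 2) ^ l            ≤⟨ ^-monoˡ-≤ l half ⟩
  ((a + b) ^ suc M) ^ l          ≡⟨ ^-*-assoc (a + b) (suc M) l ⟩
  (a + b) ^ (suc M * l)          ∎
  where
  open ≤-Reasoning
  half : b ^ suc M * 2 ≤ (a + b) ^ suc M
  half = begin
    b ^ suc M * 2                      ≡⟨ eq (b ^ suc M) ⟩
    b ^ suc M + b * b ^ M              ≤⟨ +-monoʳ-≤ (b ^ suc M) (*-monoˡ-≤ (b ^ M) (m≤n+m b a)) ⟩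
    b ^ suc M + (a + b) * b ^ M        ≤⟨ +-monoʳ-≤ (b ^ suc M) (*-monoˡ-≤ (b ^ M) h) ⟩
    b ^ suc M + suc M * a * b ^ M      ≡⟨ cong (b ^ suc M +_) (*-assoc (suc M) a (b ^ M)) ⟩
    b ^ suc M + suc M * (a * b ^ M)    ≤⟨ bernoulli a b M ⟩
    (a + b) ^ suc M                    ∎
    where
    eq : ∀ a → a * 2 ≡ a + a
    eq = solve-∀

length-cartesianProductWith : ∀ {A B C : Set} (f : A → B → C) xs ys →
  length (cartesianProductWith f xs ys) ≡ length xs * length ys
length-cartesianProductWith f [] ys = refl
length-cartesianProductWith f (x ∷ xs) ys = trans (length-++ (map (f x) ys))
  (cong₂ _+_ (length-map (f x) ys) (length-cartesianProductWith f xs ys))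

-- Decision lists all of whose rules are of the form T = 1.
Rule : Set → Set
Rule V = List (V × Bool) × Bool

litVal : V × Bool → (V → Bool) → Bool
litVal (v , b) ρ = if b then ρ v else (if ρ v then false else true)

termVal : List (V × Bool) → (V → Bool) → Bool
termVal t ρ = all (λ l → litVal l ρ) t

ruleVal : List (Rule V) → (V → Bool) → Bool
ruleVal [] ρ = false
ruleVal ((t , a) ∷ K) ρ = if termVal t ρ then a else ruleVal K ρ

-- The list of allowed outputs is what distinguishes r-DNFs from r-decision lists, so that both
-- classes share one proof.
Valid : ℕ → List Bool → Rule V → Set
Valid r o (t , a) = length t ≤ r × a ∈ o

-- `nothing` stands for a term discarded for lack of a literal. Its entry stays in the vector, so
-- that the marks of all recursive calls refer to the same positions.
fires : Maybe (Term n) → Input n → Bool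
fires nothing x = false
fires (just t) x = evalTerm t x

Short : ℕ → Maybe (Term n) → Set
Short r nothing = ⊤
Short r (just t) = length t ≤ r

-- The first term of L that fires on x is t, and t is not marked by M.
data Missed (x : Input n) : Vec (Maybe (Term n)) N → Vec Bool N → Term n → Set where
  here : ∀ {t} {L : Vec (Maybe (Term n)) N} {M} →
    evalTerm t x ≡ true → Missed x (just t ∷ L) (false ∷ M) t
  there : ∀ {t m b} {L : Vec (Maybe (Term n)) N} {M} →
    fires m x ≡ false → Missed x L M t → Missed x (m ∷ L) (b ∷ M) t

missed-fires : ∀ {x : Input n} {L : Vec (Maybe (Term n)) N} {M t} → Missed x L M t → evalTerm t x ≡ true
missed-fires (here e) = e
missed-fires (there _ μ) = missed-fires μ

infixl 6 _∪_
_∪_ : Vec Bool N → Vec Bool N → Vec Bool N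
_∪_ = zipWith _∨_

missed-∪ˡ : ∀ {x : Input n} {L : Vec (Maybe (Term n)) N} M {M′ t} → Missed x L (M ∪ M′) t → Missed x L M t
missed-∪ˡ (false ∷ M) {false ∷ M′} (here e) = here e
missed-∪ˡ (b ∷ M) {b′ ∷ M′} (there e μ) = there e (missed-∪ˡ M μ)

missed-∪ʳ : ∀ {x : Input n} {L : Vec (Maybe (Term n)) N} M {M′ t} → Missed x L (M ∪ M′) t → Missed x L M′ t
missed-∪ʳ (false ∷ M) {false ∷ M′} (here e) = here e
missed-∪ʳ (b ∷ M) {b′ ∷ M′} (there e μ) = there e (missed-∪ʳ M μ)

weight : Vec Bool N → ℕ
weight [] = 0
weight (b ∷ M) = ⟦ b ⟧ + weight M

weight-∪ : (M M′ : Vec Bool N) → weight (M ∪ M′) ≤ weight M + weight M′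
weight-∪ [] [] = z≤n
weight-∪ (b ∷ M) (b′ ∷ M′) = ≤-trans (+-mono-≤ (⟦⟧-∨ b b′) (weight-∪ M M′))
  (≤-reflexive (exch ⟦ b ⟧ ⟦ b′ ⟧ (weight M) (weight M′)))
  where
  exch : ∀ a b c d → a + b + (c + d) ≡ a + c + (b + d)
  exch = solve-∀

weight-none : ∀ N → weight (replicate N false) ≡ 0
weight-none zero = refl
weight-none (suc N) = weight-none N

_≟L_ : (k l : Literal n) → Dec (k ≡ l)
_≟L_ = ≡-dec _≟F_ _≟ᵇ_

removeLit : Literal n → Term n → Maybe (Term n)
removeLit l [] = nothing
removeLit l (k ∷ t) with l ≟L k
... | yes _ = just t
... | no _ = Maybe.map (k ∷_) (removeLit l t)

without : Literal n → Maybe (Term n) → Maybe (Term n)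
without l nothing = nothing
without l (just t) = removeLit l t

removeLit-∈ : ∀ {l : Literal n} {t} → l ∈ t → ∃ λ t′ → removeLit l t ≡ just t′
removeLit-∈ {l = l} {k ∷ t} l∈ with l ≟L k
... | yes _ = t , refl
removeLit-∈ {l = l} {k ∷ t} (here e) | no ne = ⊥-elim (ne e)
removeLit-∈ {l = l} {k ∷ t} (there l∈) | no ne with removeLit-∈ l∈
... | t′ , e rewrite e = k ∷ t′ , refl

removeLit-length : ∀ (l : Literal n) t {t′} → removeLit l t ≡ just t′ → length t ≡ suc (length t′)
removeLit-length l (k ∷ t) e with l ≟L k | e
... | yes _ | refl = refl
... | no _ | e′ with removeLit l t in eq | e′
...   | just t″ | refl = cong suc (removeLit-length l t eq)

removeLit-eval : ∀ (l : Literal n) t {t′} x → removeLit l t ≡ just t′ → evalTerm t x ≡ evalLit l x ∧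
    evalTerm t′ x
removeLit-eval l (k ∷ t) x e with l ≟L k | e
... | yes refl | refl = refl
... | no _ | e′ with removeLit l t in eq | e′
...   | just t″ | refl rewrite removeLit-eval l t x eq = ∧-exch (evalLit k x) (evalLit l x) (evalTerm t″ x)
  where
  ∧-exch : ∀ a b c → a ∧ (b ∧ c) ≡ b ∧ (a ∧ c)
  ∧-exch true b c = refl
  ∧-exch false b c = sym (∧-zeroʳ b)

without-short : ∀ r (l : Literal n) m → Short (suc r) m → Short r (without l m)
without-short r l nothing s = tt
without-short r l (just t) s with removeLit l t in e
... | nothing = tt
... | just t′ = ≤-pred (subst (_≤ suc r) (removeLit-length l t e) s)

without-silent : ∀ (l : Literal n) m x → evalLit l x ≡ true → fires m x ≡ false → fires (without l m) x ≡ false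
without-silent l nothing x lx e = refl
without-silent l (just t) x lx e with removeLit l t in eq
... | nothing = refl
... | just t′ = trans (sym (trans (removeLit-eval l t x eq) (cong (_∧ evalTerm t′ x) lx))) e

-- Where l is true, a term containing l keeps its value when l is removed, and the other terms
-- become silent. Thus the first firing term remains the first one.
missed-without : ∀ {x : Input n} {L : Vec (Maybe (Term n)) N} {M t t′} l → evalLit l x ≡ true →
  removeLit l t ≡ just t′ → Missed x L M t → Missed x (Vec.map (without l) L) M t′
missed-without {x = x} {t = t} {t′} l lx e (here tx) rewrite e =
  here (∧-trueʳ {evalLit l x} (trans (sym (removeLit-eval l t x e)) tx))
missed-without {x = x} l lx e (there {m = m} mx μ) = there (without-silent l m x lx mx)
    (missed-without l lx e μ)

vars : List (V × Bool) → List V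
vars = map proj₁

Ignores : (Input n → Bool) → List (Fin n) → Set
Ignores F U = ∀ x v b → v ∈ U → F (x [ v ]≔ b) ≡ F x

evalLit-xor : ∀ (l : Literal n) x → evalLit l x ≡ not (lookup x (proj₁ l) xor proj₂ l)
evalLit-xor (v , true) x with lookup x v
... | true = refl
... | false = refl
evalLit-xor (v , false) x with lookup x v
... | true = refl
... | false = refl

evalTerm-elsewhere : ∀ (t : Term n) x v b → ¬ v ∈ vars t → evalTerm t (x [ v ]≔ b) ≡ evalTerm t x
evalTerm-elsewhere [] x v b _ = refl
evalTerm-elsewhere (l ∷ t) x v b v∉ = cong₂ _∧_
  (trans (evalLit-xor l (x [ v ]≔ b)) (trans
    (cong (λ z → not (z xor proj₂ l)) (lookup∘update′ (λ e → v∉ (here (sym e))) x b)) (sym (evalLit-xor l x))))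
  (evalTerm-elsewhere t x v b (v∉ ∘ there))

evalTerm-towards : ∀ (t : Term n) x x₀ v → evalTerm t x ≡ true → evalTerm t x₀ ≡ true →
  evalTerm t (x [ v ]≔ lookup x₀ v) ≡ true
evalTerm-towards [] x x₀ v _ _ = refl
evalTerm-towards (l ∷ t) x x₀ v e e₀ = ∧-true (lit (proj₁ l ≟F v))
  (evalTerm-towards t x x₀ v (∧-trueʳ {evalLit l x} e) (∧-trueʳ {evalLit l x₀} e₀))
  where
  lit : Dec (proj₁ l ≡ v) → evalLit l (x [ v ]≔ lookup x₀ v) ≡ true
  lit (yes refl) = trans (evalLit-xor l (x [ v ]≔ lookup x₀ v)) (trans
    (cong (λ z → not (z xor proj₂ l)) (lookup∘update v x (lookup x₀ v)))
    (trans (sym (evalLit-xor l x₀)) (∧-trueˡ e₀)))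
  lit (no ne) = trans (evalLit-xor l (x [ v ]≔ lookup x₀ v)) (trans
    (cong (λ z → not (z xor proj₂ l)) (lookup∘update′ ne x (lookup x₀ v)))
    (trans (sym (evalLit-xor l x)) (∧-trueˡ e)))

-- Setting the variables of t one after the other to their values in `x₀` costs a factor of at most
-- 2 each, and it cannot falsify literals that are already satisfied, even when a variable is
-- repeated.
term-often : ∀ (t : Term n) x₀ F → evalTerm t x₀ ≡ true → Ignores F (vars t) →
  # (cube n) F ≤ 2 ^ length t * # (cube n) (λ x → evalTerm t x ∧ F x)
term-often [] x₀ F _ _ = ≤-reflexive (sym (*-identityˡ _))
term-often {n} (l ∷ t) x₀ F e₀ ig = begin
  # (cube n) F
    ≤⟨ term-often t x₀ F (∧-trueʳ {evalLit l x₀} e₀) (λ x v b → ig x v b ∘ there) ⟩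
  2 ^ length t * # (cube n) (λ x → evalTerm t x ∧ F x)
    ≤⟨ *-monoʳ-≤ (2 ^ length t) halved ⟩
  2 ^ length t * (2 * # (cube n) (λ x → evalTerm (l ∷ t) x ∧ F x))
    ≡⟨ exch (2 ^ length t) (# (cube n) (λ x → evalTerm (l ∷ t) x ∧ F x)) ⟩
  2 ^ length (l ∷ t) * # (cube n) (λ x → evalTerm (l ∷ t) x ∧ F x) ∎
  where
  open ≤-Reasoning
  exch : ∀ a b → a * (2 * b) ≡ 2 * a * b
  exch = solve-∀
  v = proj₁ l
  b₀ = lookup x₀ v
  b₀≡ : b₀ ≡ proj₂ l
  b₀≡ = xor-≡ (not-injective (trans (sym (evalLit-xor l x₀)) (∧-trueˡ e₀)))
    where
    not-injective : ∀ {a} → not a ≡ true → a ≡ false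
    not-injective {false} _ = refl
  halved : # (cube n) (λ x → evalTerm t x ∧ F x) ≤ 2 * # (cube n) (λ x → evalTerm (l ∷ t) x ∧ F x)
  halved = begin
    # (cube n) (λ x → evalTerm t x ∧ F x)
      ≤⟨ #-mono (cube n) (λ x e → ∧-true
           (evalTerm-towards t x x₀ v (∧-trueˡ e) (∧-trueʳ {evalLit l x₀} e₀))
           (trans (ig x v b₀ (here refl)) (∧-trueʳ {evalTerm t x} e))) ⟩
    ∑ n (λ x → ⟦ evalTerm t (x [ v ]≔ b₀) ∧ F (x [ v ]≔ b₀) ⟧)
      ≡⟨ ∑-update v b₀ (λ x → ⟦ evalTerm t x ∧ F x ⟧) ⟩
    2 * ∑ n (λ x → ⟦ not (lookup x v xor b₀) ⟧ * ⟦ evalTerm t x ∧ F x ⟧)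
      ≡⟨ cong (2 *_) (∑-cong {n} pointwise) ⟩
    2 * # (cube n) (λ x → evalTerm (l ∷ t) x ∧ F x) ∎
    where
    ∧-assoc′ : ∀ a b c → a ∧ (b ∧ c) ≡ (a ∧ b) ∧ c
    ∧-assoc′ true b c = refl
    ∧-assoc′ false b c = refl
    pointwise : ∀ x → ⟦ not (lookup x v xor b₀) ⟧ * ⟦ evalTerm t x ∧ F x ⟧ ≡ ⟦ evalTerm (l ∷ t) x ∧ F x ⟧
    pointwise x = trans (sym (⟦⟧-∧ (not (lookup x v xor b₀)) (evalTerm t x ∧ F x)))
      (cong ⟦_⟧ (trans (∧-assoc′ (not (lookup x v xor b₀)) (evalTerm t x) (F x))
        (cong (λ z → (z ∧ evalTerm t x) ∧ F x)
          (trans (cong (λ z → not (lookup x v xor z)) b₀≡) (sym (evalLit-xor l x))))))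

-- As F ignores the variables of t, it is independent of t, which is satisfiable and so fires with
-- probability at least 2 ^ (- r). A further disjoint term contributes a factor 1 - 2 ^ (- r).
rare-disjoint : ∀ r p (t : Term n) x₀ {F} → length t ≤ r → evalTerm t x₀ ≡ true → Ignores F (vars t) →
  Rare (cube n) F ((2 ^ r ∸ 1) ^ p) ((2 ^ r) ^ p) →
  Rare (cube n) (λ x → not (evalTerm t x) ∧ F x) ((2 ^ r ∸ 1) ^ suc p) ((2 ^ r) ^ suc p)
rare-disjoint {n} r p t x₀ {F} t≤r e ig ρ .bound = begin
  U * (R * R ^ p)             ≡⟨ *-assoc U R (R ^ p) ⟨
  U * R * R ^ p               ≤⟨ *-monoˡ-≤ (R ^ p) step ⟩
  (R ∸ 1) * # C F * R ^ p     ≡⟨ *-assoc (R ∸ 1) (# C F) (R ^ p) ⟩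
  (R ∸ 1) * (# C F * R ^ p)   ≤⟨ *-monoʳ-≤ (R ∸ 1) (bound ρ) ⟩
  (R ∸ 1) * ((R ∸ 1) ^ p * 2 ^ n) ≡⟨ *-assoc (R ∸ 1) _ (2 ^ n) ⟨
  (R ∸ 1) ^ suc p * 2 ^ n     ∎
  where
  open ≤-Reasoning
  C = cube n
  R = 2 ^ r
  T = # C (λ x → evalTerm t x ∧ F x)
  U = # C (λ x → not (evalTerm t x) ∧ F x)
  split : U + T ≡ # C F
  split = trans (sym (E-+ C _ _)) (∑-cong {n} (λ x → pick (evalTerm t x) (F x)))
    where
    pick : ∀ a b → ⟦ not a ∧ b ⟧ + ⟦ a ∧ b ⟧ ≡ ⟦ b ⟧
    pick true b = refl
    pick false b = +-identityʳ _
  F≤ : # C F ≤ R * T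
  F≤ = ≤-trans (term-often t x₀ F e ig) (*-monoˡ-≤ T (^-monoʳ-≤ 2 t≤r))
  step : U * R ≤ (R ∸ 1) * # C F
  step = +-cancelʳ-≤ (# C F) _ _ (begin
    U * R + # C F              ≤⟨ +-monoʳ-≤ (U * R) F≤ ⟩
    U * R + R * T              ≡⟨ eq U R T ⟩
    R * (U + T)                ≡⟨ cong (R *_) split ⟩
    R * # C F                  ≡⟨ cong (_* # C F) (suc-pred R {{>-nonZero (m^n>0 2 r)}}) ⟨
    suc (pred R) * # C F ≡⟨ cong (λ z → suc z * # C F) (pred[m]≡m∸1 R) ⟩
    suc (R ∸ 1) * # C F        ≡⟨ +-comm (# C F) _ ⟩
    (R ∸ 1) * # C F + # C F    ∎)
    where
    pred[m]≡m∸1 : ∀ m → pred m ≡ m ∸ 1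
    pred[m]≡m∸1 zero = refl
    pred[m]≡m∸1 (suc m) = refl
    eq : ∀ u r t → u * r + r * t ≡ r * (u + t)
    eq = solve-∀

Touches : Term n → List (Fin n) → Set
Touches t U = ∃ λ l → l ∈ t × proj₁ l ∈ U

-- Marks up to p satisfiable terms of L on pairwise disjoint sets of variables U;
-- F is the event that p terms are marked and none of them fires.
record Greedy (r p : ℕ) (W : List (Fin n)) (L : Vec (Maybe (Term n)) N) : Set where
  field
    marks : Vec Bool N
    used : List (Fin n)
    F : Input n → Bool
    marks≤ : weight marks ≤ p
    used≤ : length used ≤ p * r
    ignores : Ignores F W
    F-rare : Rare (cube n) F ((2 ^ r ∸ 1) ^ p) ((2 ^ r) ^ p)
    covers : ∀ x {t} → Missed x L marks t → Touches t (W ++ used) ⊎ F x ≡ true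

touches? : (t : Term n) (U : List (Fin n)) → Dec (Any (λ l → proj₁ l ∈ U) t)
touches? t U = any? (λ l → DecMembership._∈?_ _≟F_ (proj₁ l) U) t

-- W collects the variables of the terms marked earlier. Every term before the p-th marked one is
-- marked, unsatisfiable, or shares a variable with an earlier marked term. A later term can fire
-- first only where none of the p marked terms fires, which is the event F.
greedy : ∀ r p (W : List (Fin n)) (L : Vec (Maybe (Term n)) N) → VAll.All (Short r) L → Greedy r p W L
greedy {n} {N} r zero W L short = record
  { marks = replicate N false ; used = [] ; F = λ _ → true
  ; marks≤ = ≤-reflexive (weight-none N) ; used≤ = z≤n ; ignores = λ _ _ _ _ → refl
  ; F-rare = rare (≤-reflexive (trans (*-identityʳ _) (trans (∑-const n 1) (*-comm _ 1))))
  ; covers = λ _ _ → inj₂ refl }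
greedy r (suc p) W [] short = record
  -- The list ended before p terms could be marked: every missed term then touches a used variable,
  -- and no exceptional event is left.
  { marks = [] ; used = [] ; F = λ _ → false
  ; marks≤ = z≤n ; used≤ = z≤n ; ignores = λ _ _ _ _ → refl
  ; F-rare = rare-false _ _ (λ _ → refl)
  ; covers = λ _ () }
greedy {n} {suc N} r (suc p) W (m ∷ L) (s VAll.∷ short) = cases m s (skipping m)
  where
  rest = greedy r (suc p) W L short
  open Greedy rest
  Skippable : Maybe (Term n) → Set
  Skippable m = ∀ x t → m ≡ just t → evalTerm t x ≡ true → Touches t (W ++ used)
  skipping : ∀ m → Skippable m → Greedy r (suc p) W (m ∷ L)
  skipping m skip = record
    { marks = false ∷ marks ; used = used ; F = F
    ; marks≤ = marks≤ ; used≤ = used≤ ; ignores = ignores ; F-rare = F-rare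
    ; covers = λ { x (here e) → inj₁ (skip x _ refl e) ; x (there _ μ) → covers x μ } }
  cases : ∀ m → Short r m → (Skippable m → Greedy r (suc p) W (m ∷ L)) → Greedy r (suc p) W (m ∷ L)
  cases nothing s sk = sk (λ { x t () _ })
  cases (just t) s sk with touches? t W
  ... | yes touch = sk λ { x .t refl _ → let l , l∈t , v∈W = find touch in l , l∈t , ∈-++⁺ˡ v∈W }
  ... | no untouched with search n (evalTerm t)
  ...   | inj₂ unsat = sk λ { x .t refl e → ⊥-elim (true≢false (trans (sym e) (unsat x))) }
  ...   | inj₁ (x₀ , e₀) = record
    { marks = true ∷ G.marks ; used = vars t ++ G.used ; F = λ x → not (evalTerm t x) ∧ G.F x
    ; marks≤ = s≤s G.marks≤
    ; used≤ = ≤-trans (≤-reflexive (length-++ (vars t)))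
        (+-mono-≤ (≤-trans (≤-reflexive (length-map proj₁ t)) s) G.used≤)
    ; ignores = λ x v b v∈W → cong₂ (λ y z → not y ∧ z)
        (evalTerm-elsewhere t x v b (λ v∈t → let l , l∈t , e = ∈-map⁻ proj₁ v∈t in
          untouched (lose l∈t (subst (_∈ W) e v∈W))))
        (G.ignores x v b (∈-++⁺ˡ v∈W))
    ; F-rare = rare-disjoint r p t x₀ s e₀ (λ x v b v∈t → G.ignores x v b (∈-++⁺ʳ W v∈t)) G.F-rare
    ; covers = λ { x (there e μ) → Sum.map
        (λ { (l , l∈ , v∈) → l , l∈ , subst (proj₁ l ∈_) (++-assoc W (vars t) G.used) v∈ })
        (λ Fx → ∧-true (cong not e) Fx) (G.covers x μ) } }
    where module G = Greedy (greedy r p (W ++ vars t) L short)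

-- With this many disjoint terms, (1 - 2 ^ (- r)) ^ (2 ^ r p) ≤ 2 ^ (- p) by `decay`.
budget : ℕ → ℕ → ℕ
budget r p = 2 ^ r * p

greedy-rare : ∀ r p {F} → Rare (cube n) F ((2 ^ r ∸ 1) ^ budget r p) ((2 ^ r) ^ budget r p) → Rare (cube n)
    F 1 (2 ^ p)
greedy-rare r p = rare-scale (m^n>0 (2 ^ r) {{>-nonZero (m^n>0 2 r)}} (budget r p))
    (subst (λ R → (R ∸ 1) ^ (R * p) * 2 ^ p ≤ 1 * R ^ (R * p))
  (suc-pred (2 ^ r) {{>-nonZero (m^n>0 2 r)}})
  (≤-trans (decay (pred (2 ^ r)) 1 (pred (2 ^ r)) p (≤-reflexive (sym (*-identityʳ _))))
      (≤-reflexive (sym (*-identityˡ _)))))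

-- Bounds the literals over the variables of the marked terms: r variables per term, two signs per
-- variable.
branches : ℕ → ℕ → ℕ
branches r p = budget r p * r * 2

-- For constant r these are polynomials in p, of degrees r + 1 and r.
keptBound errBound : ℕ → ℕ → ℕ
keptBound zero p = budget zero p
keptBound (suc r) p = budget (suc r) p + branches (suc r) p * keptBound r p
errBound zero p = 1
errBound (suc r) p = 1 + branches (suc r) p * errBound r p

-- `X` says which missed terms have to be accounted for: all of them, or those that contain a
-- literal from a given list. `Z` is the exceptional set on which the thinned list may err.
record Approx (kept err p : ℕ) (L : Vec (Maybe (Term n)) N) (X : Input n → Term n → Set) : Set where
  field
    marks : Vec Bool N
    Z : Input n → Bool
    marks≤ : weight marks ≤ kept
    Z-rare : Rare (cube n) Z err (2 ^ p)
    covers : ∀ x {t} → X x t → Missed x L marks t → Z x ≡ true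

-- Terms containing l: remove l and approximate; where l is true, removing it
-- does not change which of them fire.
approx-literals : ∀ (r p : ℕ) (L : Vec (Maybe (Term n)) N) →
  (∀ l → Approx (keptBound r p) (errBound r p) p (Vec.map (without l) L) (λ _ _ → ⊤)) →
  ∀ Λ → Approx (length Λ * keptBound r p) (length Λ * errBound r p) p L (λ x t → ∃ λ l → l ∈ Λ × l ∈ t)
approx-literals {n} {N} r p L IH [] = record
  { marks = replicate N false ; Z = λ _ → false ; marks≤ = ≤-reflexive (weight-none N)
  ; Z-rare = rare-false _ _ (λ _ → refl) ; covers = λ { x (_ , () , _) } }
approx-literals {n} {N} r p L IH (l ∷ Λ) = record
  { marks = A.marks ∪ As.marks ; Z = λ x → A.Z x ∨ As.Z x
  ; marks≤ = ≤-trans (weight-∪ A.marks As.marks) (+-mono-≤ A.marks≤ As.marks≤)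
  ; Z-rare = rare-∨ {a = errBound r p} {length Λ * errBound r p} A.Z-rare As.Z-rare
  ; covers = λ
    { x {t} (.l , here refl , l∈t) μ → let t′ , e = removeLit-∈ l∈t in
        cong (_∨ As.Z x) (A.covers x tt (missed-without l
          (∧-trueˡ (trans (sym (removeLit-eval l t x e)) (missed-fires μ))) e (missed-∪ˡ A.marks μ)))
    ; x (k , there k∈Λ , k∈t) μ → ∨-trueʳ (A.Z x) (As.covers x (k , k∈Λ , k∈t) (missed-∪ʳ A.marks μ)) } }
  where
  module A = Approx (IH l)
  module As = Approx (approx-literals r p L IH Λ)

-- Outside the event of the greedy step, a missed term contains a literal over a used variable, and
-- removing it lowers r by one. For r = 0 no variable can be touched, so the greedy step alone
-- suffices.
approx : ∀ r p (L : Vec (Maybe (Term n)) N) → VAll.All (Short r) L →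
  Approx (keptBound r p) (errBound r p) p L (λ _ _ → ⊤)
approx zero p L short = record
  { marks = marks ; Z = F ; marks≤ = marks≤ ; Z-rare = greedy-rare 0 p F-rare
  ; covers = λ x _ μ → [ (λ { (l , _ , v∈) → ⊥-elim
      (empty used (≤-trans used≤ (≤-reflexive (*-zeroʳ (budget 0 p)))) v∈) }) , id ]′ (covers x μ) }
  where
  open Greedy (greedy 0 (budget 0 p) [] L short)
  empty : ∀ {A : Set} (xs : List A) → length xs ≤ 0 → ∀ {v} → ¬ v ∈ xs
  empty [] _ ()
approx (suc r) p L short = record
  { marks = G.marks ∪ A.marks ; Z = λ x → G.F x ∨ A.Z x
  ; marks≤ = ≤-trans (weight-∪ G.marks A.marks)
      (+-mono-≤ G.marks≤ (≤-trans A.marks≤ (*-monoˡ-≤ (keptBound r p) Λ≤)))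
  ; Z-rare = rare-∨ {a = 1} {branches (suc r) p * errBound r p} (greedy-rare (suc r) p G.F-rare)
      (rare-scale (m^n>0 2 p) (*-monoˡ-≤ (2 ^ p) (*-monoˡ-≤ (errBound r p) Λ≤)) A.Z-rare)
  ; covers = λ x _ μ → [
      (λ { ((v , b) , l∈t , v∈) → ∨-trueʳ (G.F x)
           (A.covers x ((v , b) , ∈-cartesianProduct⁺ v∈ (bool∈ b) , l∈t) (missed-∪ʳ G.marks μ)) }) ,
      (λ Fx → cong (_∨ A.Z x) Fx) ]′ (G.covers x (missed-∪ˡ G.marks μ)) }
  where
  module G = Greedy (greedy (suc r) (budget (suc r) p) [] L short)
  Λ = cartesianProduct G.used (true ∷ false ∷ [])
  Λ≤ : length Λ ≤ branches (suc r) p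
  Λ≤ = ≤-trans (≤-reflexive (length-cartesianProductWith _,_ G.used (true ∷ false ∷ []))) (*-monoˡ-≤ 2 G.used≤)
  bool∈ : ∀ b → b ∈ true ∷ false ∷ []
  bool∈ true = here refl
  bool∈ false = there (here refl)
  shorter : ∀ {N} l {L : Vec (Maybe (Term _)) N} → VAll.All (Short (suc r)) L → VAll.All (Short r)
      (Vec.map (without l) L)
  shorter l {[]} VAll.[] = VAll.[]
  shorter l {m ∷ L} (s VAll.∷ ss) = without-short r l m s VAll.∷ shorter l ss
  module A = Approx (approx-literals r p L (λ l → approx r p (Vec.map (without l) L) (shorter l short)) Λ)

-- From marked terms to short lists

terms : (K : List (Rule (Fin n))) → Vec (Maybe (Term n)) (length K)
terms [] = []
terms ((t , _) ∷ K) = just t ∷ terms K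

kept : (K : List (Rule (Fin n))) → Vec Bool (length K) → List (Rule (Fin n))
kept [] [] = []
kept (R ∷ K) (true ∷ M) = R ∷ kept K M
kept (R ∷ K) (false ∷ M) = kept K M

kept-length : (K : List (Rule (Fin n))) (M : Vec Bool (length K)) → length (kept K M) ≡ weight M
kept-length [] [] = refl
kept-length (R ∷ K) (true ∷ M) = cong suc (kept-length K M)
kept-length (R ∷ K) (false ∷ M) = kept-length K M

kept-All : ∀ {P : Rule (Fin n) → Set} {K} M → All P K → All P (kept K M)
kept-All [] [] = []
kept-All (true ∷ M) (p ∷ ps) = p ∷ kept-All M ps
kept-All (false ∷ M) (p ∷ ps) = kept-All M ps

kept-agrees : ∀ (K : List (Rule (Fin n))) M x → (∀ t → ¬ Missed x (terms K) M t) →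
  ruleVal K (lookup x) ≡ ruleVal (kept K M) (lookup x)
kept-agrees [] [] x h = refl
kept-agrees ((t , a) ∷ K) (true ∷ M) x h with evalTerm t x in e
... | true = refl
... | false = kept-agrees K M x (λ t μ → h t (there e μ))
kept-agrees ((t , a) ∷ K) (false ∷ M) x h with evalTerm t x in e
... | true = ⊥-elim (h t (here e))
... | false = kept-agrees K M x (λ t μ → h t (there e μ))

short-rules : ∀ r o p (K : List (Rule (Fin n))) → All (Valid r o) K →
  Σ (List (Rule (Fin n))) λ K′ → All (Valid r o) K′ × length K′ ≤ keptBound r p ×
    Rare (cube n) (λ x → ruleVal K (lookup x) xor ruleVal K′ (lookup x)) (errBound r p) (2 ^ p)
short-rules {n} r o p K valid = kept K marks , kept-All marks valid ,
  ≤-trans (≤-reflexive (kept-length K marks)) marks≤ , rare-mono differs Z-rare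
  where
  all-short : ∀ {K : List (Rule (Fin n))} → All (Valid r o) K → VAll.All (Short r) (terms K)
  all-short [] = VAll.[]
  all-short ((s , _) ∷ ss) = s VAll.∷ all-short ss
  open Approx (approx r p (terms K) (all-short valid))
  differs : ∀ x → ruleVal K (lookup x) xor ruleVal (kept K marks) (lookup x) ≡ true → Z x ≡ true
  differs x e with Z x in z
  ... | true = refl
  ... | false = trans (sym (xor-false (kept-agrees K marks x
    (λ t μ → true≢false (trans (sym (covers x tt μ)) z))))) e

-- Substitution, hypotheses and the two classes

assign : (V → W ⊎ Bool) → (W → Bool) → V → Bool
assign σ ρ v = [ ρ , id ]′ (σ v)

-- `nothing` is a term falsified by a substituted constant; `substRules` drops its rule, so
-- substitution never lengthens a list.
substTerm : (V → W ⊎ Bool) → List (V × Bool) → Maybe (List (W × Bool))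
substTerm σ [] = just []
substTerm σ ((v , b) ∷ t) with σ v
... | inj₁ w = Maybe.map ((w , b) ∷_) (substTerm σ t)
... | inj₂ c = if litVal (c , b) id then substTerm σ t else nothing

substRules : (V → W ⊎ Bool) → List (Rule V) → List (Rule W)
substRules σ [] = []
substRules σ ((t , a) ∷ K) with substTerm σ t
... | just t′ = (t′ , a) ∷ substRules σ K
... | nothing = substRules σ K

maybeVal : Maybe (List (W × Bool)) → (W → Bool) → Bool
maybeVal (just t) ρ = termVal t ρ
maybeVal nothing ρ = false

substTerm-val : ∀ (σ : V → W ⊎ Bool) t ρ → maybeVal (substTerm σ t) ρ ≡ termVal t (assign σ ρ)
substTerm-val σ [] ρ = refl
substTerm-val σ ((v , b) ∷ t) ρ rewrite sym (substTerm-val σ t ρ) with σ v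
... | inj₁ w with substTerm σ t
...   | just t′ = refl
...   | nothing = sym (∧-zeroʳ _)
substTerm-val σ ((v , b) ∷ t) ρ | inj₂ c with litVal (c , b) id
...   | true = refl
...   | false = refl

substRules-val : ∀ (σ : V → W ⊎ Bool) K ρ → ruleVal (substRules σ K) ρ ≡ ruleVal K (assign σ ρ)
substRules-val σ [] ρ = refl
substRules-val σ ((t , a) ∷ K) ρ rewrite sym (substTerm-val σ t ρ) | sym (substRules-val σ K ρ) with
    substTerm σ t
... | just t′ = refl
... | nothing = refl

substTerm-length : ∀ (σ : V → W ⊎ Bool) t {t′} → substTerm σ t ≡ just t′ → length t′ ≤ length t
substTerm-length σ [] refl = z≤n
substTerm-length σ ((v , b) ∷ t) e with σ v | e
... | inj₁ w | e′ with substTerm σ t in eq | e′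
...   | just t″ | refl = s≤s (substTerm-length σ t eq)
substTerm-length σ ((v , b) ∷ t) e | inj₂ c | e′ with litVal (c , b) id | e′
...   | true | e″ = m≤n⇒m≤1+n (substTerm-length σ t e″)

substRules-valid : ∀ (σ : V → W ⊎ Bool) {K r o} → All (Valid r o) K → All (Valid r o) (substRules σ K)
substRules-valid σ [] = []
substRules-valid σ {(t , a) ∷ K} ((t≤r , a∈o) ∷ vs) with substTerm σ t in e
... | just t′ = (≤-trans (substTerm-length σ t e) t≤r , a∈o) ∷ substRules-valid σ vs
... | nothing = substRules-valid σ vs

substRules-length : ∀ (σ : V → W ⊎ Bool) K → length (substRules σ K) ≤ length K
substRules-length σ [] = z≤n
substRules-length σ ((t , a) ∷ K) with substTerm σ t
... | just t′ = s≤s (substRules-length σ K)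
... | nothing = m≤n⇒m≤1+n (substRules-length σ K)

ruleVars : List (Rule V) → List V
ruleVars [] = []
ruleVars ((t , a) ∷ K) = vars t ++ ruleVars K

ruleVars-length : ∀ {K : List (Rule V)} {r o} → All (Valid r o) K → length (ruleVars K) ≤ length K * r
ruleVars-length [] = z≤n
ruleVars-length {K = (t , a) ∷ K} ((t≤r , _) ∷ vs) = ≤-trans (≤-reflexive (length-++ (vars t)))
  (+-mono-≤ (≤-trans (≤-reflexive (length-map proj₁ t)) t≤r) (ruleVars-length vs))

termVal-cong : ∀ (t : List (V × Bool)) {ρ ρ′ : V → Bool} → (∀ {v} → v ∈ vars t → ρ v ≡ ρ′ v) → termVal t ρ ≡
    termVal t ρ′
termVal-cong [] h = refl
termVal-cong ((v , b) ∷ t) h rewrite h (here refl) | termVal-cong t (h ∘ there) = refl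

ruleVal-cong : ∀ (K : List (Rule V)) {ρ ρ′ : V → Bool} → (∀ {v} → v ∈ ruleVars K → ρ v ≡ ρ′ v) → ruleVal K ρ
    ≡ ruleVal K ρ′
ruleVal-cong [] h = refl
ruleVal-cong ((t , a) ∷ K) h rewrite termVal-cong t (h ∘ ∈-++⁺ˡ) | ruleVal-cong K (h ∘ ∈-++⁺ʳ (vars t)) = refl

-- Enumeration of the hypotheses

listsUpTo : List A → ℕ → List (List A)
listsUpTo xs zero = [] ∷ []
listsUpTo xs (suc k) = [] ∷ cartesianProductWith _∷_ xs (listsUpTo xs k)

listsUpTo-complete : ∀ {xs : List A} k {l} → All (_∈ xs) l → length l ≤ k → l ∈ listsUpTo xs k
listsUpTo-complete zero [] _ = here refl
listsUpTo-complete (suc k) [] _ = here refl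
listsUpTo-complete (suc k) (a∈ ∷ l∈) (s≤s h) = there
    (∈-cartesianProductWith⁺ _∷_ a∈ (listsUpTo-complete k l∈ h))

listsUpTo-sound : ∀ (xs : List A) k {l} → l ∈ listsUpTo xs k → All (_∈ xs) l × length l ≤ k
listsUpTo-sound xs zero (here refl) = [] , z≤n
listsUpTo-sound xs (suc k) (here refl) = [] , z≤n
listsUpTo-sound xs (suc k) (there l∈) with ∈-cartesianProductWith⁻ _∷_ xs (listsUpTo xs k) l∈
... | a , l , a∈ , l∈′ , refl with listsUpTo-sound xs k l∈′
...   | all∈ , h = a∈ ∷ all∈ , s≤s h

listsUpTo-length : ∀ (xs : List A) k → length (listsUpTo xs k) ≤ suc (length xs) ^ k
listsUpTo-length xs zero = ≤-refl
listsUpTo-length xs (suc k) = +-mono-≤ (m^n>0 (suc (length xs)) k)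
  (≤-trans (≤-reflexive (length-cartesianProductWith _∷_ xs (listsUpTo xs k)))
      (*-monoʳ-≤ (length xs) (listsUpTo-length xs k)))

n<2^n : ∀ n → n < 2 ^ n
n<2^n zero = s≤s z≤n
n<2^n (suc n) = +-mono-≤ (m^n>0 2 n) (≤-trans (n<2^n n) (≤-reflexive (sym (+-identityʳ _))))

allLits : ∀ N → List (Fin N × Bool)
allLits N = cartesianProduct (allFin N) (true ∷ false ∷ [])

allRules : ∀ N → ℕ → List Bool → List (Rule (Fin N))
allRules N r o = cartesianProduct (listsUpTo (allLits N) r) o

hypotheses : ∀ N → ℕ → List Bool → ℕ → List (List (Rule (Fin N)))
hypotheses N r o s = listsUpTo (allRules N r o) s

hypotheses-complete : ∀ {r o s} {K : List (Rule (Fin N))} → All (Valid r o) K → length K ≤ s → K ∈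
    hypotheses N r o s
hypotheses-complete {r = r} {s = s} vs = listsUpTo-complete s (All.map
  (λ { {t , a} (t≤r , a∈o) → ∈-cartesianProduct⁺ (listsUpTo-complete r (All.tabulate (λ { {v , b} _ →
    ∈-cartesianProduct⁺ (∈-allFin v) (bool∈ b) })) t≤r) a∈o }) vs)
  where
  bool∈ : ∀ b → b ∈ true ∷ false ∷ []
  bool∈ true = here refl
  bool∈ false = there (here refl)

hypotheses-sound : ∀ {r o s} {K : List (Rule (Fin N))} → K ∈ hypotheses N r o s → All (Valid r o) K
hypotheses-sound {N} {r} {o} {s} K∈ = All.map
  (λ { {t , a} R∈ → let t∈ , a∈ = ∈-cartesianProduct⁻ (listsUpTo (allLits N) r) o R∈ in
    proj₂ (listsUpTo-sound (allLits N) r t∈) , a∈ })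
  (proj₁ (listsUpTo-sound (allRules N r o) s K∈))

-- The exponent comes from (1 + R) ^ s ≤ 2 ^ (R s), where R bounds the number of rules. This is
-- crude, but still polynomial in p when N and s are and r is constant.
hypBits : ℕ → ℕ → ℕ → ℕ
hypBits N r s = (1 + N * 2) ^ r * 2 * s

hypotheses-length : ∀ N r o s → length o ≤ 2 → length (hypotheses N r o s) ≤ 2 ^ hypBits N r s
hypotheses-length N r o s o≤2 = begin
  length (hypotheses N r o s)              ≤⟨ listsUpTo-length (allRules N r o) s ⟩
  suc (length (allRules N r o)) ^ s        ≤⟨ ^-monoˡ-≤ s (s≤s rules≤) ⟩
  suc ((1 + N * 2) ^ r * 2) ^ s            ≤⟨ ^-monoˡ-≤ s (n<2^n ((1 + N * 2) ^ r * 2)) ⟩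
  (2 ^ ((1 + N * 2) ^ r * 2)) ^ s          ≡⟨ ^-*-assoc 2 ((1 + N * 2) ^ r * 2) s ⟩
  2 ^ hypBits N r s                        ∎
  where
  open ≤-Reasoning
  rules≤ : length (allRules N r o) ≤ (1 + N * 2) ^ r * 2
  rules≤ = begin
    length (allRules N r o)
      ≡⟨ length-cartesianProductWith _,_ (listsUpTo (allLits N) r) o ⟩
    length (listsUpTo (allLits N) r) * length o
      ≤⟨ *-mono-≤ (listsUpTo-length (allLits N) r) o≤2 ⟩
    suc (length (allLits N)) ^ r * 2
      ≡⟨ cong (λ z → suc z ^ r * 2) (trans (length-cartesianProductWith _,_ (allFin N) (true ∷ false ∷ []))
           (cong (λ l → l * 2) (length-tabulate {n = N} id))) ⟩
    (1 + N * 2) ^ r * 2 ∎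

-- Equivalence with r-decision lists and r-DNFs

Rules : List Bool → ℕ → Class
Rules o r n f = Σ (List (Rule (Fin n))) λ K → All (Valid r o) K × (∀ x → f x ≡ ruleVal K (lookup x))

both : List Bool
both = true ∷ false ∷ []

rules⇒dl : ∀ r f → Rules both r n f → RDL r n f
rules⇒dl {n} r f (K , vs , f≡) = toDL K , shorts vs , λ x → trans (f≡ x) (same K x)
  where
  toDL : List (Rule (Fin n)) → DecisionList n
  toDL = map (λ (t , a) → t , true , a)
  shorts : ∀ {K} → All (Valid r both) K → AllRTerms r (toDL K)
  shorts [] = []
  shorts ((s , _) ∷ vs) = s ∷ shorts vs
  same : ∀ K x → ruleVal K (lookup x) ≡ evalDL (toDL K) x
  same [] x = refl
  same ((t , a) ∷ K) x with evalTerm t x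
  ... | true = refl
  ... | false = same K x

-- A rule T = 0 fires when some literal of T fails, so it is replaced by one
-- rule for the negation of each literal.
dl⇒rules : ∀ r f → RDL r n f → Rules both r n f
dl⇒rules {n} r f (L , shorts , f≡) = toRules L , valid shorts , λ x → trans (f≡ x) (same L x)
  where
  negations : Bool → Term n → List (Rule (Fin n)) → List (Rule (Fin n))
  negations a [] K = K
  negations a ((i , b) ∷ t) K = ((i , not b) ∷ [] , a) ∷ negations a t K
  toRules : DecisionList n → List (Rule (Fin n))
  toRules [] = []
  toRules ((t , true , a) ∷ L) = (t , a) ∷ toRules L
  toRules ((t , false , a) ∷ L) = negations a t (toRules L)
  output∈ : ∀ a → a ∈ both
  output∈ true = here refl
  output∈ false = there (here refl)
  negations-valid : ∀ a t {K} → length t ≤ r → All (Valid r both) K → All (Valid r both) (negations a t K)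
  negations-valid a [] _ vs = vs
  negations-valid a (l ∷ t) h vs = (≤-trans (s≤s z≤n) h , output∈ a) ∷ negations-valid a t
      (≤-trans (n≤1+n _) h) vs
  valid : ∀ {L} → AllRTerms r L → All (Valid r both) (toRules L)
  valid [] = []
  valid (_∷_ {ξ = true} {a} s ss) = (s , output∈ a) ∷ valid ss
  valid (_∷_ {T = t} {false} {a} s ss) = negations-valid a t s (valid ss)
  litVal-not : ∀ (l : Literal n) x → litVal (proj₁ l , not (proj₂ l)) (lookup x) ≡ not (evalLit l x)
  litVal-not (i , true) x with lookup x i
  ... | true = refl
  ... | false = refl
  litVal-not (i , false) x with lookup x i
  ... | true = refl
  ... | false = refl
  negations-val : ∀ a t K x → ruleVal (negations a t K) (lookup x) ≡
      (if evalTerm t x then ruleVal K (lookup x) else a)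
  negations-val a [] K x = refl
  negations-val a (l ∷ t) K x rewrite litVal-not l x with evalLit l x
  ... | true = negations-val a t K x
  ... | false = refl
  same : ∀ L x → evalDL L x ≡ ruleVal (toRules L) (lookup x)
  same [] x = refl
  same ((t , true , a) ∷ L) x with evalTerm t x
  ... | true = refl
  ... | false = same L x
  same ((t , false , a) ∷ L) x rewrite negations-val a t (toRules L) x with evalTerm t x
  ... | true = same L x
  ... | false = refl

rules⇒dnf : ∀ r f → Rules (true ∷ []) r n f → RDNF r n f
rules⇒dnf {n} r f (K , vs , f≡) = map proj₁ K , shorts vs , λ x → trans (f≡ x) (same vs x)
  where
  shorts : ∀ {K} → All (Valid r (true ∷ [])) K → AllRTermsDNF r (map proj₁ K)
  shorts [] = []
  shorts ((s , _) ∷ vs) = s ∷ shorts vs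
  same : ∀ {K} → All (Valid r (true ∷ [])) K → ∀ x → ruleVal K (lookup x) ≡ evalDNF (map proj₁ K) x
  same [] x = refl
  same {(t , .true) ∷ K} ((_ , here refl) ∷ vs) x with evalTerm t x
  ... | true = refl
  ... | false = same vs x

dnf⇒rules : ∀ r f → RDNF r n f → Rules (true ∷ []) r n f
dnf⇒rules {n} r f (D , shorts , f≡) = map (_, true) D , valid shorts , λ x → trans (f≡ x) (same D x)
  where
  valid : ∀ {D : DNF n} → AllRTermsDNF r D → All (Valid r (true ∷ [])) (map (_, true) D)
  valid [] = []
  valid (s ∷ ss) = (s , here refl) ∷ valid ss
  same : ∀ (D : DNF n) x → evalDNF D x ≡ ruleVal (map (_, true) D) (lookup x)
  same [] x = refl
  same (t ∷ D) x with evalTerm t x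
  ... | true = refl
  ... | false = same D x

testable-≅ : ∀ {C D : Class} → (∀ {n} f → C n f → D n f) → (∀ {n} f → D n f → C n f) →
  TestableWithSoftOInvEps C → TestableWithSoftOInvEps D
testable-≅ C⇒D D⇒C (c , k , tester) = c , k , λ ε n →
  let A , (accepts , rejects) , cost = tester ε n in
  A , ((λ f d → accepts f (D⇒C f d)) , (λ f far → rejects f (λ g Cg → far g (C⇒D g Cg)))) , cost

-- Query algorithms and the tester

-- The index γ bounds the number of queries. `compile` takes a continuation, so that sequencing is
-- composition and the bounds add up; `eval` is the meaning used in all probability arguments.
record Query (n : ℕ) (A : Set) (γ : ℕ) : Set where
  no-eta-equality
  field
    eval : BoolFun n → A
    compile : (A → QTree n) → QTree n
    run-compile : ∀ κ f → run (compile κ) f ≡ run (κ (eval f)) f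
    depth-compile : ∀ κ e → (∀ a → depth (κ a) ≤ e) → depth (compile κ) ≤ γ + e

open Query

pure : A → Query n A γ
pure a .eval f = a
pure a .compile κ = κ a
pure a .run-compile κ f = refl
pure {γ = γ} a .depth-compile κ e h = ≤-trans (h a) (m≤n+m e γ)

ask : Input n → Query n Bool 1
ask x .eval f = f x
ask x .compile κ = query x κ
ask x .run-compile κ f = refl
ask x .depth-compile κ e h = s≤s (⊔-lub (h true) (h false))

infixl 1 _>>=_
_>>=_ : Query n A γ → (A → Query n B δ) → Query n B (γ + δ)
(p >>= q) .eval f = eval (q (eval p f)) f
(p >>= q) .compile κ = compile p (λ a → compile (q a) κ)
(p >>= q) .run-compile κ f = trans (run-compile p _ f) (run-compile (q (eval p f)) κ f)
_>>=_ {γ = γ} {δ = δ} p q .depth-compile κ e h = ≤-trans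
  (depth-compile p _ (δ + e) (λ a → depth-compile (q a) κ e h)) (≤-reflexive (sym (+-assoc γ δ e)))

mapQ : (A → B) → Query n A γ → Query n B γ
mapQ h p .eval f = h (eval p f)
mapQ h p .compile κ = compile p (κ ∘ h)
mapQ h p .run-compile κ f = run-compile p (κ ∘ h) f
mapQ h p .depth-compile κ e b = depth-compile p (κ ∘ h) e (b ∘ h)

forF : (Fin N → Query n A γ) → Query n (Vec A N) (N * γ)
forF q .eval f = tabulate (λ i → eval (q i) f)
forF {zero} q .compile κ = κ []
forF {suc N} q .compile κ = compile (q zero) λ a → compile (forF (q ∘ suc)) λ v → κ (a ∷ v)
forF {zero} q .run-compile κ f = refl
forF {suc N} q .run-compile κ f = trans (run-compile (q zero) _ f) (run-compile (forF (q ∘ suc)) _ f)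
forF {zero} q .depth-compile κ e h = h []
forF {suc N} {γ = γ} q .depth-compile κ e h = ≤-trans
  (depth-compile (q zero) _ (N * γ + e) (λ a → depth-compile (forF (q ∘ suc)) _ e (λ v → h (a ∷ v))))
  (≤-reflexive (sym (+-assoc γ (N * γ) e)))

any-intro : ∀ (p : A → Bool) {xs x} → x ∈ xs → p x ≡ true → any p xs ≡ true
any-intro p {x ∷ xs} (here refl) e rewrite e = refl
any-intro p {x ∷ xs} (there x∈) e = ∨-trueʳ (p x) (any-intro p x∈ e)

any-elim : ∀ (p : A → Bool) xs → any p xs ≡ true → ∃ λ x → x ∈ xs × p x ≡ true
any-elim p (x ∷ xs) e with p x in px
... | true = x , here refl , px
... | false = let y , y∈ , py = any-elim p xs e in y , there y∈ , py

mutual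
  -- Solved to the local function maxList in the definition of queries.
  maxDepth : RandAlg n → List ℕ → ℕ
  maxDepth = _

  queries-maxDepth : (𝒜 : RandAlg n) →
    queries 𝒜 ≡ maxDepth 𝒜 (map (λ ω → depth (tree 𝒜 ω)) (allInputs (coins 𝒜)))
  queries-maxDepth 𝒜 with map (λ ω → depth (tree 𝒜 ω)) (allInputs (coins 𝒜))
  ... | ds = refl

queries≤ : ∀ (𝒜 : RandAlg n) b → (∀ ω → depth (tree 𝒜 ω) ≤ b) → queries 𝒜 ≤ b
queries≤ 𝒜 b h rewrite queries-maxDepth 𝒜 = bounded (allInputs (coins 𝒜))
  where
  bounded : ∀ ωs → maxDepth 𝒜 (map (λ ω → depth (tree 𝒜 ω)) ωs) ≤ b
  bounded [] = z≤n
  bounded (ω ∷ ωs) = ⊔-lub (h ω) (bounded ωs)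

compileAlg : Source A → (A → Query n Bool γ) → RandAlg n
compileAlg S q .coins = bits S
compileAlg S q .tree ω = compile (q (draw S ω)) halt

compileAlg-queries : ∀ (S : Source A) (q : A → Query n Bool γ) → queries (compileAlg S q) ≤ γ
compileAlg-queries {γ = γ} S q = queries≤ (compileAlg S q) γ λ ω →
  ≤-trans (depth-compile (q (draw S ω)) halt 0 (λ _ → z≤n)) (≤-reflexive (+-identityʳ γ))

compileAlg-outcomes : ∀ (S : Source A) (q : A → Query n Bool γ) f b →
  outcomes (compileAlg S q) f b ≡ # S (λ a → not (eval (q a) f xor b))
compileAlg-outcomes S q f b = trans (length-filter-∑ (bits S) _)
  (trans (∑-cong (λ ω → cong ⟦_⟧ (trans (does-≟ (run (compile (q (draw S ω)) halt) f) b)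
      (cong (λ z → not (z xor b)) (run-compile (q (draw S ω)) halt f)))))
    (sym (E-draw S _)))
  where
  does-≟ : ∀ x y → does (_≟ᵇ_ x y) ≡ not (x xor y)
  does-≟ true true = refl
  does-≟ true false = refl
  does-≟ false true = refl
  does-≟ false false = refl

-- Each of the three bad events on either side is bounded by 1/16, and 5/16 is the largest multiple
-- of 1/16 below 1/3.
compileAlg-prob : ∀ (S : Source A) (q : A → Query n Bool γ) f b →
  Rare S (λ a → eval (q a) f xor b) 5 16 → ProbAtLeast2/3 (compileAlg S q) f b
compileAlg-prob S q f b r = subst (λ z → 2 * size S ≤ 3 * z) (sym (compileAlg-outcomes S q f b))
  (two-thirds (# S (λ a → eval (q a) f xor b)) _ (size S) (#-not S (λ a → eval (q a) f xor b)) (bound r))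
  where
  two-thirds : ∀ x y s → x + y ≡ s → x * 16 ≤ 5 * s → 2 * s ≤ 3 * y
  two-thirds x y s refl h = +-cancelˡ-≤ (3 * x) (2 * (x + y)) (3 * y) (begin
    3 * x + 2 * (x + y)     ≤⟨ +-monoˡ-≤ (2 * (x + y)) 3x≤s ⟩
    (x + y) + 2 * (x + y)   ≡⟨ eq x y ⟩
    3 * x + 3 * y           ∎)
    where
    open ≤-Reasoning
    eq : ∀ x y → (x + y) + 2 * (x + y) ≡ 3 * x + 3 * y
    eq = solve-∀
    eq₅ : ∀ x → 5 * (3 * x) ≡ x * 15
    eq₅ = solve-∀
    3x≤s : 3 * x ≤ x + y
    3x≤s = *-cancelˡ-≤ 5 (begin
      5 * (3 * x)   ≡⟨ eq₅ x ⟩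
      x * 15        ≤⟨ *-monoʳ-≤ x (n≤1+n 15) ⟩
      x * 16        ≤⟨ h ⟩
      5 * (x + y)   ∎)

-- Repetitions have to be unanimous: a wrong first bit is then accepted only if it is wrong for all
-- independent seeds, which makes the error exponentially small in their number.
steady : Vec Bool (suc N) → Bool
steady v = allF (λ e → not (lookup v e xor lookup v zero))

not-xor : ∀ {a b} → a ≡ b → not (a xor b) ≡ true
not-xor e = cong not (xor-false e)

not-xor⁻ : ∀ {a b} → not (a xor b) ≡ true → a ≡ b
not-xor⁻ {true} {true} _ = refl
not-xor⁻ {false} {false} _ = refl

steady⁻ : (v : Vec Bool (suc N)) → steady v ≡ true → ∀ e → lookup v e ≡ lookup v zero
steady⁻ v st e = not-xor⁻ (allF-elim {P = λ e → not (lookup v e xor lookup v zero)} st e)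

onWitness : Maybe (Input n) → A → (Input n → Query n A γ) → Query n A γ
onWitness nothing a q = pure a
onWitness (just w) a q = q w

findWitness : (Fin n → Bool) → Vec (Input n × Input n) N → Query n (Maybe (Input n)) (N * 2)
findWitness S [] = pure nothing
findWitness S ((x , y) ∷ ts) = ask x >>= λ p → ask (mix S x y) >>= λ q →
  if p xor q then pure (just x) else findWitness S ts

probeQ : (Fin n → Bool) → Input n → Input n → Input n → Query n Bool 2
probeQ S w a s = ask (mix S w (s ⊕ a)) >>= λ p → ask (mix S w s) >>= λ q → pure (p xor q)

restrict : BoolFun n → (Fin n → Bool) → Input n → BoolFun n
restrict f S w u = f (mix S w u)

-- A block without a witness reads as the constant `false`. In soundness this is a substituted
-- constant; in completeness the accepted hypothesis does not mention such a block.
extracted : BoolFun n → (Fin n → Bool) → Maybe (Input n) → Input n → Input n → Bool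
extracted f S nothing x s = false
extracted f S (just w) x s = probe (restrict f S w) x s

-- N tries per block to find a witness, T tests of a found block, m samples, and
-- t + 1 repetitions for every extracted bit; H is the list of hypotheses.
module Tester (n β N T t m : ℕ) (H : List (List (Rule (Fin (2 ^ β))))) where

  Blocks : ℕ
  Blocks = 2 ^ β

  encode : ∀ {k} → Input k → Fin (2 ^ k)
  encode [] = zero
  encode (true ∷ x) = combine {2} zero (encode x)
  encode (false ∷ x) = combine {2} (suc zero) (encode x)

  Try Sample Coins : Set
  Try = Input n × Input n
  Sample = Input n × Vec (Vec (Input n) (suc t)) Blocks
  Coins = Vec (Fin Blocks) n × Vec (Vec Try N) Blocks × Vec (Vec (BlockTest n) T) Blocks × Input n × Vec
      Sample m

  blocks : Source (Fin Blocks)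
  blocks = mapS encode (cube β)

  try : Source Try
  try = cube n ⊗ cube n

  sample : Source Sample
  sample = cube n ⊗ vec Blocks (vec (suc t) (cube n))

  -- The fourth component is never queried: it only serves in the analysis.
  allCoins : Source Coins
  allCoins = vec n blocks ⊗ vec Blocks (vec N try) ⊗ vec Blocks (vec T (blockTests n)) ⊗ cube n ⊗ vec m sample

  block : Vec (Fin Blocks) n → Fin Blocks → Fin n → Bool
  block P b i = does (lookup P i ≟F b)

  testQ : (Fin n → Bool) → Input n → BlockTest n → Query n Bool 8
  testQ S w (uv , ss) = mapQ (λ v → consistent (lookup v))
      (forF λ i → probeQ S w (direction uv i) (lookup ss i))

  checkBlock : (Fin n → Bool) → Maybe (Input n) → Vec (BlockTest n) T → Query n Bool (T * 8)
  checkBlock S mw tests = onWitness mw true λ w → mapQ (λ v → allF (lookup v))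
      (forF λ j → testQ S w (lookup tests j))

  Row : Set
  Row = Bool × Vec (Vec Bool (suc t)) Blocks

  extract : (Fin n → Bool) → Maybe (Input n) → Input n → Vec (Input n) (suc t) → Query n (Vec Bool (suc t))
      (suc t * 2)
  extract S mw x seeds = onWitness mw (replicate _ false) λ w → forF λ e → probeQ S w x (lookup seeds e)

  row : Vec (Fin Blocks) n → Vec (Maybe (Input n)) Blocks → Sample → Query n Row (1 + Blocks * (suc t * 2))
  row P ws (x , seeds) = ask x >>= λ y → mapQ (y ,_)
      (forF λ b → extract (block P b) (lookup ws b) x (lookup seeds b))

  fits : List (Rule (Fin Blocks)) → Row → Bool
  fits h (y , bs) = not (y xor ruleVal h (λ b → lookup (lookup bs b) zero))

  verdict : Vec Bool Blocks → Vec Row m → Bool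
  verdict oks rows = allF (lookup oks) ∧
    (allF (λ i → allF λ b → steady (lookup (proj₂ (lookup rows i)) b)) ∧
     any (λ h → allF λ i → fits h (lookup rows i)) H)

  cost : ℕ
  cost = Blocks * (N * 2) + (Blocks * (T * 8) + m * (1 + Blocks * (suc t * 2)))

  tester : Coins → Query n Bool cost
  tester (P , tries , tests , _ , samples) =
    forF (λ b → findWitness (block P b) (lookup tries b)) >>= λ ws →
    forF (λ b → checkBlock (block P b) (lookup ws b) (lookup tests b)) >>= λ oks →
    mapQ (verdict oks) (forF λ i → row P ws (lookup samples i))

  module Run (f : BoolFun n) (P : Vec (Fin Blocks) n) (tries : Vec (Vec Try N) Blocks)
    (tests : Vec (Vec (BlockTest n) T) Blocks) (z : Input n) (samples : Vec Sample m) where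

    witness : Fin Blocks → Maybe (Input n)
    witness b = eval (findWitness (block P b) (lookup tries b)) f

    point : Fin m → Input n
    point i = proj₁ (lookup samples i)

    seed : Fin m → Fin Blocks → Fin (suc t) → Input n
    seed i b e = lookup (lookup (proj₂ (lookup samples i)) b) e

    value : Fin m → Fin Blocks → Fin (suc t) → Bool
    value i b e = extracted f (block P b) (witness b) (point i) (seed i b e)

    BlocksPass Steady : Set
    BlocksPass = ∀ b {w} → witness b ≡ just w → ∀ j → passes (restrict f (block P b) w)
        (lookup (lookup tests b) j) ≡ true
    Steady = ∀ i b e → value i b e ≡ value i b zero

    Fits : List (Rule (Fin Blocks)) → Set
    Fits h = ∀ i → f (point i) ≡ ruleVal h (λ b → value i b zero)

    private
      ws = tabulate witness

      ok : Fin Blocks → Bool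
      ok b = eval (checkBlock (block P b) (lookup ws b) (lookup tests b)) f

      rowOf : Fin m → Row
      rowOf i = eval (row P ws (lookup samples i)) f

      row-label : ∀ i → proj₁ (lookup (tabulate rowOf) i) ≡ f (point i)
      row-label i = cong proj₁ (lookup∘tabulate rowOf i)

      extract-eval : ∀ S mw x seeds e → lookup (eval (extract S mw x seeds) f) e ≡ extracted f S mw x
          (lookup seeds e)
      extract-eval S nothing x seeds e = lookup-replicate e false
      extract-eval S (just w) x seeds e = lookup∘tabulate (λ e → probe (restrict f S w) x (lookup seeds e)) e

      row-value : ∀ i b e → lookup (lookup (proj₂ (lookup (tabulate rowOf) i)) b) e ≡ value i b e
      row-value i b e = trans (cong (λ (r : Row) → lookup (lookup (proj₂ r) b) e) (lookup∘tabulate rowOf i))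
        (trans (cong (λ (v : Vec Bool (suc t)) → lookup v e) (lookup∘tabulate extractAt b))
        (trans (extract-eval (block P b) (lookup ws b) (point i) (lookup (proj₂ (lookup samples i)) b) e)
          (cong (λ mw → extracted f (block P b) mw (point i) (seed i b e)) (lookup∘tabulate witness b))))
        where
        extractAt : Fin Blocks → Vec Bool (suc t)
        extractAt b = eval (extract (block P b) (lookup ws b) (point i) (lookup (proj₂ (lookup samples i)) b)) f

      tests-eval : ∀ S w (ts : Vec (BlockTest n) T) j →
        lookup (tabulate (λ j → eval (testQ S w (lookup ts j)) f)) j ≡ passes (restrict f S w) (lookup ts j)
      tests-eval S w ts j = lookup∘tabulate (λ j → eval (testQ S w (lookup ts j)) f) j

    accept-intro : BlocksPass → Steady → ∀ {h} → h ∈ H → Fits h → eval (tester (P , tries , tests , z , samples)) f ≡ true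
    accept-intro pass st {h} h∈ fit = ∧-true (allF-intro oks)
        (∧-true (allF-intro λ i → allF-intro λ b → steady-row i b)
      (any-intro _ h∈ (allF-intro fits-row)))
      where
      check : ∀ b mw → (∀ {w} → mw ≡ just w → ∀ j → passes (restrict f (block P b) w)
          (lookup (lookup tests b) j) ≡ true) →
        eval (checkBlock (block P b) mw (lookup tests b)) f ≡ true
      check b nothing _ = refl
      check b (just w) h = allF-intro (λ j → trans (tests-eval (block P b) w (lookup tests b) j) (h refl j))
      oks : ∀ b → lookup (tabulate ok) b ≡ true
      oks b = trans (lookup∘tabulate ok b)
          (check b (lookup ws b) (λ e → pass b (trans (sym (lookup∘tabulate witness b)) e)))
      steady-row : ∀ i b → steady (lookup (proj₂ (lookup (tabulate rowOf) i)) b) ≡ true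
      steady-row i b = allF-intro (λ e → not-xor
          (trans (row-value i b e) (trans (st i b e) (sym (row-value i b zero)))))
      fits-row : ∀ i → fits h (lookup (tabulate rowOf) i) ≡ true
      fits-row i = not-xor (trans (row-label i)
          (trans (fit i) (ruleVal-cong h (λ {b} _ → sym (row-value i b zero)))))

    accept-elim : eval (tester (P , tries , tests , z , samples)) f ≡ true →
      BlocksPass × Steady × ∃ λ h → h ∈ H × Fits h
    accept-elim acc = pass , st , h , h∈ , fit
      where
      oks = ∧-trueˡ acc
      tail = ∧-trueʳ {allF (lookup (tabulate ok))} acc
      check : ∀ b mw → eval (checkBlock (block P b) mw (lookup tests b)) f ≡ true →
        ∀ {w} → mw ≡ just w → ∀ j → passes (restrict f (block P b) w) (lookup (lookup tests b) j) ≡ true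
      check b (just w) e refl j = trans (sym (tests-eval (block P b) w (lookup tests b) j)) (allF-elim e j)
      pass : BlocksPass
      pass b e = check b (lookup ws b) (trans (sym (lookup∘tabulate ok b)) (allF-elim oks b))
        (trans (lookup∘tabulate witness b) e)
      steadies : allF (λ i → allF λ b → steady (lookup (proj₂ (lookup (tabulate rowOf) i)) b)) ≡ true
      steadies = ∧-trueˡ tail
      st : Steady
      st i b e = trans (sym (row-value i b e))
          (trans (steady⁻ (lookup (proj₂ (lookup (tabulate rowOf) i)) b)
          (allF-elim (allF-elim steadies i) b) e) (row-value i b zero))
      found = any-elim (λ h → allF λ i → fits h (lookup (tabulate rowOf) i)) H
          (∧-trueʳ {allF (λ i → allF λ b → steady (lookup (proj₂ (lookup (tabulate rowOf) i)) b))} tail)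
      h = proj₁ found
      h∈ = proj₁ (proj₂ found)
      fit : Fits h
      fit i = trans (sym (row-label i))
          (trans (not-xor⁻ (allF-elim (proj₂ (proj₂ found)) i)) (ruleVal-cong h (λ {b} _ → row-value i b zero)))

-- Soundness

^-oneˡ : ∀ k → 1 ^ k ≡ 1
^-oneˡ zero = refl
^-oneˡ (suc k) = trans (*-identityˡ _) (^-oneˡ k)

rare-decay : ∀ {S : Source A} {P} k l → Rare S P k (suc k) →
  Rare (vec (suc k * l) S) (λ v → allF λ i → P (lookup v i)) 1 (2 ^ l)
rare-decay k l r = rare-scale (m^n>0 (suc k) (suc k * l))
  (≤-trans (decay k 1 k l (≤-reflexive (sym (*-identityʳ _)))) (≤-reflexive (sym (*-identityˡ _))))
  (rare-all (suc k * l) r)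

rare-1/16 : ∀ {S : Source A} {P} K l → K * 16 ≤ 2 ^ l → Rare S P (K * 1) (2 ^ l) → Rare S P 1 16
rare-1/16 K l h = rare-scale (m^n>0 2 l)
  (≤-trans (≤-reflexive (cong (λ z → z * 16) (*-identityʳ K))) (≤-trans h (≤-reflexive (sym (*-identityˡ _)))))

≢true : ∀ {p} → p ≢ true → p ≡ false
≢true {true} h = ⊥-elim (h refl)
≢true {false} _ = refl

or-elim : ∀ p q {r} → (p ≡ false → q ≡ false → r ≡ true) → p ∨ (q ∨ r) ≡ true
or-elim true q h = refl
or-elim false true h = refl
or-elim false false h = h refl refl

-- `far` ranges over all substitutions because the one that matters depends on the partition and the
-- tries. Both are fixed before tests and samples are drawn, so the union bound over the samples
-- ranges over H alone.
module Soundness (n β N lT t M l : ℕ) (H : List (List (Rule (Fin (2 ^ β)))))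
  (blocks-few : 2 ^ β * 16 ≤ 2 ^ lT)
  (bits-few : (suc M * l * 2 ^ β) * 16 ≤ 2 ^ suc t)
  (hyps-few : length H * 16 ≤ 2 ^ l)
  (f : BoolFun n)
  (far : ∀ {h} → h ∈ H → ∀ (σ : Fin (2 ^ β) → Fin n ⊎ Bool) →
    2 ^ n ≤ suc M * # (cube n) (λ x → f x xor ruleVal h (assign σ (lookup x)))) where

  T m : ℕ
  T = 12 * lT
  m = suc M * l

  open Tester n β N T t m H

  -- `assign` over the one-point set `⊤` evaluates the single entry τ at x. The error 1/6 of the
  -- corrector is relaxed to 1/2, so that k repetitions give 2 ^ (- k).
  Extracts : (Fin n → Bool) → Maybe (Input n) → Fin n ⊎ Bool → Set
  Extracts S mw τ = ∀ x → Rare (cube n)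
      (λ s → extracted f S mw x s xor assign {V = ⊤} (λ _ → τ) (lookup x) tt) 1 2

  data Verdict (S : Fin n → Bool) : Maybe (Input n) → Set where
    good : ∀ {mw} τ → Extracts S mw τ → Verdict S mw
    bad : ∀ w → Rare (blockTests n) (passes (restrict f S w)) 11 12 → Verdict S (just w)

  classify : ∀ S mw → Verdict S mw
  classify S nothing = good (inj₂ false) (λ x → rare-false 1 2 (λ _ → refl))
  classify S (just w) with BlockTesting.dichotomy (restrict f S w)
  ... | inj₂ r = bad w r
  ... | inj₁ (g , inj₁ zero-g , c) = good (inj₂ false) (λ x →
    subst (λ b → Rare (cube n) (λ s → probe (restrict f S w) x s xor b) 1 2) (zero-g x)
        (rare-scale (s≤s z≤n) (m≤m+n 2 4) (c x)))
  ... | inj₁ (g , inj₂ (i , lookup-g) , c) = good (inj₁ i) (λ x →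
    subst (λ b → Rare (cube n) (λ s → probe (restrict f S w) x s xor b) 1 2) (lookup-g x)
        (rare-scale (s≤s z≤n) (m≤m+n 2 4) (c x)))

  target : ∀ {S mw} → Verdict S mw → Fin n ⊎ Bool
  target (good τ _) = τ
  target (bad _ _) = inj₂ false

  badPass : ∀ {S mw} → Verdict S mw → Vec (BlockTest n) T → Bool
  badPass (good _ _) ts = false
  badPass {S} (bad w _) ts = allF (λ j → passes (restrict f S w) (lookup ts j))

  badPass-rare : ∀ {S mw} (v : Verdict S mw) → Rare (vec T (blockTests n)) (badPass v) 1 (2 ^ lT)
  badPass-rare (good _ _) = rare-false 1 (2 ^ lT) (λ _ → refl)
  badPass-rare (bad w r) = rare-decay 11 lT r

  wrongBit : ∀ {S mw} → Verdict S mw → Input n → Input n → Bool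
  wrongBit {S} {mw} (good τ _) x s = extracted f S mw x s xor assign {V = ⊤} (λ _ → τ) (lookup x) tt
  wrongBit (bad _ _) x s = false

  wrongBit-rare : ∀ {S mw} (v : Verdict S mw) x → Rare (cube n) (wrongBit v x) 1 2
  wrongBit-rare (good τ r) x = r x
  wrongBit-rare (bad w _) x = rare-false 1 2 (λ _ → refl)

  module Fixed (P : Vec (Fin Blocks) n) (tries : Vec (Vec Try N) Blocks) where

    found : Fin Blocks → Maybe (Input n)
    found b = eval (findWitness (block P b) (lookup tries b)) f

    verdictAt : ∀ b → Verdict (block P b) (found b)
    verdictAt b = classify (block P b) (found b)

    σ : Fin Blocks → Fin n ⊎ Bool
    σ b = target (verdictAt b)

    Rest : Set
    Rest = Vec (Vec (BlockTest n) T) Blocks × Input n × Vec Sample m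

    rest : Source Rest
    rest = vec Blocks (vec T (blockTests n)) ⊗ cube n ⊗ vec m sample

    missedBlock : Vec (Vec (BlockTest n) T) Blocks → Bool
    missedBlock tests = anyF (λ b → badPass (verdictAt b) (lookup tests b))

    missedBlock-rare : Rare rest (missedBlock ∘ proj₁) 1 16
    missedBlock-rare = rare-marginal
        (marginal-proj₁ {S = vec Blocks (vec T (blockTests n))} {cube n ⊗ vec m sample})
      (rare-1/16 Blocks lT blocks-few (rare-anyF {a = 1} (λ b →
        rare-marginal {P = badPass (verdictAt b)} (marginal-lookup {S = vec T (blockTests n)} b)
            (badPass-rare (verdictAt b)))))

    allWrong : Fin Blocks → Sample → Bool
    allWrong b (x , seeds) = allF (λ e → wrongBit (verdictAt b) x (lookup (lookup seeds b) e))

    allWrong-rare : ∀ b → Rare sample (allWrong b) 1 (2 ^ suc t)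
    allWrong-rare b = rare-fixˡ (λ x → rare-marginal
        {P = λ ss → allF (λ e → wrongBit (verdictAt b) x (lookup ss e))}
      (marginal-lookup {S = vec (suc t) (cube n)} b)
      (subst (λ z → Rare (vec (suc t) (cube n)) (λ ss → allF (λ e → wrongBit (verdictAt b) x (lookup ss e)))
          z (2 ^ suc t)) (^-oneˡ (suc t))
        (rare-all (suc t) (wrongBit-rare (verdictAt b) x))))

    wrongExtraction : Vec Sample m → Bool
    wrongExtraction samples = anyF (λ i → anyF λ b → allWrong b (lookup samples i))

    samples-marginal : Marginal rest (vec m sample) (proj₂ ∘ proj₂)
    samples-marginal = marginal-∘ {O = rest} {cube n ⊗ vec m sample} {vec m sample} {proj₂} {proj₂}
      (marginal-proj₂ {S = cube n} {vec m sample})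
      (marginal-proj₂ {S = vec Blocks (vec T (blockTests n))} {cube n ⊗ vec m sample})

    wrongExtraction-rare : Rare rest (wrongExtraction ∘ proj₂ ∘ proj₂) 1 16
    wrongExtraction-rare = rare-marginal {P = wrongExtraction} samples-marginal
      (rare-1/16 (m * Blocks) (suc t) bits-few
          (subst (λ z → Rare (vec m sample) wrongExtraction z (2 ^ suc t)) (sym (*-assoc m Blocks 1))
        (rare-anyF {a = Blocks * 1} (λ i → rare-anyF {a = 1} (λ b →
          rare-marginal {P = allWrong b} (marginal-lookup {S = sample} i) (allWrong-rare b))))))

    agreeWith : List (Rule (Fin Blocks)) → Input n → Bool
    agreeWith h x = not (f x xor ruleVal h (assign σ (lookup x)))

    consistentHyp : Vec Sample m → Bool
    consistentHyp samples = any (λ h → allF λ i → agreeWith h (proj₁ (lookup samples i))) H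

    consistentHyp-rare : Rare rest (consistentHyp ∘ proj₂ ∘ proj₂) 1 16
    consistentHyp-rare = rare-marginal {P = consistentHyp} samples-marginal
      (rare-1/16 (length H) l hyps-few
          (rare-any {a = 1} {P = λ h samples → allF λ i → agreeWith h (proj₁ (lookup samples i))} H (λ {h} h∈ →
        rare-decay M l (rare-marginal {P = agreeWith h}
            (marginal-proj₁ {S = cube n} {vec Blocks (vec (suc t) (cube n))})
          (rare-complement M (far h∈ σ))))))

    -- If no bad block survives its tests and no bit is wrong in all repetitions, every extracted
    -- bit is the one that σ prescribes. The accepted hypothesis, read through σ, then agrees with f
    -- on all samples.
    accept⇒rare : ∀ ω → eval (tester (P , tries , ω)) f ≡ true →
      missedBlock (proj₁ ω) ∨ (wrongExtraction (proj₂ (proj₂ ω)) ∨ consistentHyp (proj₂ (proj₂ ω))) ≡ true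
    accept⇒rare (tests , z , samples) acc = or-elim (missedBlock tests) (wrongExtraction samples)
        (λ no-missed no-wrong →
      any-intro _ h∈ (allF-intro λ i → not-xor
          (trans (fit i) (ruleVal-cong h (λ {b} _ → correct no-missed no-wrong i b)))))
      where
      open Run f P tries tests z samples
      parts = accept-elim acc
      pass = proj₁ parts
      st = proj₁ (proj₂ parts)
      h = proj₁ (proj₂ (proj₂ parts))
      h∈ = proj₁ (proj₂ (proj₂ (proj₂ parts)))
      fit = proj₂ (proj₂ (proj₂ (proj₂ parts)))
      correct : missedBlock tests ≡ false → wrongExtraction samples ≡ false → ∀ i b → value i b zero ≡
          assign σ (lookup (point i)) b
      correct no-missed no-wrong i b = by-verdict (verdictAt b) (pass b) (anyF-false no-missed b)
          (anyF-false (anyF-false no-wrong i) b) (st i b)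
        where
        by-verdict : ∀ {mw} (v : Verdict (block P b) mw) →
          (∀ {w} → mw ≡ just w → ∀ j → passes (restrict f (block P b) w) (lookup (lookup tests b) j) ≡ true) →
          badPass v (lookup tests b) ≡ false →
          allF (λ e → wrongBit v (point i) (seed i b e)) ≡ false →
          (∀ e → extracted f (block P b) mw (point i) (seed i b e) ≡ extracted f (block P b) mw (point i)
              (seed i b zero)) →
          extracted f (block P b) mw (point i) (seed i b zero) ≡ assign {V = ⊤} (λ _ → target v)
              (lookup (point i)) tt
        by-verdict (bad w _) passing none _ _ = ⊥-elim
            (true≢false (trans (sym (allF-intro (passing refl))) none))
        by-verdict {mw} (good τ _) _ _ not-all same = xor-≡ (≢true (λ e → true≢false (trans
          (sym (allF-intro (λ e′ → trans (cong (_xor assign {V = ⊤} (λ _ → τ) (lookup (point i)) tt)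
              (same e′)) e))) not-all)))

  rejects : Rare allCoins (λ ω → eval (tester ω) f) 5 16
  rejects = rare-fixˡ (λ P → rare-fixˡ (λ tries → let open Fixed P tries in
    rare-scale (s≤s z≤n) (*-monoˡ-≤ 16 (m≤m+n 3 2)) (rare-mono accept⇒rare
      (rare-∨ {a = 1} {2} missedBlock-rare (rare-∨ {a = 1} {1} wrongExtraction-rare consistentHyp-rare)))))

-- Completeness

does⁻ : (P? : Dec A) → does P? ≡ true → A
does⁻ (yes p) _ = p

marginal-swap : {S : Source A} {T : Source B} → Marginal (S ⊗ T) (T ⊗ S) (λ (x , y) → y , x)
marginal-swap {S = S} {T} .law φ = trans (cong (_* size (T ⊗ S)) (E-swap S T (λ x y → φ (y , x))))
  (trans (*-comm _ (size (T ⊗ S))) (cong (_* E (T ⊗ S) φ)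
    (trans (size-⊗ T S) (trans (*-comm (size T) (size S)) (sym (size-⊗ S T))))))

marginal-exch : ∀ {C : Set} {S : Source A} {T : Source B} {U : Source C} →
  Marginal (S ⊗ T ⊗ U) (T ⊗ S ⊗ U) (λ (x , y , z) → y , x , z)
marginal-exch {S = S} {T} {U} .law φ = trans
    (cong (_* size (T ⊗ S ⊗ U)) (E-swap S T (λ x y → E U (λ z → φ (y , x , z)))))
  (trans (*-comm _ (size (T ⊗ S ⊗ U))) (cong (_* E (T ⊗ S ⊗ U) φ) sizes))
  where
  exch : ∀ a b c → b * (a * c) ≡ a * (b * c)
  exch = solve-∀
  sizes : size (T ⊗ S ⊗ U) ≡ size (S ⊗ T ⊗ U)
  sizes = begin
    size (T ⊗ S ⊗ U)            ≡⟨ size-⊗ T (S ⊗ U) ⟩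
    size T * size (S ⊗ U)       ≡⟨ cong (size T *_) (size-⊗ S U) ⟩
    size T * (size S * size U)  ≡⟨ exch (size S) (size T) (size U) ⟩
    size S * (size T * size U)  ≡⟨ cong (size S *_) (size-⊗ T U) ⟨
    size S * size (T ⊗ U)       ≡⟨ size-⊗ S (T ⊗ U) ⟨
    size (S ⊗ T ⊗ U)            ∎
    where open ≡-Reasoning

marginal-shift : (a : Input n) → Marginal (cube n) (cube n) (_⊕ a)
marginal-shift {n} a .law φ = trans (cong (_* 2 ^ n) (∑-shift a φ)) (*-comm _ (2 ^ n))

mix-cong : ∀ {S S′ : Fin n → Bool} → (∀ c → S c ≡ S′ c) → ∀ x y → mix S x y ≡ mix S′ x y
mix-cong h [] [] = refl
mix-cong h (a ∷ x) (b ∷ y) = cong₂ _∷_ (cong (λ s → if s then b else a) (h zero)) (mix-cong (h ∘ suc) x y)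

if-false : ∀ {s} {x y : A} → s ≡ false → (if s then x else y) ≡ y
if-false refl = refl

if-true : ∀ {s} {x y : A} → s ≡ true → (if s then x else y) ≡ x
if-true refl = refl

-- Resampling S does not see what happens to z on U. This lets a sample whose coordinates in U were
-- exchanged with those of z count as a genuine try for S.
mix-disjoint : ∀ (S U : Fin n → Bool) w z x → (∀ c → S c ≡ true → U c ≡ false) →
  mix S w z ≡ mix S w (mix U z x)
mix-disjoint S U [] [] [] h = refl
mix-disjoint S U (a ∷ w) (b ∷ z) (d ∷ x) h = cong₂ _∷_ (head (S zero) refl)
    (mix-disjoint (S ∘ suc) (U ∘ suc) w z x (h ∘ suc))
  where
  head : ∀ s → S zero ≡ s → (if S zero then b else a) ≡ (if S zero then (if U zero then d else b) else a)
  head true e = trans (if-true e) (sym (trans (if-true e) (if-false (h zero e))))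
  head false e = trans (if-false e) (sym (if-false e))

findWitness-spec : ∀ (f : BoolFun n) S (ts : Vec (Input n × Input n) N) →
  (eval (findWitness S ts) f ≡ nothing ×
      (∀ j → f (proj₁ (lookup ts j)) ≡ f (mix S (proj₁ (lookup ts j)) (proj₂ (lookup ts j)))))
  ⊎ (∃ λ j → eval (findWitness S ts) f ≡ just (proj₁ (lookup ts j)) ×
       f (proj₁ (lookup ts j)) xor f (mix S (proj₁ (lookup ts j)) (proj₂ (lookup ts j))) ≡ true)
findWitness-spec f S [] = inj₁ (refl , λ ())
findWitness-spec f S ((x , y) ∷ ts) with f x xor f (mix S x y) in e
... | true = inj₂ (zero , refl , e)
... | false with findWitness-spec f S ts
...   | inj₁ (eq , h) = inj₁ (eq , λ { zero → xor-≡ e ; (suc j) → h j })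
...   | inj₂ (j , eq , h) = inj₂ (suc j , eq , h)

differ? : ∀ {V : Set} (U : List V) (ρ ρ′ : V → Bool) →
  (∃ λ c → c ∈ U × ρ c xor ρ′ c ≡ true) ⊎ (∀ {c} → c ∈ U → ρ c ≡ ρ′ c)
differ? [] ρ ρ′ = inj₂ λ ()
differ? (c ∷ U) ρ ρ′ with ρ c xor ρ′ c in e | differ? U ρ ρ′
... | true | _ = inj₁ (c , here refl , e)
... | false | inj₁ (d , d∈ , h) = inj₁ (d , there d∈ , h)
... | false | inj₂ h = inj₂ λ { (here refl) → xor-≡ e ; (there d∈) → h d∈ }

flip-bit : ∀ {a b} → a xor b ≡ true → a ≡ not b
flip-bit {true} {false} _ = refl
flip-bit {false} {true} _ = refl

module _ (K : List (Rule (Fin n))) (S : Fin n → Bool)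
  (single : ∀ {c d} → c ∈ ruleVars K → d ∈ ruleVars K → S c ≡ true → S d ≡ true → c ≡ d) where

  -- Among the variables of the list, S contains only c. So the restriction to S is a function of
  -- one bit, and it takes both values because y changes the result.
  sensitive-literal : ∀ w y → ruleVal K (lookup w) xor ruleVal K (lookup (mix S w y)) ≡ true →
    ∃ λ c → c ∈ ruleVars K × S c ≡ true ×
      (∀ u → ruleVal K (lookup (mix S w u)) ≡ ruleVal K (lookup w) xor (lookup u c xor lookup w c))
  sensitive-literal w y diff with differ? (ruleVars K) (lookup w) (lookup (mix S w y))
  ... | inj₂ same = ⊥-elim (true≢false (trans (sym diff) (xor-false (ruleVal-cong K same))))
  ... | inj₁ (c , c∈ , d) = c , c∈ , Sc , λ u → by-bit u (lookup u c xor lookup w c) refl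
    where
    Sc : S c ≡ true
    Sc with S c in e
    ... | true = refl
    ... | false = trans (sym (xor-false (sym (trans (lookup-mix S w y c) (if-false e))))) d
    agree : ∀ u u′ → lookup u c ≡ lookup u′ c → ruleVal K (lookup (mix S w u)) ≡ ruleVal K (lookup (mix S w u′))
    agree u u′ e = ruleVal-cong K (λ {v} v∈ → trans (lookup-mix S w u v)
        (trans (at v v∈ (S v) refl) (sym (lookup-mix S w u′ v))))
      where
      at : ∀ v → v ∈ ruleVars K → ∀ s → S v ≡ s → (if S v then lookup u v else lookup w v) ≡
          (if S v then lookup u′ v else lookup w v)
      at v v∈ true Sv with refl ← single v∈ c∈ Sv Sc = trans (if-true Sv) (trans e (sym (if-true Sv)))
      at v v∈ false Sv = trans (if-false Sv) (sym (if-false Sv))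
    self : ruleVal K (lookup (mix S w w)) ≡ ruleVal K (lookup w)
    self = ruleVal-cong K (λ {v} _ → trans (lookup-mix S w w v) (const (S v)))
      where
      const : ∀ s {x : Bool} → (if s then x else x) ≡ x
      const true = refl
      const false = refl
    by-bit : ∀ u b → lookup u c xor lookup w c ≡ b →
      ruleVal K (lookup (mix S w u)) ≡ ruleVal K (lookup w) xor (lookup u c xor lookup w c)
    by-bit u false e = trans (agree u w (xor-≡ e))
        (trans self (sym (trans (cong (ruleVal K (lookup w) xor_) e) (xor-identityʳ _))))
    by-bit u true e = trans (agree u y
        (trans (flip-bit e) (sym (trans (sym (trans (lookup-mix S w y c) (if-true Sc)))
        (flip-bit (trans (xor-comm (lookup (mix S w y) c) (lookup w c)) d))))))
      (trans (flip-bit (trans (xor-comm (ruleVal K (lookup (mix S w y))) (ruleVal K (lookup w))) diff))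
        (sym (trans (cong (ruleVal K (lookup w) xor_) e) (xor-comm _ true))))

-- The distance between f and its short list is at most e / q. Three union bounds are kept below
-- 1/16: `spread` for two variables in one block, `searched` for an overlooked block, `few-points`
-- for a queried point where f and the list differ.
module Completeness (n β N T t m : ℕ) (H : List (List (Rule (Fin (2 ^ β)))))
  (f : BoolFun n) (K : List (Rule (Fin n)))
  (H-closed : ∀ (σ : Fin n → Fin (2 ^ β) ⊎ Bool) → substRules σ K ∈ H)
  (e q : ℕ) (q>0 : 0 < q)
  (close : Rare (cube n) (λ x → f x xor ruleVal K (lookup x)) e q)
  (spread : length (ruleVars K) * (length (ruleVars K) * 1) * 16 ≤ 2 ^ β)
  (searched : m * (2 ^ β * 1) * 16 ≤ suc N)
  (few-points : (2 ^ β * (N * (e + e)) +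
      (2 ^ β * (N * (T * (4 * (e + e)))) + (m * (2 ^ β * (suc t * (N * (e + e)))) + m * e))) * 16 ≤ q)
  where

  open Tester n β N T t m H

  g : BoolFun n
  g x = ruleVal K (lookup x)

  U : List (Fin n)
  U = ruleVars K

  D : Input n → Bool
  D x = f x xor g x

  D2 : (Fin n → Bool) → Input n → Input n → Input n → Bool
  D2 S w a s = D (mix S w (s ⊕ a)) ∨ D (mix S w s)

  triesS : Source (Vec (Vec Try N) Blocks)
  triesS = vec Blocks (vec N try)

  testsS : Source (Vec (Vec (BlockTest n) T) Blocks)
  testsS = vec Blocks (vec T (blockTests n))

  samplesS : Source (Vec Sample m)
  samplesS = vec m sample

  Rest : Set
  Rest = Vec (Vec Try N) Blocks × Vec (Vec (BlockTest n) T) Blocks × Input n × Vec Sample m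

  rest : Source Rest
  rest = triesS ⊗ testsS ⊗ cube n ⊗ samplesS

  encode-injective : ∀ {k} {x y : Input k} → encode x ≡ encode y → x ≡ y
  encode-injective {x = []} {[]} _ = refl
  encode-injective {x = true ∷ x} {true ∷ y} eq =
    cong (true ∷_) (encode-injective (proj₂ (combine-injective {2} zero (encode x) zero (encode y) eq)))
  encode-injective {x = false ∷ x} {false ∷ y} eq =
    cong (false ∷_) (encode-injective
        (proj₂ (combine-injective {2} (suc zero) (encode x) (suc zero) (encode y) eq)))
  encode-injective {x = true ∷ x} {false ∷ y} eq with () ← proj₁
      (combine-injective {2} zero (encode x) (suc zero) (encode y) eq)
  encode-injective {x = false ∷ x} {true ∷ y} eq with () ← proj₁
      (combine-injective {2} (suc zero) (encode x) zero (encode y) eq)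

  collides : Fin n → Fin n → Vec (Fin Blocks) n → Bool
  collides c d P = not (does (c ≟F d)) ∧ does (lookup P c ≟F lookup P d)

  collision : Vec (Fin Blocks) n → Bool
  collision P = any (λ c → any (λ d → collides c d P) U) U

  collides-rare : ∀ c d → Rare allCoins (λ (P , _) → collides c d P) 1 Blocks
  collides-rare c d with c ≟F d
  ... | yes _ = rare-false 1 Blocks (λ _ → refl)
  -- The block of c is drawn afresh with that of d fixed; as `encode` is injective, at most one of
  -- the `Blocks` outcomes collides.
  ... | no c≢d = rare-resample {S = blocks} {T = rest} c λ P → rare-mono
      {Q = λ (a , _) → does (a ≟F lookup P d)}
      (λ { (a , _) h → trans (sym (cong₂ (λ x y → does (x ≟F y)) (lookup∘update c P a)
          (lookup∘update′ (c≢d ∘ sym) P a))) h })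
      (rare-marginal {P = λ a → does (a ≟F lookup P d)} (marginal-proj₁ {S = blocks} {rest})
        (rare (*-monoˡ-≤ Blocks (∑-injective {m = β} (encode {β}) (λ a → does (a ≟F lookup P d))
          (λ p p′ → encode-injective {β} (trans (does⁻ (_ ≟F _) p) (sym (does⁻ (_ ≟F _) p′))))))))

  collision-rare : Rare allCoins (collision ∘ proj₁) 1 16
  collision-rare = rare-scale {a = length U * (length U * 1)} (m^n>0 2 β)
    (≤-trans spread (≤-reflexive (sym (*-identityˡ _))))
    (rare-any {a = length U * 1} {P = λ c ω → any (λ d → collides c d (proj₁ ω)) U} U (λ {c} _ →
      rare-any {a = 1} {P = λ d ω → collides c d (proj₁ ω)} U (λ {d} _ → collides-rare c d)))

  D2-rare : ∀ S a → Rare (cube n ⊗ cube n) (λ (w , s) → D2 S w a s) (e + e) q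
  D2-rare S a = rare-∨ {a = e} {e}
    (rare-marginal {P = λ (w , s) → D (mix S w s)}
        (marginal-⊗ {O = cube n} (marginal-id {S = cube n}) (marginal-shift a)) (rare-mix S close))
    (rare-mix S close)

  module Fixed (P : Vec (Fin Blocks) n) where

    tryAt : ∀ b j → Marginal triesS try (λ v → lookup (lookup v b) j)
    tryAt b j = marginal-∘ {O = triesS} (marginal-lookup {S = try} j) (marginal-lookup {S = vec N try} b)

    startAt : ∀ b j → Marginal triesS (cube n) (λ v → proj₁ (lookup (lookup v b) j))
    startAt b j = marginal-∘ {O = triesS} (marginal-proj₁ {S = cube n} {cube n}) (tryAt b j)

    start : Vec (Vec Try N) Blocks → Fin Blocks → Fin N → Input n
    start tries b j = proj₁ (lookup (lookup tries b) j)

    badTry : Vec (Vec Try N) Blocks → Bool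
    badTry tries = anyF λ b → anyF λ j → D (start tries b j) ∨ D
        (mix (block P b) (start tries b j) (proj₂ (lookup (lookup tries b) j)))

    badTry-rare : Rare rest (badTry ∘ proj₁) (Blocks * (N * (e + e))) q
    badTry-rare = rare-marginal {P = badTry} (marginal-proj₁ {S = triesS})
        (rare-anyF {a = N * (e + e)} λ b → rare-anyF {a = e + e} λ j →
      rare-marginal {P = λ (x , y) → D x ∨ D (mix (block P b) x y)} (tryAt b j)
        (rare-∨ {a = e} {e} (rare-marginal {P = D} (marginal-proj₁ {S = cube n}) close)
            (rare-mix (block P b) close)))

    testPoint : Vec (Vec (BlockTest n) T) Blocks → Fin Blocks → Fin T → Fin 4 → Input n × Input n
    testPoint tests b k i =
      direction (proj₁ (lookup (lookup tests b) k)) i , lookup (proj₂ (lookup (lookup tests b) k)) i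

    -- A witness is selected by its answers and hence not uniform. Every try j is therefore treated
    -- as a possible witness, at the price of a factor N in the union bound; `badSeed` does the
    -- same.
    badTest : Vec (Vec Try N) Blocks → Vec (Vec (BlockTest n) T) Blocks → Bool
    badTest tries tests = anyF λ b → anyF λ j → anyF λ k → anyF λ (i : Fin 4) →
      D2 (block P b) (start tries b j) (proj₁ (testPoint tests b k i)) (proj₂ (testPoint tests b k i))

    badTest-rare : Rare rest (λ (tries , tests , _) → badTest tries tests)
        (Blocks * (N * (T * (4 * (e + e))))) q
    badTest-rare = rare-anyF {a = N * (T * (4 * (e + e)))} λ b → rare-anyF {a = T * (4 * (e + e))} λ j →
      rare-anyF {a = 4 * (e + e)} λ k → rare-anyF {a = e + e} λ i →
      rare-marginal {P = λ (uv , w , s) → D2 (block P b) w (direction uv i) s} (testMarginal b j k i)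
        (rare-fixˡ (λ uv → D2-rare (block P b) (direction uv i)))
      where
      testMarginal : ∀ b j k i → Marginal rest ((cube n ⊗ cube n) ⊗ cube n ⊗ cube n)
        (λ (tries , tests , _) → proj₁ (lookup (lookup tests b) k) , start tries b j , lookup
            (proj₂ (lookup (lookup tests b) k)) i)
      testMarginal b j k i = marginal-∘ {O = rest} (marginal-exch {S = cube n} {cube n ⊗ cube n} {cube n})
        (marginal-⊗ {O = triesS} (startAt b j) (marginal-∘ {O = testsS ⊗ cube n ⊗ samplesS}
          (marginal-⊗ {O = cube n ⊗ cube n} (marginal-id {S = cube n ⊗ cube n})
              (marginal-lookup {S = cube n} i))
          (marginal-∘ {O = testsS ⊗ cube n ⊗ samplesS} (marginal-lookup {S = blockTests n} k)
            (marginal-∘ {O = testsS ⊗ cube n ⊗ samplesS} (marginal-lookup {S = vec T (blockTests n)} b)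
                (marginal-proj₁ {S = testsS})))))

    seedAt : Vec Sample m → Fin m → Fin Blocks → Fin (suc t) → Input n
    seedAt samples i b k = lookup (lookup (proj₂ (lookup samples i)) b) k

    samplesMarginal : Marginal (testsS ⊗ cube n ⊗ samplesS) samplesS (λ (_ , _ , samples) → samples)
    samplesMarginal = marginal-∘ {O = testsS ⊗ cube n ⊗ samplesS} (marginal-proj₂ {S = cube n})
        (marginal-proj₂ {S = testsS})

    badSeed : Vec (Vec Try N) Blocks → Vec Sample m → Bool
    badSeed tries samples = anyF λ i → anyF λ b → anyF λ k → anyF λ j →
      D2 (block P b) (start tries b j) (proj₁ (lookup samples i)) (seedAt samples i b k)

    badSeed-rare : Rare rest (λ (tries , _ , _ , samples) → badSeed tries samples)
        (m * (Blocks * (suc t * (N * (e + e))))) q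
    badSeed-rare = rare-anyF {a = Blocks * (suc t * (N * (e + e)))} λ i → rare-anyF
        {a = suc t * (N * (e + e))} λ b →
      rare-anyF {a = N * (e + e)} λ k → rare-anyF {a = e + e} λ j →
      rare-marginal {P = λ (a , w , s) → D2 (block P b) w a s} (seedMarginal i b k j)
          (rare-fixˡ (λ a → D2-rare (block P b) a))
      where
      seedMarginal : ∀ i b k j → Marginal rest (cube n ⊗ cube n ⊗ cube n)
        (λ (tries , _ , _ , samples) → proj₁ (lookup samples i) , start tries b j , seedAt samples i b k)
      seedMarginal i b k j = marginal-∘ {O = rest} (marginal-exch {S = cube n} {cube n} {cube n})
        (marginal-⊗ {O = triesS} (startAt b j) (marginal-∘ {O = testsS ⊗ cube n ⊗ samplesS}
          (marginal-⊗ {O = cube n} (marginal-id {S = cube n})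
              (marginal-∘ {O = vec Blocks (vec (suc t) (cube n))}
            (marginal-lookup {S = cube n} k) (marginal-lookup {S = vec (suc t) (cube n)} b)))
          (marginal-∘ {O = testsS ⊗ cube n ⊗ samplesS} (marginal-lookup {S = sample} i) samplesMarginal)))

    badSample : Vec Sample m → Bool
    badSample samples = anyF λ i → D (proj₁ (lookup samples i))

    pointMarginal : ∀ i → Marginal samplesS (cube n) (λ samples → proj₁ (lookup samples i))
    pointMarginal i = marginal-∘ {O = samplesS}
        (marginal-proj₁ {S = cube n} {vec Blocks (vec (suc t) (cube n))}) (marginal-lookup {S = sample} i)

    badSample-rare : Rare rest (λ (_ , _ , _ , samples) → badSample samples) (m * e) q
    badSample-rare = rare-marginal {P = badSample}
        (marginal-∘ {O = rest} samplesMarginal (marginal-proj₂ {S = triesS}))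
      (rare-anyF {a = e} λ i → rare-marginal {P = D} (pointMarginal i) close)

    badPoint : Rest → Bool
    badPoint (tries , tests , _ , samples) = badTry tries ∨
        (badTest tries tests ∨ (badSeed tries samples ∨ badSample samples))

    badPoint-rare : Rare rest badPoint 1 16
    badPoint-rare = rare-scale q>0 (≤-trans few-points (≤-reflexive (sym (*-identityˡ q))))
      (rare-∨ {a = Blocks * (N * (e + e))}
          {Blocks * (N * (T * (4 * (e + e)))) + (m * (Blocks * (suc t * (N * (e + e)))) + m * e)} badTry-rare
      (rare-∨ {a = Blocks * (N * (T * (4 * (e + e))))} {m * (Blocks * (suc t * (N * (e + e)))) + m * e}
          badTest-rare
      (rare-∨ {a = m * (Blocks * (suc t * (N * (e + e))))} {m * e} badSeed-rare badSample-rare)))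

    changes : Fin Blocks → Try → Bool
    changes b (x , y) = g x xor g (mix (block P b) x y)

    unfound : Vec (Vec Try N) Blocks → Fin Blocks → Bool
    unfound tries b = allF λ j → not (changes b (lookup (lookup tries b) j))

    below : Vec (Vec Try N) Blocks → ℕ → Fin n → Bool
    below tries k c = unfound tries (lookup P c) ∧ does (toℕ (lookup P c) <? k)

    -- Block b was not found although resampling it changes g on the sample x,
    -- whose unfound blocks before b have already been replaced by those of z.
    missedAt : Fin Blocks → Vec (Vec Try N) Blocks → Input n × Input n → Bool
    missedAt b tries (x , z) = unfound tries b ∧
      (g (mix (below tries (toℕ b)) x z) xor g (mix (block P b) (mix (below tries (toℕ b)) x z) z))

    -- Fix the tries of all blocks but b. The mask of unfound earlier blocks does not depend on
    -- those of b, and exchanging x and z on it keeps the pair uniform. The sample thus acts as one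
    -- more try, independent of the N tries for b: if a try changes g with probability q, the event
    -- has probability at most q (1 - q) ^ N.
    missedAt-rare : ∀ b → Rare (triesS ⊗ cube n ⊗ cube n) (λ (tries , xz) → missedAt b tries xz) 1 (suc N)
    missedAt-rare b = rare-resample {S = vec N try} {T = cube n ⊗ cube n} b λ v → rare-mono
        {Q = independent v} (decouple v)
      (rare-scale {a = # try (not ∘ changes b) ^ N * # try (changes b)} {size try ^ N * size try}
          (*-mono-≤ {1} {_} {1} (m^n>0 (size try) {{>-nonZero (size>0 try)}} N) (size>0 try)) unlikely
        (rare-∧ (rare-all N {S = try} {not ∘ changes b} (rare ≤-refl))
            (rare-mix-pair (below v (toℕ b)) (rare ≤-refl))))
      where
      independent : Vec (Vec Try N) Blocks → Vec Try N × Input n × Input n → Bool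
      independent v (ts , x , z) = allF (λ j → not (changes b (lookup ts j))) ∧
        changes b (mix (below v (toℕ b)) x z , mix (below v (toℕ b)) z x)
      unlikely : # try (not ∘ changes b) ^ N * # try (changes b) * suc N ≤ 1 * (size try ^ N * size try)
      unlikely = begin
        Y ^ N * X * suc N          ≡⟨ eq (Y ^ N) X (suc N) ⟩
        suc N * (X * Y ^ N)        ≤⟨ m≤n+m _ (Y ^ suc N) ⟩
        Y ^ suc N + suc N * (X * Y ^ N) ≤⟨ bernoulli X Y N ⟩
        (X + Y) ^ suc N            ≡⟨ cong (_^ suc N) (#-not try (changes b)) ⟩
        size try ^ suc N           ≡⟨ trans (*-comm (size try) _) (sym (*-identityˡ _)) ⟩
        1 * (size try ^ N * size try) ∎
        where
        open ≤-Reasoning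
        X = # try (changes b)
        Y = # try (not ∘ changes b)
        eq : ∀ a b c → a * b * c ≡ c * (b * a)
        eq = solve-∀
      below-update : ∀ v ts c → below (v [ b ]≔ ts) (toℕ b) c ≡ below v (toℕ b) c
      below-update v ts c with lookup P c ≟F b
      ... | no ne = cong (λ ts → allF (λ j → not (changes (lookup P c) (lookup ts j))) ∧ _)
          (lookup∘update′ ne v ts)
      ... | yes e rewrite e | dec-false (toℕ b <? toℕ b) (<-irrefl refl) = trans (∧-zeroʳ _) (sym (∧-zeroʳ _))
      off-block : ∀ v c → block P b c ≡ true → below v (toℕ b) c ≡ false
      off-block v c e = trans (cong (unfound v (lookup P c) ∧_) (dec-false (toℕ (lookup P c) <? toℕ b)
        (<-irrefl (cong toℕ (does⁻ (lookup P c ≟F b) e))))) (∧-zeroʳ _)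
      decouple : ∀ v ω → missedAt b (v [ b ]≔ proj₁ ω) (proj₂ ω) ≡ true → independent v ω ≡ true
      decouple v (ts , x , z) h = trans (sym (cong₂ _∧_
        (cong (λ ts → allF (λ j → not (changes b (lookup ts j)))) (lookup∘update b v ts))
        (cong₂ _xor_ (cong g masked) (cong g (trans (cong (λ w → mix (block P b) w z) masked)
          (mix-disjoint (block P b) (below v (toℕ b)) _ z x (off-block v))))))) h
        where
        masked : mix (below (v [ b ]≔ ts) (toℕ b)) x z ≡ mix (below v (toℕ b)) x z
        masked = mix-cong (below-update v ts) x z

    missed : Vec (Vec Try N) Blocks → Input n → Vec Sample m → Bool
    missed tries z samples = anyF λ i → anyF λ b → missedAt b tries (proj₁ (lookup samples i) , z)

    missed-rare : Rare rest (λ (tries , _ , z , samples) → missed tries z samples) 1 16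
    missed-rare = rare-scale {a = m * (Blocks * 1)} (s≤s z≤n)
        (≤-trans searched (≤-reflexive (sym (*-identityˡ _))))
      (rare-anyF {a = Blocks * 1} λ i → rare-anyF {a = 1} λ b → rare-marginal
          {P = λ (tries , xz) → missedAt b tries xz} (xz-marginal i) (missedAt-rare b))
      where
      xz-marginal : ∀ i → Marginal rest (triesS ⊗ cube n ⊗ cube n)
          (λ (tries , _ , z , samples) → tries , proj₁ (lookup samples i) , z)
      xz-marginal i = marginal-⊗ {O = triesS} (marginal-id {S = triesS})
          (marginal-∘ {O = testsS ⊗ cube n ⊗ samplesS}
        (marginal-∘ {O = cube n ⊗ samplesS} (marginal-swap {S = cube n} {cube n})
            (marginal-⊗ {O = cube n} (marginal-id {S = cube n}) (pointMarginal i)))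
        (marginal-proj₂ {S = testsS}))

    module Good (tries : Vec (Vec Try N) Blocks) (tests : Vec (Vec (BlockTest n) T) Blocks)
      (z : Input n) (samples : Vec Sample m)
      (no-collision : collision P ≡ false) (no-point : badPoint (tries , tests , z , samples) ≡ false)
      (no-missed : missed tries z samples ≡ false) where

      open Run f P tries tests z samples

      no-test : badTest tries tests ∨ (badSeed tries samples ∨ badSample samples) ≡ false
      no-test = ∨-falseʳ {badTry tries} no-point

      no-seed : badSeed tries samples ∨ badSample samples ≡ false
      no-seed = ∨-falseʳ {badTest tries tests} no-test

      try-good : ∀ b j → D (start tries b j) ∨ D
          (mix (block P b) (start tries b j) (proj₂ (lookup (lookup tries b) j))) ≡ false
      try-good b j = anyF-false (anyF-false (∨-falseˡ {badTry tries} no-point) b) j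

      test-good : ∀ b j k i → D2 (block P b) (start tries b j) (proj₁ (testPoint tests b k i))
          (proj₂ (testPoint tests b k i)) ≡ false
      test-good b j k i = anyF-false {P = λ i → D2 (block P b) (start tries b j)
          (proj₁ (testPoint tests b k i)) (proj₂ (testPoint tests b k i))}
        (anyF-false (anyF-false (anyF-false (∨-falseˡ {badTest tries tests} no-test) b) j) k) i

      seed-good : ∀ b j i k → D2 (block P b) (start tries b j) (point i) (seed i b k) ≡ false
      seed-good b j i k = anyF-false {P = λ j → D2 (block P b) (start tries b j) (point i) (seed i b k)}
        (anyF-false {P = λ k → anyF λ j → D2 (block P b) (start tries b j) (point i) (seed i b k)}
          (anyF-false (anyF-false (∨-falseˡ {badSeed tries samples} no-seed) i) b) k) j

      sample-good : ∀ i → f (point i) ≡ g (point i)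
      sample-good i = xor-≡ (anyF-false (∨-falseʳ {badSeed tries samples} no-seed) i)

      distinct : ∀ {c d} → c ∈ U → d ∈ U → lookup P c ≡ lookup P d → c ≡ d
      distinct {c} {d} c∈ d∈ same with c ≟F d in eq
      ... | yes e = e
      ... | no c≢d = ⊥-elim (true≢false (trans (sym (any-intro (λ c → any (λ d → collides c d P) U) c∈
              (any-intro (λ d → collides c d P) d∈
                  (∧-true (cong not (cong does eq)) (dec-true (lookup P c ≟F lookup P d) same)))))
                  no-collision))

      in-block : ∀ {b c} → block P b c ≡ true → lookup P c ≡ b
      in-block {b} {c} = does⁻ (lookup P c ≟F b)

      single : ∀ b {c d} → c ∈ U → d ∈ U → block P b c ≡ true → block P b d ≡ true → c ≡ d
      single b c∈ d∈ p p′ = distinct c∈ d∈ (trans (in-block p) (sym (in-block p′)))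

      Reads : Fin Blocks → Input n → Fin n → Set
      Reads b w c = ∀ {a s} → D2 (block P b) w a s ≡ false → probe (restrict f (block P b) w) a s ≡ lookup a c

      data Status (b : Fin Blocks) : Set where
        silent : witness b ≡ nothing → unfound tries b ≡ true → Status b
        active : ∀ j c → witness b ≡ just (start tries b j) → unfound tries b ≡ false → c ∈ U → lookup P c ≡ b →
          Reads b (start tries b j) c → Status b

      try-same : ∀ b j → f (start tries b j) ≡ g (start tries b j) ×
        f (mix (block P b) (start tries b j) (proj₂ (lookup (lookup tries b) j))) ≡ g
            (mix (block P b) (start tries b j) (proj₂ (lookup (lookup tries b) j)))
      try-same b j = xor-≡ (∨-falseˡ {D (start tries b j)} (try-good b j)) , xor-≡
          (∨-falseʳ {D (start tries b j)} (try-good b j))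

      status : ∀ b → Status b
      status b with findWitness-spec f (block P b) (lookup tries b)
      ... | inj₁ (e , same) = silent e (allF-intro λ j → cong not (xor-false
              (trans (sym (proj₁ (try-same b j))) (trans (same j) (proj₂ (try-same b j))))))
      ... | inj₂ (j , e , diff) = active j c e not-unfound (proj₁ (proj₂ lit))
          (in-block (proj₁ (proj₂ (proj₂ lit)))) reads
        where
        w = start tries b j
        y = proj₂ (lookup (lookup tries b) j)
        g-diff : changes b (w , y) ≡ true
        g-diff = trans (sym (cong₂ _xor_ (proj₁ (try-same b j)) (proj₂ (try-same b j)))) diff
        not-unfound : unfound tries b ≡ false
        not-unfound = ≢true (λ u → true≢false (trans (sym (allF-elim u j)) (cong not g-diff)))
        lit = sensitive-literal K (block P b) (single b) w y g-diff
        c = proj₁ lit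
        affine = proj₂ (proj₂ (proj₂ lit))
        reads : Reads b w c
        reads {a} {s} good = trans (cong₂ _xor_ (trans at-shifted (affine (s ⊕ a))) (trans at-s (affine s)))
          (trans (cong (λ v → (g w xor (v xor lookup w c)) xor (g w xor (lookup s c xor lookup w c)))
              (lookup-zipWith _xor_ c s a))
            (solve 4 (λ g w s a → (g :+ ((s :+ a) :+ w)) :+ (g :+ (s :+ w)) := a) refl (g w) (lookup w c)
                (lookup s c) (lookup a c)))
          where
          open xor-∧-Solver
          at-shifted : f (mix (block P b) w (s ⊕ a)) ≡ g (mix (block P b) w (s ⊕ a))
          at-shifted = xor-≡ (∨-falseˡ {D (mix (block P b) w (s ⊕ a))} good)
          at-s : f (mix (block P b) w s) ≡ g (mix (block P b) w s)
          at-s = xor-≡ (∨-falseʳ {D (mix (block P b) w (s ⊕ a))} good)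

      passing : BlocksPass
      passing b {w} found j with status b
      ... | silent e _ with () ← trans (sym e) found
      ... | active j′ c e _ _ _ reads with refl ← trans (sym e) found = ∧-true
        (not-xor (trans (reads (test-good b j′ j i0)) (sym (reads (test-good b j′ j i1)))))
        (not-xor (trans (cong₂ _∧_ (reads (test-good b j′ j i1)) (reads (test-good b j′ j i2)))
          (trans (sym (lookup-zipWith _∧_ c (proj₁ uv) (proj₂ uv))) (sym (reads (test-good b j′ j i3))))))
        where uv = proj₁ (lookup (lookup tests b) j)

      value-silent : ∀ i b k → witness b ≡ nothing → value i b k ≡ false
      value-silent i b k e = cong (λ mw → extracted f (block P b) mw (point i) (seed i b k)) e

      value-active : ∀ i b k j c → witness b ≡ just (start tries b j) → Reads b (start tries b j) c → value
          i b k ≡ lookup (point i) c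
      value-active i b k j c e reads = trans
          (cong (λ mw → extracted f (block P b) mw (point i) (seed i b k)) e) (reads (seed-good b j i k))

      steadily : Steady
      steadily i b k with status b
      ... | silent e _ = trans (value-silent i b k e) (sym (value-silent i b zero e))
      ... | active j c e _ _ _ reads = trans (value-active i b k j c e reads)
          (sym (value-active i b zero j c e reads))

      -- The constants come from one point z for all samples, so that a single hypothesis fits them
      -- all. The tester need not know z, as H contains the result for every substitution.
      σ : Fin n → Fin Blocks ⊎ Bool
      σ c = if unfound tries (lookup P c) then inj₂ (lookup z c) else inj₁ (lookup P c)

      -- Hybrid argument: the unfound blocks of a sample are replaced by those of z one at a time.
      hybrid : ∀ i k → k ≤ Blocks → g (mix (below tries k) (point i) z) ≡ g (point i)
      hybrid i zero _ = ruleVal-cong K (λ {c} _ → trans (lookup-mix (below tries 0) (point i) z c)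
        (if-false (trans (cong (unfound tries (lookup P c) ∧_) (dec-false (toℕ (lookup P c) <? 0) λ ()))
            (∧-zeroʳ _))))
      hybrid i (suc k) k<B = trans next (hybrid i k (<⇒≤ k<B))
        where
        b = fromℕ< k<B
        x = point i
        b≡k : toℕ b ≡ k
        b≡k = toℕ-fromℕ< k<B
        ok : unfound tries b ∧ (g (mix (below tries k) x z) xor g
            (mix (block P b) (mix (below tries k) x z) z)) ≡ false
        ok = subst (λ κ → unfound tries b ∧
            (g (mix (below tries κ) x z) xor g (mix (block P b) (mix (below tries κ) x z) z)) ≡ false)
          b≡k (anyF-false (anyF-false no-missed i) b)
        <?-step : ∀ p → p ≢ k → does (p <? suc k) ≡ does (p <? k)
        <?-step p p≢k = by-dec (p <? k)
          where
          by-dec : Dec (p < k) → does (p <? suc k) ≡ does (p <? k)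
          by-dec (yes p<k) = trans (dec-true (p <? suc k) (m≤n⇒m≤1+n p<k)) (sym (dec-true (p <? k) p<k))
          by-dec (no p≮k) = trans (dec-false (p <? suc k) (λ { (s≤s p≤k) → p≮k (≤∧≢⇒< p≤k p≢k) }))
              (sym (dec-false (p <? k) p≮k))
        at-b : ∀ c → lookup P c ≡ b → below tries (suc k) c ≡ unfound tries b
        at-b c p = trans (cong (unfound tries (lookup P c) ∧_) (dec-true (toℕ (lookup P c) <? suc k)
          (s≤s (≤-reflexive (trans (cong toℕ p) b≡k))))) (trans (∧-identityʳ _) (cong (unfound tries) p))
        off-b : ∀ c → lookup P c ≢ b → below tries (suc k) c ≡ below tries k c
        off-b c ne = cong (unfound tries (lookup P c) ∧_)
            (<?-step (toℕ (lookup P c)) (λ e → ne (toℕ-injective (trans e (sym b≡k)))))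
        before : ∀ c → lookup P c ≡ b → below tries k c ≡ false
        before c p = trans (cong (unfound tries (lookup P c) ∧_) (dec-false (toℕ (lookup P c) <? k)
          (<-irrefl (trans (cong toℕ p) b≡k)))) (∧-zeroʳ _)
        -- A found block leaves the mask unchanged. For an unfound one, passing from k to k + 1
        -- overwrites exactly block b, which by `no-missed` does not change g at this point.
        by-status : ∀ u → unfound tries b ≡ u → g (mix (below tries (suc k)) x z) ≡ g (mix (below tries k) x z)
        by-status false e = cong g (mix-cong same x z)
          where
          same : ∀ c → below tries (suc k) c ≡ below tries k c
          same c with lookup P c ≟F b
          ... | yes p = trans (at-b c p) (trans e (sym (before c p)))
          ... | no ne = off-b c ne
        by-status true e = trans (ruleVal-cong K (λ {c} _ → pointwise c))
          (sym (xor-≡ (trans (sym (cong (_∧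
              (g (mix (below tries k) x z) xor g (mix (block P b) (mix (below tries k) x z) z))) e)) ok)))
          where
          pointwise : ∀ c → lookup (mix (below tries (suc k)) x z) c ≡ lookup
              (mix (block P b) (mix (below tries k) x z) z) c
          pointwise c = trans (lookup-mix (below tries (suc k)) x z c)
            (trans (cases (lookup P c ≟F b)) (sym (lookup-mix (block P b) (mix (below tries k) x z) z c)))
            where
            cases : Dec (lookup P c ≡ b) → (if below tries (suc k) c then lookup z c else lookup x c) ≡
              (if block P b c then lookup z c else lookup (mix (below tries k) x z) c)
            cases (yes p) = trans (if-true (trans (at-b c p) e)) (sym (if-true (dec-true (lookup P c ≟F b) p)))
            cases (no ne) = trans (cong (λ s → if s then lookup z c else lookup x c) (off-b c ne))
              (trans (sym (lookup-mix (below tries k) x z c)) (sym (if-false (dec-false (lookup P c ≟F b) ne))))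
        next : g (mix (below tries (suc k)) x z) ≡ g (mix (below tries k) x z)
        next = by-status (unfound tries b) refl

      fitting : Fits (substRules σ K)
      fitting i = trans (sample-good i) (trans (sym (hybrid i Blocks ≤-refl)) (trans (ruleVal-cong K at)
        (sym (substRules-val σ K (λ b → value i b zero)))))
        where
        below-all : ∀ c → below tries Blocks c ≡ unfound tries (lookup P c)
        below-all c = trans (cong (unfound tries (lookup P c) ∧_)
            (dec-true (toℕ (lookup P c) <? Blocks) (toℕ<n (lookup P c)))) (∧-identityʳ _)
        at : ∀ {c} → c ∈ U → lookup (mix (below tries Blocks) (point i) z) c ≡ assign σ (λ b → value i b zero) c
        at {c} c∈ = trans (lookup-mix (below tries Blocks) (point i) z c)
          (trans (cong (λ s → if s then lookup z c else lookup (point i) c) (below-all c))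
              (by-status (status (lookup P c))))
          where
          by-status : Status (lookup P c) →
              (if unfound tries (lookup P c) then lookup z c else lookup (point i) c) ≡ assign σ
              (λ b → value i b zero) c
          by-status (silent _ u) = trans (if-true u) (cong [ (λ b → value i b zero) , id ]′ (sym (if-true u)))
          by-status (active j d e u d∈ Pd reads) with refl ← distinct d∈ c∈ Pd =
            trans (if-false u) (trans (sym (value-active i (lookup P c) zero j c e reads))
              (cong [ (λ b → value i b zero) , id ]′ (sym (if-false u))))

      accepted : eval (tester (P , tries , tests , z , samples)) f ≡ true
      accepted = accept-intro passing steadily (H-closed σ) fitting

  badPair : Coins → Bool
  badPair (P , ω@(tries , _ , z , samples)) = Fixed.badPoint P ω ∨ Fixed.missed P tries z samples

  accepts : Rare allCoins (λ ω → not (eval (tester ω) f)) 5 16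
  accepts = rare-scale (s≤s z≤n) (*-monoˡ-≤ 16 (m≤m+n 3 2))
      (rare-mono {Q = λ ω → collision (proj₁ ω) ∨ badPair ω} rejected⇒bad
    (rare-∨ {a = 1} {2} collision-rare
        (rare-fixˡ (λ P → rare-∨ {a = 1} {1} (Fixed.badPoint-rare P) (Fixed.missed-rare P)))))
    where
    rejected⇒bad : ∀ ω → not (eval (tester ω) f) ≡ true → collision (proj₁ ω) ∨ badPair ω ≡ true
    rejected⇒bad (P , ω@(tries , tests , z , samples)) rej = or-elim (collision P) (Fixed.badPoint P ω) (λ c p →
      ≢false (λ miss → true≢false (trans (sym rej) (cong not (Fixed.Good.accepted P tries tests z samples c p miss)))))
      where
      ≢false : ∀ {b} → b ≢ false → b ≡ true
      ≢false {true} _ = refl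
      ≢false {false} h = ⊥-elim (h refl)

-- Polynomial bounds

open import Data.Integer using (+_; +[1+_]; ∣_∣)

n≤2^⌈log₂n⌉ : ∀ n → n ≤ 2 ^ ⌈log₂ n ⌉
n≤2^⌈log₂n⌉ = <-rec _ step
  where
  double : ∀ n → n ≤ 2 * ⌈ n /2⌉
  double n = begin
    n                        ≡⟨ ⌊n/2⌋+⌈n/2⌉≡n n ⟨
    ⌊ n /2⌋ + ⌈ n /2⌉        ≤⟨ +-monoˡ-≤ ⌈ n /2⌉ (⌊n/2⌋≤⌈n/2⌉ n) ⟩
    ⌈ n /2⌉ + ⌈ n /2⌉        ≡⟨ cong (λ z → ⌈ n /2⌉ + z) (+-identityʳ ⌈ n /2⌉) ⟨
    2 * ⌈ n /2⌉              ∎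
    where open ≤-Reasoning
  step : ∀ n → (∀ {k} → k < n → k ≤ 2 ^ ⌈log₂ k ⌉) → n ≤ 2 ^ ⌈log₂ n ⌉
  step 0 _ = z≤n
  step 1 _ = ≤-refl
  step n@(suc (suc n′)) rec = begin
    n                              ≤⟨ double n ⟩
    2 * ⌈ n /2⌉                    ≤⟨ *-monoʳ-≤ 2 (rec (⌈n/2⌉<n n′)) ⟩
    2 * 2 ^ ⌈log₂ ⌈ n /2⌉ ⌉        ≡⟨ cong (λ z → 2 * 2 ^ z) (⌈log₂⌈n/2⌉⌉≡⌈log₂n⌉∸1 n) ⟩
    2 ^ suc (⌈log₂ n ⌉ ∸ 1)        ≡⟨ cong (2 ^_)
        (m+[n∸m]≡n {1} {⌈log₂ n ⌉} (⌈log₂⌉-mono-≤ {2} {n} (s≤s (s≤s z≤n)))) ⟩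
    2 ^ ⌈log₂ n ⌉                  ∎
    where open ≤-Reasoning

-- For ε = (a + 1) / (d + 1), the first factor on the right is what the ceiling of 1/ε unfolds to: a
-- negated floor of a negation.
numerator≤ceiling : ∀ d a → + suc d ℤ.≤ ℤ.- ((ℤ.- + suc d) ℤ./ + suc a) ℤ.* + suc a
numerator≤ceiling d a = begin
  + suc d                                        ≡⟨ ℤ.neg-involutive (+ suc d) ⟨
  ℤ.- (ℤ.- + suc d)                              ≤⟨ ℤ.neg-mono-≤ (ℤ.[n/d]*d≤n (ℤ.- + suc d) (+ suc a)) ⟩
  ℤ.- ((ℤ.- + suc d) ℤ./ + suc a ℤ.* + suc a)    ≡⟨ ℤ.neg-distribˡ-* ((ℤ.- + suc d) ℤ./ + suc a) (+ suc a) ⟩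
  ℤ.- ((ℤ.- + suc d) ℤ./ + suc a) ℤ.* + suc a    ∎
  where open ℤ.≤-Reasoning

positive-factor : ∀ d a c → + suc d ℤ.≤ c ℤ.* + suc a → ∃ λ M → c ≡ + suc M × suc d ≤ suc M * suc a
positive-factor d a (+ zero) h = ⊥-elim (ℤ.<-irrefl refl (ℤ.<-≤-trans (ℤ.+<+ (s≤s z≤n)) h))
positive-factor d a (+ suc M) h = M , refl , ℤ.drop‿+≤+ (subst (+ suc d ℤ.≤_) (sym (ℤ.pos-* (suc M) (suc a))) h)

-- Clears the denominators once and for all: the tester and its analysis see ε only through M + 1 =
-- ⌈1/ε⌉.
ceilInv-bound : ∀ ε .{{_ : Positive ε}} → ∃ λ M → ceilInv ε ≡ suc M ×
  (∀ N D → ε ℚ.* ℕtoℚ N ℚ.≤ ℕtoℚ D → N ≤ suc M * D)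
ceilInv-bound ε@(mkℚ +[1+ a ] d _) with positive-factor d a (ℤ.- ((ℤ.- + suc d) ℤ./ + suc a))
    (numerator≤ceiling d a)
... | M , eq , d≤ = M , cong ∣_∣ eq , bound′
  where
  bound′ : ∀ N D → ε ℚ.* ℕtoℚ N ℚ.≤ ℕtoℚ D → N ≤ suc M * D
  bound′ N D h = *-cancelˡ-≤ (suc a) (begin
    suc a * N             ≤⟨ cleared ⟩
    D * suc d             ≤⟨ *-monoʳ-≤ D d≤ ⟩
    D * (suc M * suc a)   ≡⟨ exch D (suc M) (suc a) ⟩
    suc a * (suc M * D)   ∎)
    where
    open ≤-Reasoning
    exch : ∀ a b c → a * (b * c) ≡ c * (b * a)
    exch = solve-∀
    unnormalised : ℚᵘ.mkℚᵘ +[1+ a ] d ℚᵘ.* ℚᵘ.mkℚᵘ (+ N) 0 ℚᵘ.≤ ℚᵘ.mkℚᵘ (+ D) 0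
    unnormalised = ℚᵘ.≤-respˡ-≃ (ℚᵘ.≃-trans (ℚ.toℚᵘ-homo-* ε (ℕtoℚ N))
        (ℚᵘ.*-congˡ {ℚ.toℚᵘ ε} (ℚ.toℚᵘ-fromℚᵘ (ℚᵘ.mkℚᵘ (+ N) 0))))
      (ℚᵘ.≤-respʳ-≃ (ℚ.toℚᵘ-fromℚᵘ (ℚᵘ.mkℚᵘ (+ D) 0)) (ℚ.toℚᵘ-mono-≤ h))
    cleared : suc a * N ≤ D * suc d
    cleared = ℤ.drop‿+≤+ (subst₂ ℤ._≤_
      (trans (ℤ.*-identityʳ _) (sym (ℤ.pos-* (suc a) N)))
      (trans (cong (λ z → + D ℤ.* + z) (*-identityʳ (suc d))) (sym (ℤ.pos-* D (suc d))))
      (ℚᵘ.drop-*≤* unnormalised))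

disagreements-# : (f g : BoolFun n) → disagreements f g ≡ # (cube n) (λ x → f x xor g x)
disagreements-# {n} f g = trans (length-filter-∑ n _) (∑-cong (λ x → cong ⟦_⟧ (not-≟ (f x) (g x))))
  where
  not-≟ : ∀ a b → not (does (_≟ᵇ_ a b)) ≡ a xor b
  not-≟ true true = refl
  not-≟ true false = refl
  not-≟ false true = refl
  not-≟ false false = refl

-- A single power suffices as normal form: the base is at least 2, so constants and sums are
-- absorbed by a larger exponent.
Poly : (ℕ → ℕ) → Set
Poly F = ∃ λ k → ∀ p → F p ≤ (2 + p) ^ k

poly-≤ : ∀ {F G} → (∀ p → F p ≤ G p) → Poly G → Poly F
poly-≤ h (k , b) = k , λ p → ≤-trans (h p) (b p)

poly-const : ∀ c → Poly (λ _ → c)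
poly-const c = c , λ p → ≤-trans (<⇒≤ (n<2^n c)) (^-monoˡ-≤ c (m≤m+n 2 p))

poly-id : Poly (λ p → p)
poly-id = 1 , λ p → ≤-trans (m≤n+m p 2) (≤-reflexive (sym (*-identityʳ _)))

infixl 6 _+ᴾ_
infixl 7 _*ᴾ_

_+ᴾ_ : ∀ {F G} → Poly F → Poly G → Poly (λ p → F p + G p)
_+ᴾ_ {F} {G} (k , b) (l , c) = suc (k + l) , λ p → begin
  F p + G p                                     ≤⟨ +-mono-≤ (≤-trans (b p) (^-monoʳ-≤ (2 + p) (m≤m+n k l)))
      (≤-trans (c p) (^-monoʳ-≤ (2 + p) (m≤n+m l k))) ⟩
  (2 + p) ^ (k + l) + (2 + p) ^ (k + l)         ≡⟨ cong (λ z → (2 + p) ^ (k + l) + z) (+-identityʳ _) ⟨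
  2 * (2 + p) ^ (k + l)                         ≤⟨ *-monoˡ-≤ ((2 + p) ^ (k + l)) (m≤m+n 2 p) ⟩
  (2 + p) ^ suc (k + l)                         ∎
  where open ≤-Reasoning

_*ᴾ_ : ∀ {F G} → Poly F → Poly G → Poly (λ p → F p * G p)
_*ᴾ_ (k , b) (l , c) = k + l , λ p → ≤-trans (*-mono-≤ (b p) (c p))
    (≤-reflexive (sym (^-distribˡ-+-* (2 + p) k l)))

_^ᴾ_ : ∀ {F} → Poly F → ∀ e → Poly (λ p → F p ^ e)
P ^ᴾ zero = poly-const 1
P ^ᴾ suc e = P *ᴾ (P ^ᴾ e)

-- Chosen so that 2 + scale k ≤ 2 ^ a for an a with 2 + a * k + k = scale k, namely a = 4 (k + 5).
scale : ℕ → ℕ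
scale k = 2 + 4 * (k + 5) * k + k

2+scale≤ : ∀ k → 2 + scale k ≤ 2 ^ (4 * (k + 5))
2+scale≤ k = begin
  2 + scale k                              ≤⟨ m≤m+n _ (19 * k + 96) ⟩
  2 + scale k + (19 * k + 96)              ≡⟨ eq k ⟩
  (k + 5) * (k + 5) * 4                    ≤⟨ *-mono-≤ (*-mono-≤ d≤ d≤) 4≤ ⟩
  2 ^ d * 2 ^ d * 2 ^ (2 * d)              ≡⟨ cong (_* 2 ^ (2 * d)) (^-distribˡ-+-* 2 d d) ⟨
  2 ^ (d + d) * 2 ^ (2 * d)                ≡⟨ ^-distribˡ-+-* 2 (d + d) (2 * d) ⟨
  2 ^ (d + d + 2 * d)                      ≡⟨ cong (2 ^_) (eq₂ d) ⟩
  2 ^ (4 * d)                              ∎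
  where
  open ≤-Reasoning
  d = k + 5
  d≤ : d ≤ 2 ^ d
  d≤ = <⇒≤ (n<2^n d)
  4≤ : 4 ≤ 2 ^ (2 * d)
  4≤ = ^-monoʳ-≤ 2 {2} {2 * d} (≤-trans (m≤m+n 2 (2 * k + 8)) (≤-reflexive (eq₃ k)))
    where
    eq₃ : ∀ k → 2 + (2 * k + 8) ≡ 2 * (k + 5)
    eq₃ = solve-∀
  eq : ∀ k → 2 + (2 + 4 * (k + 5) * k + k) + (19 * k + 96) ≡ (k + 5) * (k + 5) * 4
  eq = solve-∀
  eq₂ : ∀ d → d + d + 2 * d ≡ 4 * d
  eq₂ = solve-∀

2+scale*l≤ : ∀ k l → 2 + scale k * suc l ≤ (2 + scale k) * suc l
2+scale*l≤ k l = begin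
  2 + scale k * suc l            ≤⟨ +-monoˡ-≤ _ (m≤m*n 2 (suc l)) ⟩
  2 * suc l + scale k * suc l    ≡⟨ *-distribʳ-+ (suc l) 2 (scale k) ⟨
  (2 + scale k) * suc l          ∎
  where open ≤-Reasoning

-- This breaks the circle in the choice of p. The query points number M ^ 2 poly(p), and with p =
-- `scale k` times the logarithm of M, rounded up to be positive, 2 ^ p still exceeds this.
exponential-beats : ∀ k l → 2 ^ suc l * 2 ^ suc l * (2 + scale k * suc l) ^ k ≤ 2 ^ (scale k * suc l)
exponential-beats k l = begin
  2 ^ L * 2 ^ L * (2 + C * L) ^ k                  ≤⟨ *-monoʳ-≤ (2 ^ L * 2 ^ L) (^-monoˡ-≤ k base) ⟩
  2 ^ L * 2 ^ L * (2 ^ (a * L + L)) ^ k            ≡⟨ cong₂ _*_ (^-distribˡ-+-* 2 L L)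
      (sym (^-*-assoc 2 (a * L + L) k)) ⟨
  2 ^ (L + L) * 2 ^ ((a * L + L) * k)              ≡⟨ ^-distribˡ-+-* 2 (L + L) ((a * L + L) * k) ⟨
  2 ^ (L + L + (a * L + L) * k)                    ≡⟨ cong (2 ^_) (eq a k L) ⟩
  2 ^ (C * L)                                      ∎
  where
  open ≤-Reasoning
  L = suc l
  a = 4 * (k + 5)
  C = scale k
  eq : ∀ a k L → L + L + (a * L + L) * k ≡ (2 + a * k + k) * L
  eq = solve-∀
  base : 2 + C * L ≤ 2 ^ (a * L + L)
  base = begin
    2 + C * L              ≤⟨ 2+scale*l≤ k l ⟩
    (2 + C) * L            ≤⟨ *-mono-≤ (2+scale≤ k) (<⇒≤ (n<2^n L)) ⟩
    2 ^ a * 2 ^ L          ≤⟨ *-monoˡ-≤ (2 ^ L) (^-monoʳ-≤ 2 (m≤m*n a L)) ⟩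
    2 ^ (a * L) * 2 ^ L    ≡⟨ ^-distribˡ-+-* 2 (a * L) L ⟨
    2 ^ (a * L + L)        ∎

-- Blocks are drawn exactly uniformly from random bits, so their number has to be a power of two;
-- the upper bound keeps it polynomial.
powerOfTwo : ∀ x → ∃ λ β → x ≤ 2 ^ β × 2 ^ β ≤ 2 * x + 1
powerOfTwo zero = 0 , z≤n , ≤-refl
powerOfTwo (suc x) with powerOfTwo x
... | β , lo , hi with suc x ≤? 2 ^ β
...   | yes lo′ = β , lo′ , ≤-trans hi (+-monoˡ-≤ 1 (*-monoʳ-≤ 2 (n≤1+n x)))
...   | no ¬lo = suc β , ≤-trans (≤-trans (s≤s lo) (+-monoˡ-≤ (2 ^ β) (m^n>0 2 β)))
    (≤-reflexive (cong (λ z → 2 ^ β + z) (sym (+-identityʳ _)))) ,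
    ≤-trans (*-monoʳ-≤ 2 (≤-trans (<⇒≤ (≰⇒> ¬lo)) ≤-refl)) (m≤m+n _ 1)

-- Choice of the parameters

*16≤2^+4 : ∀ x y → x ≤ 2 ^ y → x * 16 ≤ 2 ^ (y + 4)
*16≤2^+4 x y h = ≤-trans (*-monoˡ-≤ 16 h) (≤-reflexive (sym (^-distribˡ-+-* 2 y 4)))

module Parameters (r : ℕ) (o : List Bool) (o≤2 : length o ≤ 2) where

  s e v β b lT T l t′ N₀ : ℕ → ℕ
  s = keptBound r
  e = errBound r
  v p = s p * r
  β p = proj₁ (powerOfTwo (v p * (v p * 1) * 16))
  -- In the next lines a summand 4 pays for the factor 16 of a union bound; `b p` serves as a crude
  -- bound on its own logarithm.
  b p = 2 ^ β p
  lT p = b p + 4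
  T p = 12 * lT p
  l p = hypBits (b p) r (s p) + 4
  -- p, `l p` and `b p` bound the logarithms of M + 1, `l p` and `b p`. The constant is 3 and not 4
  -- because there are `suc (t′ p)` repetitions.
  t′ p = p + l p + b p + 3
  N₀ p = l p * b p * 16

  -- With M samples per unit of l, M² F bounds the number of potential query
  -- points (weighted by the error e) and M G the number of queries.
  F₁ F₂ F₃ F G : ℕ → ℕ
  F₁ p = b p * (N₀ p * (e p + e p))
  F₂ p = b p * (N₀ p * (T p * (4 * (e p + e p))))
  F₃ p = l p * (b p * (suc (t′ p) * (N₀ p * (e p + e p))))
  F p = (F₁ p + (F₂ p + (F₃ p + l p * e p))) * 16
  G p = b p * (N₀ p * 2) + (b p * (T p * 8) + l p * (1 + b p * (suc (t′ p) * 2)))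

  budget-poly : ∀ k → Poly (budget k)
  budget-poly k = poly-const (2 ^ k) *ᴾ poly-id

  branches-poly : ∀ k → Poly (branches k)
  branches-poly k = budget-poly k *ᴾ poly-const k *ᴾ poly-const 2

  kept-poly : ∀ k → Poly (keptBound k)
  kept-poly zero = budget-poly 0
  kept-poly (suc k) = budget-poly (suc k) +ᴾ branches-poly (suc k) *ᴾ kept-poly k

  err-poly : ∀ k → Poly (errBound k)
  err-poly zero = poly-const 1
  err-poly (suc k) = poly-const 1 +ᴾ branches-poly (suc k) *ᴾ err-poly k

  v-poly : Poly v
  v-poly = kept-poly r *ᴾ poly-const r

  B-poly : Poly b
  B-poly = poly-≤ (λ p → proj₂ (proj₂ (powerOfTwo (v p * (v p * 1) * 16))))
    (poly-const 2 *ᴾ (v-poly *ᴾ (v-poly *ᴾ poly-const 1) *ᴾ poly-const 16) +ᴾ poly-const 1)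

  T-poly : Poly T
  T-poly = poly-const 12 *ᴾ (B-poly +ᴾ poly-const 4)

  l-poly : Poly l
  l-poly = ((poly-const 1 +ᴾ B-poly *ᴾ poly-const 2) ^ᴾ r) *ᴾ poly-const 2 *ᴾ kept-poly r +ᴾ poly-const 4

  t-poly : Poly (λ p → suc (t′ p))
  t-poly = poly-const 1 +ᴾ (poly-id +ᴾ l-poly +ᴾ B-poly +ᴾ poly-const 3)

  N-poly : Poly N₀
  N-poly = l-poly *ᴾ B-poly *ᴾ poly-const 16

  2e-poly : Poly (λ p → e p + e p)
  2e-poly = err-poly r +ᴾ err-poly r

  F-poly : Poly F
  F-poly = (B-poly *ᴾ (N-poly *ᴾ 2e-poly) +ᴾ (B-poly *ᴾ (N-poly *ᴾ (T-poly *ᴾ (poly-const 4 *ᴾ 2e-poly))) +ᴾ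
    (l-poly *ᴾ (B-poly *ᴾ (t-poly *ᴾ (N-poly *ᴾ 2e-poly))) +ᴾ l-poly *ᴾ err-poly r))) *ᴾ poly-const 16

  G-poly : Poly G
  G-poly = B-poly *ᴾ (N-poly *ᴾ poly-const 2) +ᴾ (B-poly *ᴾ (T-poly *ᴾ poly-const 8) +ᴾ
    l-poly *ᴾ (poly-const 1 +ᴾ B-poly *ᴾ (t-poly *ᴾ poly-const 2)))

  C : ℕ
  C = scale (proj₁ F-poly)

  module At (M L n : ℕ) (M≤ : suc M ≤ 2 ^ suc L) where

    -- In `testable` L is ⌈log₂ (M + 1)⌉, which vanishes for ε ≥ 1. The successor keeps p positive
    -- and matches the base ⌈log₂ M⌉ + 1 in the definition of testability.
    p : ℕ
    p = C * suc L

    H : List (List (Rule (Fin (b p))))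
    H = hypotheses (b p) r o (s p)

    reps m : ℕ
    reps = suc M * N₀ p
    m = suc M * l p

    open Tester n (β p) reps (T p) (t′ p) m H

    M≤2^p : suc M ≤ 2 ^ p
    M≤2^p = ≤-trans M≤ (^-monoʳ-≤ 2 (m≤n*m (suc L) C))

    blocks-few : b p * 16 ≤ 2 ^ lT p
    blocks-few = *16≤2^+4 (b p) (b p) (<⇒≤ (n<2^n (b p)))

    hyps-few : length H * 16 ≤ 2 ^ l p
    hyps-few = *16≤2^+4 (length H) (hypBits (b p) r (s p)) (hypotheses-length (b p) r o (s p) o≤2)

    bits-few : (suc M * l p * b p) * 16 ≤ 2 ^ suc (t′ p)
    bits-few = ≤-trans (*16≤2^+4 (suc M * l p * b p) (p + l p + b p) (begin
      suc M * l p * b p              ≤⟨ *-mono-≤ (*-mono-≤ M≤2^p (<⇒≤ (n<2^n (l p)))) (<⇒≤ (n<2^n (b p))) ⟩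
      2 ^ p * 2 ^ l p * 2 ^ b p      ≡⟨ cong (_* 2 ^ b p) (^-distribˡ-+-* 2 p (l p)) ⟨
      2 ^ (p + l p) * 2 ^ b p        ≡⟨ ^-distribˡ-+-* 2 (p + l p) (b p) ⟨
      2 ^ (p + l p + b p)            ∎)) (≤-reflexive (cong (2 ^_) (+-suc (p + l p + b p) 3)))
      where open ≤-Reasoning

    searched : m * (b p * 1) * 16 ≤ suc reps
    searched = ≤-trans (≤-reflexive (eq (suc M) (l p) (b p))) (n≤1+n reps)
      where
      eq : ∀ a b c → a * b * (c * 1) * 16 ≡ a * (b * c * 16)
      eq = solve-∀

    few-points : (b p * (reps * (e p + e p)) + (b p * (reps * (T p * (4 * (e p + e p)))) +
      (m * (b p * (suc (t′ p) * (reps * (e p + e p)))) + m * e p))) * 16 ≤ 2 ^ p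
    few-points = begin
      (b p * (reps * E₂) + (b p * (reps * (T p * (4 * E₂))) +
          (m * (b p * (suc (t′ p) * (reps * E₂))) + m * e p))) * 16
        ≡⟨ cong (λ z → z * 16) (cong₂ _+_ (eq₁ M′ (b p) (N₀ p) E₂)
            (cong₂ _+_ (eq₁ M′ (b p) (N₀ p) (T p * (4 * E₂)))
             (cong₂ _+_ (eq₃ M′ (l p) (b p) (suc (t′ p)) (N₀ p) E₂) (*-assoc M′ (l p) (e p))))) ⟩
      (M′ * F₁ p + (M′ * F₂ p + (M′ * M′ * F₃ p + M′ * (l p * e p)))) * 16
        -- Only the seeds pair a sample with a try and carry the square of M′; the other terms are
        -- raised to the same factor.
        ≤⟨ *-monoˡ-≤ 16 (+-mono-≤ (grow (F₁ p))
            (+-mono-≤ (grow (F₂ p)) (+-monoʳ-≤ (M′ * M′ * F₃ p) (grow (l p * e p))))) ⟩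
      (M′ * M′ * F₁ p + (M′ * M′ * F₂ p + (M′ * M′ * F₃ p + M′ * M′ * (l p * e p)))) * 16
        ≡⟨ eq₄ (M′ * M′) (F₁ p) (F₂ p) (F₃ p) (l p * e p) ⟩
      M′ * M′ * F p
        ≤⟨ *-mono-≤ (*-mono-≤ M≤ M≤) (proj₂ F-poly p) ⟩
      2 ^ suc L * 2 ^ suc L * (2 + C * suc L) ^ proj₁ F-poly
        ≤⟨ exponential-beats (proj₁ F-poly) L ⟩
      2 ^ p ∎
      where
      open ≤-Reasoning
      M′ = suc M
      E₂ = e p + e p
      eq₁ : ∀ m b n x → b * (m * n * x) ≡ m * (b * (n * x))
      eq₁ = solve-∀
      eq₃ : ∀ m l b t n x → m * l * (b * (t * (m * n * x))) ≡ m * m * (l * (b * (t * (n * x))))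
      eq₃ = solve-∀
      eq₄ : ∀ k a b c d → (k * a + (k * b + (k * c + k * d))) * 16 ≡ k * ((a + (b + (c + d))) * 16)
      eq₄ = solve-∀
      grow : ∀ x → M′ * x ≤ M′ * M′ * x
      grow x = *-monoˡ-≤ x (m≤m*n M′ M′)

    -- Linear in M although the union bound over query points is quadratic: only the witness that
    -- was found is probed, whereas that bound ranges over all tries.
    cost-bound : cost ≤ suc M * G p
    cost-bound = begin
      b p * (reps * 2) + (b p * (T p * 8) + m * (1 + b p * (suc (t′ p) * 2)))
        ≤⟨ +-mono-≤ (≤-reflexive (eq₁ M′ (b p) (N₀ p)))
            (+-mono-≤ (m≤n*m (b p * (T p * 8)) M′)
            (≤-reflexive (*-assoc M′ (l p) (1 + b p * (suc (t′ p) * 2))))) ⟩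
      M′ * (b p * (N₀ p * 2)) + (M′ * (b p * (T p * 8)) + M′ * (l p * (1 + b p * (suc (t′ p) * 2))))
        ≡⟨ eq₂ M′ (b p * (N₀ p * 2)) (b p * (T p * 8)) (l p * (1 + b p * (suc (t′ p) * 2))) ⟩
      M′ * G p ∎
      where
      open ≤-Reasoning
      M′ = suc M
      eq₁ : ∀ m b n → b * (m * n * 2) ≡ m * (b * (n * 2))
      eq₁ = solve-∀
      eq₂ : ∀ m a b c → m * a + (m * b + m * c) ≡ m * (a + (b + c))
      eq₂ = solve-∀

    algorithm : RandAlg n
    algorithm = compileAlg allCoins tester

    queries-bound : queries algorithm ≤ (2 + C) ^ proj₁ G-poly * suc M * suc L ^ proj₁ G-poly
    queries-bound = begin
      queries algorithm                        ≤⟨ compileAlg-queries allCoins tester ⟩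
      cost                                     ≤⟨ cost-bound ⟩
      suc M * G p                              ≤⟨ *-monoʳ-≤ (suc M) (proj₂ G-poly p) ⟩
      suc M * (2 + C * suc L) ^ k              ≤⟨ *-monoʳ-≤ (suc M)
          (^-monoˡ-≤ k (2+scale*l≤ (proj₁ F-poly) L)) ⟩
      suc M * ((2 + C) * suc L) ^ k            ≡⟨ cong (suc M *_) (^-distribʳ-* (2 + C) (suc L) k) ⟩
      suc M * ((2 + C) ^ k * suc L ^ k)        ≡⟨ exch (suc M) ((2 + C) ^ k) (suc L ^ k) ⟩
      (2 + C) ^ k * suc M * suc L ^ k          ∎
      where
      open ≤-Reasoning
      k = proj₁ G-poly
      exch : ∀ a b c → a * (b * c) ≡ b * a * c
      exch = solve-∀

    accepts-members : ∀ f → Rules o r n f → ProbAtLeast2/3 algorithm f true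
    accepts-members f (K , valid , f≡) = compileAlg-prob allCoins tester f true
      (rare-mono (λ ω h → trans (xor-comm true (eval (tester ω) f)) h) accepts)
      where
      short = short-rules r o p K valid
      K′ = proj₁ short
      valid′ = proj₁ (proj₂ short)
      length≤ = proj₁ (proj₂ (proj₂ short))
      vars≤ : length (ruleVars K′) ≤ v p
      vars≤ = ≤-trans (ruleVars-length valid′) (*-monoˡ-≤ r length≤)
      open Completeness n (β p) reps (T p) (t′ p) m H f K′
        (λ σ → hypotheses-complete (substRules-valid σ valid′) (≤-trans (substRules-length σ K′) length≤))
        (e p) (2 ^ p) (m^n>0 2 p)
        (rare-mono (λ x h → trans (cong (_xor ruleVal K′ (lookup x)) (sym (f≡ x))) h)
            (proj₂ (proj₂ (proj₂ short))))
        (≤-trans (*-monoˡ-≤ 16 (*-mono-≤ vars≤ (*-monoˡ-≤ 1 vars≤)))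
            (proj₁ (proj₂ (powerOfTwo (v p * (v p * 1) * 16)))))
        searched few-points

    rejects-far : ∀ f → (∀ g → Rules o r n g → 2 ^ n ≤ suc M * disagreements f g) → ProbAtLeast2/3 algorithm
        f false
    rejects-far f far = compileAlg-prob allCoins tester f false
      (rare-mono (λ ω h → trans (sym (xor-identityʳ (eval (tester ω) f))) h) rejects)
      where
      open Soundness n (β p) reps (lT p) (t′ p) M (l p) H blocks-few bits-few hyps-few f
        (λ {h} h∈ σ → ≤-trans (far (λ x → ruleVal (substRules σ h) (lookup x))
            (substRules σ h , substRules-valid σ (hypotheses-sound {s = s p} h∈) , λ _ → refl))
          (≤-reflexive (cong (suc M *_) (trans (disagreements-# f _)
            (E-cong (cube n) (λ x → cong (λ z → ⟦ f x xor z ⟧) (substRules-val σ h (lookup x))))))))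

  testable : TestableWithSoftOInvEps (Rules o r)
  testable = (2 + C) ^ proj₁ G-poly , proj₁ G-poly , λ ε n → tester ε n (ceilInv-bound ε)
    where
    tester : ∀ ε .{{_ : Positive ε}} n →
        (∃ λ M → ceilInv ε ≡ suc M × (∀ N D → ε ℚ.* ℕtoℚ N ℚ.≤ ℕtoℚ D → N ≤ suc M * D)) →
      Σ (RandAlg n) λ A → IsTester (Rules o r) ε A ×
        queries A ≤ (2 + C) ^ proj₁ G-poly * ceilInv ε * (⌈log₂ ceilInv ε ⌉ + 1) ^ proj₁ G-poly
    tester ε n (M , eq , clear) = algorithm ,
        (accepts-members , λ f far → rejects-far f (λ g Cg → clear (2 ^ n) (disagreements f g) (far g Cg))) ,
      subst₂ (λ x y → queries algorithm ≤ (2 + C) ^ proj₁ G-poly * x * y ^ proj₁ G-poly) (sym eq)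
        (trans (cong (λ z → suc ⌈log₂ z ⌉) (sym eq)) (+-comm 1 ⌈log₂ ceilInv ε ⌉)) queries-bound
      where
      open At M ⌈log₂ suc M ⌉ n (≤-trans (n≤2^⌈log₂n⌉ (suc M)) (^-monoʳ-≤ 2 (n≤1+n ⌈log₂ suc M ⌉)))

theorem22 : (r : ℕ) → TestableWithSoftOInvEps (RDL r) × TestableWithSoftOInvEps (RDNF r)
theorem22 r = testable-≅ (rules⇒dl r) (dl⇒rules r) (Parameters.testable r both ≤-refl) ,
              testable-≅ (rules⇒dnf r) (dnf⇒rules r) (Parameters.testable r (true ∷ []) (s≤s z≤n))
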